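{- Let $p$ be a prime, $q=p^l$, $n\ge 2$ and $k\ge1$ integers, and let $d=\gcd(k,q-1)$. If $q\ge (d-1)^4+6d$, then every matrix in $M_n(\mathbb F_q)$ is of the form $A^k+B^k$ with $A,B\in M_n(\mathbb F_q)$ split semisimple.
   Context: A matrix over a field $K$ is split semisimple (diagonalizable) if its minimal polynomial is a product of distinct monic polynomials of degree $1$ in $K[x]$. -}

module Defs where

open import Level using (Level; _⊔_)
open import Data.Nat using (ℕ; zero; suc; _≤_)
open import Data.Fin using (Fin; zero; suc)
open import Data.Vec using (Vec; []; _∷_; _∷ʳ_; zipWith; map; lookup)
open import Data.Product using (Σ; ∃; _×_; _,_)
open import Relation.Nullary using (¬_)
open import Relation.Binary.PropositionalEquality using (_≡_)
open import Algebra.Bundles using (CommutativeRing)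

record IsField {c ℓ : Level} (R : CommutativeRing c ℓ) : Set (c ⊔ ℓ) where
  open CommutativeRing R hiding (zero)
  field
    1≉0 : ¬ (1# ≈ 0#)
    inverse : ∀ x → ¬ (x ≈ 0#) → ∃ λ y → (x * y) ≈ 1#

record HasCardinality {c ℓ : Level} (R : CommutativeRing c ℓ) (q : ℕ) : Set (c ⊔ ℓ) where
  open CommutativeRing R hiding (zero)
  field
    enum : Fin q → Carrier
    enum-injective : ∀ i j → enum i ≈ enum j → i ≡ j
    enum-surjective : ∀ x → ∃ λ i → enum i ≈ x

module MatrixDefs {c ℓ : Level} (R : CommutativeRing c ℓ) where
  open CommutativeRing R hiding (zero)

  ∑ : ∀ {m} → (Fin m → Carrier) → Carrier
  ∑ {zero} f = 0#
  ∑ {suc m} f = f zero + ∑ (λ i → f (suc i))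

  Mat : ℕ → Set c
  Mat n = Fin n → Fin n → Carrier

  _≈ᴹ_ : ∀ {n} → Mat n → Mat n → Set ℓ
  A ≈ᴹ B = ∀ i j → A i j ≈ B i j

  _+ᴹ_ : ∀ {n} → Mat n → Mat n → Mat n
  (A +ᴹ B) i j = A i j + B i j

  _*ᴹ_ : ∀ {n} → Mat n → Mat n → Mat n
  (A *ᴹ B) i j = ∑ (λ k → A i k * B k j)

  _•ᴹ_ : ∀ {n} → Carrier → Mat n → Mat n
  (a •ᴹ A) i j = a * A i j

  0ᴹ : ∀ {n} → Mat n
  0ᴹ i j = 0#

  Iᴹ : ∀ {n} → Mat n
  Iᴹ zero zero = 1#
  Iᴹ zero (suc j) = 0#
  Iᴹ (suc i) zero = 0#
  Iᴹ (suc i) (suc j) = Iᴹ i j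

  _^ᴹ_ : ∀ {n} → Mat n → ℕ → Mat n
  A ^ᴹ zero = Iᴹ
  A ^ᴹ suc k = A *ᴹ (A ^ᴹ k)

  -- A monic polynomial of degree m, x^m + c_{m-1} x^{m-1} + … + c_0,
  -- is represented by its lower coefficients (c_0, …, c_{m-1}).
  MonicPoly : ℕ → Set c
  MonicPoly m = Vec Carrier m

  -- evaluation at a matrix (Horner scheme, leading coefficient 1)
  evalᴹ : ∀ {n m} → MonicPoly m → Mat n → Mat n
  evalᴹ [] A = Iᴹ
  evalᴹ (a ∷ cs) A = (a •ᴹ Iᴹ) +ᴹ (A *ᴹ evalᴹ cs A)

  IsMinimalPolynomial : ∀ {n m} → Mat n → MonicPoly m → Set (c ⊔ ℓ)
  IsMinimalPolynomial {n} {m} A p =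
    (evalᴹ p A ≈ᴹ 0ᴹ) ×
    (∀ m' (p' : MonicPoly m') → evalᴹ p' A ≈ᴹ 0ᴹ → m ≤ m')

  mulLinear : ∀ {m} → Carrier → MonicPoly m → MonicPoly (suc m)
  mulLinear λ₀ cs = zipWith _+_ (0# ∷ cs) (map (λ a → - λ₀ * a) (cs ∷ʳ 1#))

  prodLinear : ∀ {r} → Vec Carrier r → MonicPoly r
  prodLinear [] = []
  prodLinear (λ₀ ∷ ls) = mulLinear λ₀ (prodLinear ls)

  SplitSemisimple : ∀ {n} → Mat n → Set (c ⊔ ℓ)
  SplitSemisimple A =
    Σ ℕ λ r → Σ (Vec Carrier r) λ ls →
      (∀ i j → lookup ls i ≈ lookup ls j → i ≡ j) ×
      IsMinimalPolynomial A (prodLinear ls)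

{-# OPTIONS --safe #-}

-- A diagonalizable matrix whose eigenvalues are k-th powers is the k-th power of a split semisimple matrix,
-- so it suffices to write M = A + B with A and B diagonalizable and all eigenvalues k-th powers.
--
-- Arithmetic: let e ≤ d be the number of k-th roots of unity and φ(x) = #{y ≠ 0 : yᵏ = x} - 1 for x ≠ 0.
-- A Cauchy-Schwarz estimate for the incidences of points and lines weighted by φ bounds the sums
-- Σ φ(x) φ(a - x), and q ≥ (e - 1)⁴ + 6 e then forces every a ≠ 0 to be a sum of two nonzero k-th powers.
--
-- Linear algebra: picking chains v, Mv, …, Mʳv greedily by decreasing length yields a basis in which M sends the
-- final vector of every chain to a multiple of itself plus non-final vectors; for the chains of length one the
-- multiple is always the same. Replacing Mⁱv by (M - aᵢ)⋯(M - a₁)v makes the diagonal entries along a chain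
-- arbitrary up to their sum. The subdiagonal entries of a chain are given alternately to A and to B, and the
-- columns of the final vectors to A. If A has only the eigenvalues c₁ and c₂ on the non-final vectors and other
-- ones at the final vectors, and entries joined by a subdiagonal entry differ, both parts are diagonalizable.
module Submission where

open import Defs
open import Level using (Level; _⊔_; 0ℓ)
open import Algebra.Bundles using (CommutativeRing; RawRing)
open import Algebra.Morphism.Structures using (IsRingMonomorphism)
import Algebra.Morphism.RingMonomorphism as RingMonomorphism
open import Algebra.Structures using (IsCommutativeRing)
open import Data.Bool.Base using (Bool; true; false; if_then_else_; not)
open import Data.Empty using (⊥)
open import Data.Fin.Base using (Fin; zero; suc; punchIn; toℕ; finToFun; funToFin)
open import Data.Fin.Permutation using (permutation)
open import Data.Fin.Properties as Fin using (all?; any?; finToFun-funToFin; pigeonhole; punchInᵢ≢i; suc-injective; toℕ<n)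
open import Data.Integer.Base as ℤ using (ℤ; +_; -[1+_])
import Data.Integer.Properties as ℤ
open import Data.Integer.Tactic.RingSolver using (solve-∀)
open import Data.List.Base using (List; []; _∷_; _++_; map; allFin)
open import Data.List.Membership.Propositional using (_∈_)
open import Data.List.Membership.Propositional.Properties using (∈-allFin; ∈-map⁺)
open import Data.List.Properties using (map-++; map-∘)
open import Data.List.Relation.Unary.All as All using (All; []; _∷_)
open import Data.List.Relation.Unary.All.Properties using (++⁺; map⁺; map⁻)
open import Data.Maybe.Base using (Maybe; just; nothing)
open import Data.Nat.Base as ℕ using (ℕ; zero; suc)
open import Data.Nat.GCD using (gcd; gcd-GCD; gcd[m,n]≡0⇒m≡0; module Bézout)
open import Data.Nat.Primality using (Prime)
import Data.Nat.Properties as ℕ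
open import Data.Product.Base using (Σ; ∃; _×_; _,_; proj₁; proj₂)
open import Data.Sum.Base using (_⊎_; inj₁; inj₂; [_,_])
open import Data.Vec.Base as Vec using (Vec; []; _∷_; lookup; replicate; zipWith; _∷ʳ_)
open import Function.Base using (_∘_)
open import Relation.Binary.PropositionalEquality as ≡ using (_≡_; _≢_)
open import Relation.Nullary using (¬_; Dec; yes; no; does; contradiction)
open import Relation.Nullary.Decidable using (map′; ¬?; decidable-stable; _×-dec_; _⊎-dec_)

-- The arithmetic uses neither complex characters nor square roots: Cauchy-Schwarz enters as
-- positivity of a quadratic form at an integer parameter. If a ≠ 0 were no sum of two nonzero
-- powers, the correlation of φ at a would be 2 ν(a) - q, while the incidence estimate keeps it
-- above roughly -(e - 1)² √q. This is the origin of the fourth power; 6 e pays for the lower-order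
-- terms.
--
-- Along a chain only the sum of the diagonal is prescribed, so chains of two vectors are critical:
-- their trace must be α + t + β + u with α in {c₁, c₂}, t outside it and β ≠ u. For each α this can
-- fail for at most three traces, and keeping c₂ / c₁ away from 1, -1, 3 and 1/3 makes one α
-- succeed, except for trace 0 in characteristic 3, which is treated separately according to whether
-- -1 is a power. Chains of one vector have no freedom, but they share one scalar a, so the pair
-- only has to avoid one summand of a. The last subdiagonal entry goes to B so that the non-final
-- vectors of all chains span an A-invariant subspace.

-- Ring solver with integer coefficients

module IntegerCoefficientSolver {c ℓ : Level} (R : CommutativeRing c ℓ) where
  open CommutativeRing R hiding (zero)
  open import Algebra.Properties.Ring ring using (-‿distribˡ-*; -‿distribʳ-*; -‿involutive; -‿+-comm; -0#≈0#)
  open import Algebra.Properties.Semiring.Mult.TCOptimised semiring using (×-homo-+; ×1-homo-*; 1+×) renaming (_×_ to _×ₙ_)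
  open import Algebra.Solver.Ring.AlmostCommutativeRing
  open import Relation.Binary.Reasoning.Setoid setoid

  ⟦_⟧ℤ : ℤ → Carrier
  ⟦ + n ⟧ℤ = n ×ₙ 1#
  ⟦ -[1+ n ] ⟧ℤ = - (suc n ×ₙ 1#)

  cancel-1 : ∀ a b → a + - b ≈ (1# + a) + - (1# + b)
  cancel-1 a b = sym (begin
    (1# + a) + - (1# + b)     ≈⟨ +-cong (+-comm 1# a) (sym (-‿+-comm 1# b)) ⟩
    (a + 1#) + (- 1# + - b)   ≈⟨ +-assoc a 1# _ ⟩
    a + (1# + (- 1# + - b))   ≈⟨ +-congˡ (sym (+-assoc 1# (- 1#) (- b))) ⟩
    a + ((1# + - 1#) + - b)   ≈⟨ +-congˡ (+-congʳ (-‿inverseʳ 1#)) ⟩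
    a + (0# + - b)            ≈⟨ +-congˡ (+-identityˡ _) ⟩
    a + - b                   ∎)

  ⊖-homo : ∀ m n → ⟦ m ℤ.⊖ n ⟧ℤ ≈ m ×ₙ 1# + - (n ×ₙ 1#)
  ⊖-homo zero zero = sym (trans (+-identityˡ _) -0#≈0#)
  ⊖-homo zero (suc n) = sym (+-identityˡ _)
  ⊖-homo (suc m) zero = sym (trans (+-congˡ -0#≈0#) (+-identityʳ _))
  ⊖-homo (suc m) (suc n) = begin
    ⟦ suc m ℤ.⊖ suc n ⟧ℤ         ≡⟨ ≡.cong ⟦_⟧ℤ (ℤ.[1+m]⊖[1+n]≡m⊖n m n) ⟩
    ⟦ m ℤ.⊖ n ⟧ℤ                 ≈⟨ ⊖-homo m n ⟩
    m ×ₙ 1# + - (n ×ₙ 1#)        ≈⟨ cancel-1 (m ×ₙ 1#) (n ×ₙ 1#) ⟩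
    (1# + m ×ₙ 1#) + - (1# + n ×ₙ 1#) ≈⟨ +-cong (1+× m 1#) (-‿cong (1+× n 1#)) ⟨
    suc m ×ₙ 1# + - (suc n ×ₙ 1#) ∎

  ⟦⟧-+ : ∀ i j → ⟦ i ℤ.+ j ⟧ℤ ≈ ⟦ i ⟧ℤ + ⟦ j ⟧ℤ
  ⟦⟧-+ (+ m) (+ n) = ×-homo-+ 1# m n
  ⟦⟧-+ (+ m) -[1+ n ] = ⊖-homo m (suc n)
  ⟦⟧-+ -[1+ m ] (+ n) = trans (⊖-homo n (suc m)) (+-comm _ _)
  ⟦⟧-+ -[1+ m ] -[1+ n ] = begin
    - (suc (suc (m ℕ.+ n)) ×ₙ 1#)       ≡⟨ ≡.cong (λ z → - (suc z ×ₙ 1#)) (≡.sym (ℕ.+-suc m n)) ⟩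
    - ((suc m ℕ.+ suc n) ×ₙ 1#)         ≈⟨ -‿cong (×-homo-+ 1# (suc m) (suc n)) ⟩
    - (suc m ×ₙ 1# + suc n ×ₙ 1#)        ≈⟨ sym (-‿+-comm _ _) ⟩
    - (suc m ×ₙ 1#) + - (suc n ×ₙ 1#)    ∎

  ⟦⟧-neg : ∀ i → ⟦ ℤ.- i ⟧ℤ ≈ - ⟦ i ⟧ℤ
  ⟦⟧-neg (+ zero) = sym -0#≈0#
  ⟦⟧-neg (+ suc n) = refl
  ⟦⟧-neg -[1+ n ] = sym (-‿involutive _)

  ⟦⟧-*-pos : ∀ m j → ⟦ + m ℤ.* j ⟧ℤ ≈ m ×ₙ 1# * ⟦ j ⟧ℤ
  ⟦⟧-*-pos m (+ n) = trans (reflexive (≡.cong ⟦_⟧ℤ (≡.sym (ℤ.pos-* m n)))) (×1-homo-* m n)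
  ⟦⟧-*-pos m -[1+ n ] = begin
    ⟦ + m ℤ.* -[1+ n ] ⟧ℤ        ≡⟨ ≡.cong ⟦_⟧ℤ (≡.sym (ℤ.neg-distribʳ-* (+ m) (+ suc n))) ⟩
    ⟦ ℤ.- (+ m ℤ.* + suc n) ⟧ℤ   ≈⟨ ⟦⟧-neg (+ m ℤ.* + suc n) ⟩
    - ⟦ + m ℤ.* + suc n ⟧ℤ       ≈⟨ -‿cong (⟦⟧-*-pos m (+ suc n)) ⟩
    - (m ×ₙ 1# * (suc n ×ₙ 1#))    ≈⟨ -‿distribʳ-* _ _ ⟩
    m ×ₙ 1# * - (suc n ×ₙ 1#)      ∎

  ⟦⟧-* : ∀ i j → ⟦ i ℤ.* j ⟧ℤ ≈ ⟦ i ⟧ℤ * ⟦ j ⟧ℤ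
  ⟦⟧-* (+ m) j = ⟦⟧-*-pos m j
  ⟦⟧-* -[1+ m ] j = begin
    ⟦ -[1+ m ] ℤ.* j ⟧ℤ          ≡⟨ ≡.cong ⟦_⟧ℤ (≡.sym (ℤ.neg-distribˡ-* (+ suc m) j)) ⟩
    ⟦ ℤ.- (+ suc m ℤ.* j) ⟧ℤ     ≈⟨ ⟦⟧-neg (+ suc m ℤ.* j) ⟩
    - ⟦ + suc m ℤ.* j ⟧ℤ         ≈⟨ -‿cong (⟦⟧-*-pos (suc m) j) ⟩
    - (suc m ×ₙ 1# * ⟦ j ⟧ℤ)      ≈⟨ -‿distribˡ-* _ _ ⟩
    - (suc m ×ₙ 1#) * ⟦ j ⟧ℤ      ∎

  -- Integer coefficients let numerals such as 3 be normalised and opposite terms cancel in any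
  -- commutative ring, whose own equality need not be decidable.
  integerMorphism : ℤ.+-*-rawRing -Raw-AlmostCommutative⟶ fromCommutativeRing R
  integerMorphism = record
    { ⟦_⟧ = ⟦_⟧ℤ ; +-homo = ⟦⟧-+ ; *-homo = ⟦⟧-* ; -‿homo = ⟦⟧-neg
    ; 0-homo = refl ; 1-homo = refl }

  coefficientEquality : (i j : ℤ) → Maybe (⟦ i ⟧ℤ ≈ ⟦ j ⟧ℤ)
  coefficientEquality i j with i ℤ.≟ j
  ... | yes ≡.refl = just refl
  ... | no _ = nothing

  open import Algebra.Solver.Ring ℤ.+-*-rawRing (fromCommutativeRing R) integerMorphism coefficientEquality public
    using (solve; _:=_; _:+_; _:*_; _:-_; :-_; con)

-- Horner evaluation and synthetic division

module MonicPolynomials {c ℓ : Level} (R : CommutativeRing c ℓ) where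
  open CommutativeRing R hiding (zero)
  open IntegerCoefficientSolver R
  open import Algebra.Properties.Semiring.Exp semiring using (_^_)
  open import Relation.Binary.Reasoning.Setoid setoid

  peval : ∀ {m} → Vec Carrier m → Carrier → Carrier
  peval [] x = 1#
  peval (c ∷ cs) x = c + x * peval cs x

  -- Synthetic division: the coefficients of the quotient by x - a are the intermediate Horner values.
  quotient : ∀ {m} → Carrier → Vec Carrier (suc m) → Vec Carrier m
  quotient a (c ∷ []) = []
  quotient a (c ∷ cs@(_ ∷ _)) = peval cs a ∷ quotient a cs

  quotient-correct : ∀ {m} a (p : Vec Carrier (suc m)) x →
    peval p x ≈ (x - a) * peval (quotient a p) x + peval p a
  quotient-correct a (c ∷ []) x =
    solve 4 (λ a c x o → c :+ x :* o := (x :- a) :* o :+ (c :+ a :* o)) refl a c x 1#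
  quotient-correct a (c ∷ cs@(_ ∷ _)) x = begin
    c + x * peval cs x
      ≈⟨ +-congˡ (*-congˡ (quotient-correct a cs x)) ⟩
    c + x * ((x - a) * peval (quotient a cs) x + peval cs a)
      ≈⟨ solve 5 (λ a c x u v → c :+ x :* ((x :- a) :* u :+ v) :=
                   (x :- a) :* (v :+ x :* u) :+ (c :+ a :* v)) refl a c x
                   (peval (quotient a cs) x) (peval cs a) ⟩
    (x - a) * (peval cs a + x * peval (quotient a cs) x) + (c + a * peval cs a) ∎

  quotient-root : ∀ {m} a (p : Vec Carrier (suc m)) → peval p a ≈ 0# → ∀ x →
    peval p x ≈ (x - a) * peval (quotient a p) x
  quotient-root a p pa≈0 x = trans (quotient-correct a p x) (trans (+-congˡ pa≈0) (+-identityʳ _))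

  peval-replicate : ∀ m x → peval (replicate m 0#) x ≈ x ^ m
  peval-replicate zero x = refl
  peval-replicate (suc m) x = trans (+-identityˡ _) (*-congˡ (peval-replicate m x))

-- Counting k-th powers in a finite field on `Fin q`

module PowerCounting where
  open import Relation.Binary.PropositionalEquality
  open import Data.Fin.Properties using (_≟_)
  open import Data.Integer.Base using (0ℤ; 1ℤ; _+_; _*_; -_; _-_; _≤_; _<_)
  open import Algebra.Properties.Semiring.Sum ℤ.+-*-semiring
    using (sum; sum-cong-≗; ∑-distrib-+; ∑-comm; sum-permute; *-distribˡ-sum; *-distribʳ-sum; sum-replicate-zero)

  sum-zero : ∀ {n} {f : Fin n → ℤ} → (∀ i → f i ≡ 0ℤ) → sum f ≡ 0ℤ
  sum-zero {n} f≡0 = trans (sum-cong-≗ f≡0) (sum-replicate-zero n)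

  sum-mono-≤ : ∀ {n} {f g : Fin n → ℤ} → (∀ i → f i ≤ g i) → sum f ≤ sum g
  sum-mono-≤ {zero} f≤g = ℤ.≤-refl
  sum-mono-≤ {suc n} f≤g = ℤ.+-mono-≤ (f≤g zero) (sum-mono-≤ (λ i → f≤g (suc i)))

  sum-nonNegative : ∀ {n} {f : Fin n → ℤ} → (∀ i → 0ℤ ≤ f i) → 0ℤ ≤ sum f
  sum-nonNegative {zero} 0≤f = ℤ.≤-refl
  sum-nonNegative {suc n} 0≤f = ℤ.+-mono-≤ (0≤f zero) (sum-nonNegative (λ i → 0≤f (suc i)))

  sum-const : ∀ n x → sum {n} (λ _ → x) ≡ + n * x
  sum-const zero x = sym (ℤ.*-zeroˡ x)
  sum-const (suc n) x = trans (cong (λ t → x + t) (sum-const n x)) (sym (ℤ.suc-* (+ n) x))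

  sum-distrib-- : ∀ {n} (f g : Fin n → ℤ) → sum (λ i → f i - g i) ≡ sum f - sum g
  sum-distrib-- {zero} f g = refl
  sum-distrib-- {suc n} f g = trans (cong (λ t → f zero - g zero + t) (sum-distrib-- (λ i → f (suc i)) (λ i → g (suc i))))
    (eq (f zero) (g zero) _ _)
    where
    eq : ∀ a b c d → (a - b) + (c - d) ≡ (a + c) - (b + d)
    eq = solve-∀

  0≤square : ∀ i → 0ℤ ≤ i * i
  0≤square (+ n) = subst (0ℤ ≤_) (ℤ.pos-* n n) (ℤ.+≤+ ℕ.z≤n)
  0≤square -[1+ n ] = ℤ.+≤+ ℕ.z≤n

  0≤+ : ∀ {i j} → 0ℤ ≤ i → 0ℤ ≤ j → 0ℤ ≤ i + j
  0≤+ = ℤ.+-mono-≤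

  0≤* : ∀ {i j} → 0ℤ ≤ i → 0ℤ ≤ j → 0ℤ ≤ i * j
  0≤* {+ m} {+ n} _ _ = subst (0ℤ ≤_) (ℤ.pos-* m n) (ℤ.+≤+ ℕ.z≤n)

  indicator : Bool → ℤ
  indicator b = if b then 1ℤ else 0ℤ

  0≤indicator : ∀ b → 0ℤ ≤ indicator b
  0≤indicator true = ℤ.+≤+ ℕ.z≤n
  0≤indicator false = ℤ.+≤+ ℕ.z≤n

  δ : ∀ {n} → Fin n → Fin n → ℤ
  δ x y = indicator (does (x ≟ y))

  δ-refl : ∀ {n} {x y : Fin n} → x ≡ y → δ x y ≡ 1ℤ
  δ-refl {x = x} {y} x≡y with x ≟ y
  ... | yes _ = refl
  ... | no x≢y = contradiction x≡y x≢y

  δ-≢ : ∀ {n} {x y : Fin n} → x ≢ y → δ x y ≡ 0ℤ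
  δ-≢ {x = x} {y} x≢y with x ≟ y
  ... | yes x≡y = contradiction x≡y x≢y
  ... | no _ = refl

  δ-⇔ : ∀ {m n} {x y : Fin m} {z w : Fin n} → (x ≡ y → z ≡ w) → (z ≡ w → x ≡ y) → δ x y ≡ δ z w
  δ-⇔ {x = x} {y} f g with x ≟ y
  ... | yes x≡y = sym (δ-refl (f x≡y))
  ... | no x≢y = sym (δ-≢ (λ z≡w → x≢y (g z≡w)))

  δ-sum : ∀ {n} (x : Fin n) (g : Fin n → ℤ) → sum (λ y → δ x y * g y) ≡ g x
  δ-sum {suc n} zero g = begin
    1ℤ * g zero + sum {n} (λ y → 0ℤ * g (suc y)) ≡⟨ cong₂ _+_ (ℤ.*-identityˡ (g zero)) (sum-zero {n} (λ y → ℤ.*-zeroˡ (g (suc y)))) ⟩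
    g zero + 0ℤ ≡⟨ ℤ.+-identityʳ _ ⟩
    g zero ∎
    where open ≡-Reasoning
  δ-sum {suc n} (suc x) g = begin
    0ℤ * g zero + sum (λ y → δ x y * g (suc y)) ≡⟨ cong₂ _+_ (ℤ.*-zeroˡ (g zero)) (δ-sum x (λ y → g (suc y))) ⟩
    0ℤ + g (suc x) ≡⟨ ℤ.+-identityˡ _ ⟩
    g (suc x) ∎
    where open ≡-Reasoning

  sum-bijection : ∀ {n} (f g : Fin n → Fin n) → (∀ x → f (g x) ≡ x) → (∀ x → g (f x) ≡ x) →
    ∀ (h : Fin n → ℤ) → sum (λ x → h (f x)) ≡ sum h
  sum-bijection f g fg gf h = sym (sum-permute h (permutation f g fg gf))

  record FiniteField (q : ℕ) : Set where
    infixl 6 _⊕_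
    infixl 7 _⊛_
    infix 8 ⊖_
    field
      _⊕_ _⊛_ : Fin q → Fin q → Fin q
      ⊖_ : Fin q → Fin q
      𝟘 𝟙 : Fin q
      isCommutativeRing : IsCommutativeRing _≡_ _⊕_ _⊛_ ⊖_ 𝟘 𝟙
      𝟙≢𝟘 : 𝟙 ≢ 𝟘
      inverse : ∀ x → x ≢ 𝟘 → ∃ λ y → x ⊛ y ≡ 𝟙

    commutativeRing : CommutativeRing 0ℓ 0ℓ
    commutativeRing = record { isCommutativeRing = isCommutativeRing }

  module PowerSums {q : ℕ} (K : FiniteField q) (k : ℕ) where
    open FiniteField K
    private
      module R = CommutativeRing commutativeRing
    open IntegerCoefficientSolver commutativeRing using (solve; _:=_; _:+_; _:*_; _:-_)
    open import Algebra.Properties.Semiring.Exp R.semiring using (_^_)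
    open import Algebra.Properties.CommutativeSemiring.Exp R.commutativeSemiring using (^-distrib-*)
    open ≡-Reasoning

    infixl 6 _⊟_
    _⊟_ : Fin q → Fin q → Fin q
    x ⊟ y = x ⊕ (⊖ y)

    ⊛-cancelˡ : ∀ {x y z} → x ≢ 𝟘 → x ⊛ y ≡ x ⊛ z → y ≡ z
    ⊛-cancelˡ {x} {y} {z} x≢0 eq with x' , xx' ← inverse x x≢0 = begin
      y              ≡⟨ R.*-identityˡ y ⟨
      𝟙 ⊛ y          ≡⟨ cong (_⊛ y) xx' ⟨
      (x ⊛ x') ⊛ y   ≡⟨ solve 3 (λ x x' y → x :* x' :* y := x' :* (x :* y)) refl x x' y ⟩
      x' ⊛ (x ⊛ y)   ≡⟨ cong (x' ⊛_) eq ⟩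
      x' ⊛ (x ⊛ z)   ≡⟨ solve 3 (λ x x' y → x :* x' :* y := x' :* (x :* y)) refl x x' z ⟨
      (x ⊛ x') ⊛ z   ≡⟨ cong (_⊛ z) xx' ⟩
      𝟙 ⊛ z          ≡⟨ R.*-identityˡ z ⟩
      z              ∎

    ⊛-≢𝟘 : ∀ {x y} → x ≢ 𝟘 → y ≢ 𝟘 → x ⊛ y ≢ 𝟘
    ⊛-≢𝟘 {x} x≢0 y≢0 eq = y≢0 (⊛-cancelˡ x≢0 (trans eq (sym (R.zeroʳ x))))

    ^-≢𝟘 : ∀ {x} m → x ≢ 𝟘 → x ^ m ≢ 𝟘
    ^-≢𝟘 zero x≢0 = 𝟙≢𝟘
    ^-≢𝟘 (suc m) x≢0 = ⊛-≢𝟘 x≢0 (^-≢𝟘 m x≢0)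

    ∑-translate : ∀ (h : Fin q → ℤ) b → sum (λ x → h (x ⊕ b)) ≡ sum h
    ∑-translate h b = sum-bijection (_⊕ b) (_⊟ b)
      (λ x → solve 2 (λ x b → x :- b :+ b := x) refl x b)
      (λ x → solve 2 (λ x b → x :+ b :- b := x) refl x b) h

    ∑-reflect : ∀ (h : Fin q → ℤ) b → sum (λ x → h (b ⊟ x)) ≡ sum h
    ∑-reflect h b = sum-bijection (b ⊟_) (b ⊟_) inv inv h
      where
      inv : ∀ x → b ⊟ (b ⊟ x) ≡ x
      inv x = solve 2 (λ x b → b :- (b :- x) := x) refl x b

    ∑-scale : ∀ (h : Fin q → ℤ) {a} → a ≢ 𝟘 → sum (λ x → h (a ⊛ x)) ≡ sum h
    ∑-scale h {a} a≢0 with a' , aa' ← inverse a a≢0 = sum-bijection (a ⊛_) (a' ⊛_)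
      (λ x → trans (sym (R.*-assoc a a' x)) (trans (cong (_⊛ x) aa') (R.*-identityˡ x)))
      (λ x → trans (sym (R.*-assoc a' a x)) (trans (cong (_⊛ x) (trans (R.*-comm a' a) aa')) (R.*-identityˡ x)))
      h

    nz : Fin q → ℤ
    nz x = indicator (not (does (x ≟ 𝟘)))

    nz-≢ : ∀ {x} → x ≢ 𝟘 → nz x ≡ 1ℤ
    nz-≢ {x} x≢0 with x ≟ 𝟘
    ... | yes x≡0 = contradiction x≡0 x≢0
    ... | no _ = refl

    nz-𝟘 : ∀ {x} → x ≡ 𝟘 → nz x ≡ 0ℤ
    nz-𝟘 {x} x≡0 with x ≟ 𝟘
    ... | yes _ = refl
    ... | no x≢0 = contradiction x≡0 x≢0

    nz-cong-* : ∀ x {i j : ℤ} → (x ≢ 𝟘 → i ≡ j) → nz x * i ≡ nz x * j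
    nz-cong-* x f with x ≟ 𝟘
    ... | yes _ = refl
    ... | no x≢0 = cong (1ℤ *_) (f x≢0)

    nz-δ : ∀ x → nz x ≡ 1ℤ - δ 𝟘 x
    nz-δ x with x ≟ 𝟘
    ... | yes x≡0 = cong (λ t → 1ℤ - t) (sym (δ-refl (sym x≡0)))
    ... | no x≢0 = cong (λ t → 1ℤ - t) (sym (δ-≢ (λ 0≡x → x≢0 (sym 0≡x))))

    nz-scale : ∀ {a} x → a ≢ 𝟘 → nz (a ⊛ x) ≡ nz x
    nz-scale {a} x a≢0 with x ≟ 𝟘
    ... | yes x≡0 = nz-𝟘 (trans (cong (a ⊛_) x≡0) (R.zeroʳ a))
    ... | no x≢0 = nz-≢ (⊛-≢𝟘 a≢0 x≢0)

    0≤nz : ∀ x → 0ℤ ≤ nz x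
    0≤nz x = 0≤indicator (not (does (x ≟ 𝟘)))

    N : ℤ
    N = sum nz

    ∑-nz : ∀ g → sum (λ x → nz x * g x) ≡ sum g - g 𝟘
    ∑-nz g = begin
      sum (λ x → nz x * g x)              ≡⟨ sum-cong-≗ (λ x → trans (cong (_* g x) (nz-δ x)) (eq (δ 𝟘 x) (g x))) ⟩
      sum (λ x → g x - δ 𝟘 x * g x)       ≡⟨ sum-distrib-- g (λ x → δ 𝟘 x * g x) ⟩
      sum g - sum (λ x → δ 𝟘 x * g x)     ≡⟨ cong (λ z → sum g - z) (δ-sum 𝟘 g) ⟩
      sum g - g 𝟘                         ∎
      where
      eq : ∀ d g → (1ℤ - d) * g ≡ g - d * g
      eq = solve-∀

    N≡q-1 : N ≡ + q - 1ℤ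
    N≡q-1 = begin
      sum nz                     ≡⟨ sum-cong-≗ (λ x → sym (ℤ.*-identityʳ (nz x))) ⟩
      sum (λ x → nz x * 1ℤ)      ≡⟨ ∑-nz (λ _ → 1ℤ) ⟩
      sum {q} (λ _ → 1ℤ) - 1ℤ    ≡⟨ cong (_- 1ℤ) (trans (sum-const q 1ℤ) (ℤ.*-identityʳ (+ q))) ⟩
      + q - 1ℤ                   ∎

    ∑*-scale : ∀ (h : Fin q → ℤ) {a} → a ≢ 𝟘 → sum (λ x → nz x * h (a ⊛ x)) ≡ sum (λ x → nz x * h x)
    ∑*-scale h {a} a≢0 = trans (sum-cong-≗ (λ x → cong (_* h (a ⊛ x)) (sym (nz-scale x a≢0))))
      (∑-scale (λ x → nz x * h x) a≢0)

    ∑*-const : ∀ z → sum (λ x → nz x * z) ≡ N * z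
    ∑*-const z = sym (*-distribʳ-sum z nz)

    ν : Fin q → ℤ
    ν x = sum (λ y → nz y * δ (y ^ k) x)

    -- φ plays the role of the sum of the nontrivial characters χ with χᵏ = 1, extended by 0 at 𝟘.
    φ : Fin q → ℤ
    φ x = ν x - nz x

    ∑-ν : ∀ g → sum (λ x → ν x * g x) ≡ sum (λ y → nz y * g (y ^ k))
    ∑-ν g = begin
      sum (λ x → ν x * g x)
        ≡⟨ sum-cong-≗ (λ x → *-distribʳ-sum (g x) (λ y → nz y * δ (y ^ k) x)) ⟩
      sum (λ x → sum (λ y → nz y * δ (y ^ k) x * g x))
        ≡⟨ ∑-comm (λ x y → nz y * δ (y ^ k) x * g x) ⟩
      sum (λ y → sum (λ x → nz y * δ (y ^ k) x * g x))
        ≡⟨ sum-cong-≗ (λ y → trans (sum-cong-≗ (λ x → ℤ.*-assoc (nz y) (δ (y ^ k) x) (g x)))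
                               (sym (*-distribˡ-sum (nz y) (λ x → δ (y ^ k) x * g x)))) ⟩
      sum (λ y → nz y * sum (λ x → δ (y ^ k) x * g x))
        ≡⟨ sum-cong-≗ (λ y → cong (nz y *_) (δ-sum (y ^ k) g)) ⟩
      sum (λ y → nz y * g (y ^ k)) ∎

    -- Summing over all x first turns `ν` into the substitution of y ^ k. Nearly every evaluation
    -- below is this identity applied to a function with a scaling invariance.
    ∑-φ : ∀ g → sum (λ x → φ x * g x) ≡ sum (λ y → nz y * g (y ^ k)) - sum (λ y → nz y * g y)
    ∑-φ g = begin
      sum (λ x → (ν x - nz x) * g x)            ≡⟨ sum-cong-≗ (λ x → eq (ν x) (nz x) (g x)) ⟩
      sum (λ x → ν x * g x - nz x * g x)        ≡⟨ sum-distrib-- (λ x → ν x * g x) (λ x → nz x * g x) ⟩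
      sum (λ x → ν x * g x) - sum (λ x → nz x * g x) ≡⟨ cong (_- sum (λ x → nz x * g x)) (∑-ν g) ⟩
      sum (λ y → nz y * g (y ^ k)) - sum (λ y → nz y * g y) ∎
      where
      eq : ∀ a b c → (a - b) * c ≡ a * c - b * c
      eq = solve-∀

    ∑-φ≡0 : sum φ ≡ 0ℤ
    ∑-φ≡0 = begin
      sum φ                     ≡⟨ sum-cong-≗ (λ x → sym (ℤ.*-identityʳ (φ x))) ⟩
      sum (λ x → φ x * 1ℤ)      ≡⟨ ∑-φ (λ _ → 1ℤ) ⟩
      sum (λ y → nz y * 1ℤ) - sum (λ y → nz y * 1ℤ) ≡⟨ ℤ.+-inverseʳ (sum (λ y → nz y * 1ℤ)) ⟩
      0ℤ ∎

    -- φ is idempotent, up to the factor N, for multiplicative convolution.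
    ∑∑-φφ : ∀ g → sum (λ u → sum (λ m → φ u * φ m * g (u ⊛ m))) ≡ N * sum (λ x → φ x * g x)
    ∑∑-φφ g = begin
      sum (λ u → sum (λ m → φ u * φ m * g (u ⊛ m)))
        ≡⟨ sum-cong-≗ (λ u → trans (sum-cong-≗ (λ m → ℤ.*-assoc (φ u) (φ m) (g (u ⊛ m))))
              (sym (*-distribˡ-sum (φ u) (λ m → φ m * g (u ⊛ m))))) ⟩
      sum (λ u → φ u * sum (λ m → φ m * g (u ⊛ m)))
        ≡⟨ sum-cong-≗ (λ u → cong (φ u *_) (∑-φ (λ m → g (u ⊛ m)))) ⟩
      sum (λ u → φ u * (G₁ u - G₂ u))
        ≡⟨ ∑-φ (λ u → G₁ u - G₂ u) ⟩
      sum (λ y → nz y * (G₁ (y ^ k) - G₂ (y ^ k))) - sum (λ y → nz y * (G₁ y - G₂ y))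
        ≡⟨ cong₂ _-_ (trans (sum-cong-≗ (λ y → nz-cong-* y (outer y))) (∑*-const (P - S)))
                     (trans (sum-cong-≗ (λ y → trans (nz-cong-* y (λ y≢0 → cong (λ t → G₁ y - t) (∑*-scale g y≢0))) (dist (nz y) (G₁ y) S)))
                       (trans (sum-distrib-- (λ y → nz y * G₁ y) (λ y → nz y * S)) (cong₂ _-_ G₁-sum (∑*-const S)))) ⟩
      N * (P - S) - (N * S - N * S)
        ≡⟨ fin N P S ⟩
      N * (P - S)
        ≡⟨ cong (N *_) (∑-φ g) ⟨
      N * sum (λ x → φ x * g x) ∎
      where
      G₁ G₂ : Fin q → ℤ
      G₁ u = sum (λ w → nz w * g (u ⊛ (w ^ k)))
      G₂ u = sum (λ w → nz w * g (u ⊛ w))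
      P S : ℤ
      P = sum (λ w → nz w * g (w ^ k))
      S = sum (λ w → nz w * g w)
      dist : ∀ a b c → a * (b - c) ≡ a * b - a * c
      dist = solve-∀
      fin : ∀ n p s → n * (p - s) - (n * s - n * s) ≡ n * (p - s)
      fin = solve-∀
      -- Substituting y w for w absorbs the factor y ^ k in the first sum, and y ^ k permutes the
      -- units in the second, so neither depends on y.
      outer : ∀ y → y ≢ 𝟘 → G₁ (y ^ k) - G₂ (y ^ k) ≡ P - S
      outer y y≢0 = cong₂ _-_
        (trans (sum-cong-≗ (λ w → cong (λ z → nz w * g z) (sym (^-distrib-* y w k)))) (∑*-scale (λ w → g (w ^ k)) y≢0))
        (∑*-scale g (^-≢𝟘 k y≢0))
      -- After exchanging the sums it is y that absorbs the unit w ^ k.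
      G₁-sum : sum (λ y → nz y * G₁ y) ≡ N * S
      G₁-sum = begin
        sum (λ y → nz y * G₁ y)
          ≡⟨ sum-cong-≗ (λ y → *-distribˡ-sum (nz y) (λ w → nz w * g (y ⊛ (w ^ k)))) ⟩
        sum (λ y → sum (λ w → nz y * (nz w * g (y ⊛ (w ^ k)))))
          ≡⟨ ∑-comm (λ y w → nz y * (nz w * g (y ⊛ (w ^ k)))) ⟩
        sum (λ w → sum (λ y → nz y * (nz w * g (y ⊛ (w ^ k)))))
          ≡⟨ sum-cong-≗ (λ w → trans (sum-cong-≗ (λ y → trans (swap (nz y) (nz w) (g (y ⊛ (w ^ k))))
                (cong (λ z → nz w * (nz y * g z)) (R.*-comm y (w ^ k)))))
                (sym (*-distribˡ-sum (nz w) (λ y → nz y * g ((w ^ k) ⊛ y))))) ⟩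
        sum (λ w → nz w * sum (λ y → nz y * g ((w ^ k) ⊛ y)))
          ≡⟨ sum-cong-≗ (λ w → nz-cong-* w (λ w≢0 → ∑*-scale g (^-≢𝟘 k w≢0))) ⟩
        sum (λ w → nz w * S)
          ≡⟨ ∑*-const S ⟩
        N * S ∎
        where
        swap : ∀ a b c → a * (b * c) ≡ b * (a * c)
        swap = solve-∀

    ν-scale : ∀ {y} x → y ≢ 𝟘 → ν ((y ^ k) ⊛ x) ≡ ν x
    ν-scale {y} x y≢0 = begin
      sum (λ w → nz w * δ (w ^ k) ((y ^ k) ⊛ x))
        ≡⟨ ∑*-scale (λ w → δ (w ^ k) ((y ^ k) ⊛ x)) y≢0 ⟨
      sum (λ w → nz w * δ ((y ⊛ w) ^ k) ((y ^ k) ⊛ x))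
        ≡⟨ sum-cong-≗ (λ w → cong (nz w *_) (δ-⇔
             (λ eq → ⊛-cancelˡ (^-≢𝟘 k y≢0) (trans (sym (^-distrib-* y w k)) eq))
             (λ eq → trans (^-distrib-* y w k) (cong ((y ^ k) ⊛_) eq)))) ⟩
      sum (λ w → nz w * δ (w ^ k) x) ∎

    φ-scale : ∀ {y} x → y ≢ 𝟘 → φ ((y ^ k) ⊛ x) ≡ φ x
    φ-scale x y≢0 = cong₂ _-_ (ν-scale x y≢0) (nz-scale x (^-≢𝟘 k y≢0))

    e : ℤ
    e = ν 𝟙

    ν-power : ∀ {y} → y ≢ 𝟘 → ν (y ^ k) ≡ e
    ν-power {y} y≢0 = trans (cong ν (sym (R.*-identityʳ (y ^ k)))) (ν-scale 𝟙 y≢0)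

    ν-𝟘 : ν 𝟘 ≡ 0ℤ
    ν-𝟘 = sum-zero (λ y → trans (nz-cong-* y (λ y≢0 → δ-≢ (^-≢𝟘 k y≢0))) (ℤ.*-zeroʳ (nz y)))

    φ-𝟘 : φ 𝟘 ≡ 0ℤ
    φ-𝟘 = cong₂ _-_ ν-𝟘 (nz-𝟘 refl)

    E : ℤ
    E = sum (λ x → φ x * φ x)

    -- `φ` has the constant value e - 1 on the nonzero powers, and the subtracted sum vanishes with
    -- `∑-φ≡0` and `φ-𝟘`.
    E≡ : E ≡ N * (e - 1ℤ)
    E≡ = begin
      sum (λ x → φ x * φ x)
        ≡⟨ ∑-φ φ ⟩
      sum (λ y → nz y * φ (y ^ k)) - sum (λ y → nz y * φ y)
        ≡⟨ cong₂ _-_ (trans (sum-cong-≗ (λ y → nz-cong-* y (λ y≢0 → cong₂ _-_ (ν-power y≢0) (nz-≢ (^-≢𝟘 k y≢0))))) (∑*-const (e - 1ℤ)))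
                     (trans (∑-nz φ) (cong₂ _-_ ∑-φ≡0 φ-𝟘)) ⟩
      N * (e - 1ℤ) - 0ℤ
        ≡⟨ ℤ.+-identityʳ _ ⟩
      N * (e - 1ℤ) ∎

    -- The additive convolution of `φ` with itself; in terms of characters, for a ≠ 0 a combination
    -- of Jacobi sums.
    C : Fin q → ℤ
    C a = sum (λ x → φ x * φ (a ⊟ x))

    C-scale : ∀ {y} a → y ≢ 𝟘 → C ((y ^ k) ⊛ a) ≡ C a
    C-scale {y} a y≢0 = begin
      sum (λ x → φ x * φ ((y ^ k) ⊛ a ⊟ x))
        ≡⟨ ∑-scale (λ x → φ x * φ ((y ^ k) ⊛ a ⊟ x)) (^-≢𝟘 k y≢0) ⟨
      sum (λ x → φ ((y ^ k) ⊛ x) * φ ((y ^ k) ⊛ a ⊟ (y ^ k) ⊛ x))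
        ≡⟨ sum-cong-≗ (λ x → cong₂ _*_ (φ-scale x y≢0)
             (trans (cong φ (solve 3 (λ u a x → u :* a :- u :* x := u :* (a :- x)) refl (y ^ k) a x)) (φ-scale (a ⊟ x) y≢0))) ⟩
      sum (λ x → φ x * φ (a ⊟ x)) ∎

    ∑-C≡0 : sum C ≡ 0ℤ
    ∑-C≡0 = begin
      sum (λ a → sum (λ x → φ x * φ (a ⊟ x)))
        ≡⟨ ∑-comm (λ a x → φ x * φ (a ⊟ x)) ⟩
      sum (λ x → sum (λ a → φ x * φ (a ⊟ x)))
        ≡⟨ sum-zero (λ x → trans (sym (*-distribˡ-sum (φ x) (λ a → φ (a ⊟ x))))
             (trans (cong (φ x *_) (trans (∑-translate φ (⊖ x)) ∑-φ≡0)) (ℤ.*-zeroʳ (φ x)))) ⟩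
      0ℤ ∎

    -- By `C-scale` the function `C` is constant on cosets of the nonzero powers, which gives N · C
    -- a; the other sum runs over all units and equals - C 𝟘 because `C` has total zero.
    ∑-φC : ∀ {a} → a ≢ 𝟘 → sum (λ z → φ z * C (a ⊛ z)) ≡ N * C a + C 𝟘
    ∑-φC {a} a≢0 = begin
      sum (λ z → φ z * C (a ⊛ z))
        ≡⟨ ∑-φ (λ z → C (a ⊛ z)) ⟩
      sum (λ y → nz y * C (a ⊛ (y ^ k))) - sum (λ y → nz y * C (a ⊛ y))
        ≡⟨ cong₂ _-_ (trans (sum-cong-≗ (λ y → nz-cong-* y (λ y≢0 → trans (cong C (R.*-comm a (y ^ k))) (C-scale a y≢0)))) (∑*-const (C a)))
                     (trans (∑*-scale C a≢0) (trans (∑-nz C) (cong (_- C 𝟘) ∑-C≡0))) ⟩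
      N * C a - (0ℤ - C 𝟘)
        ≡⟨ fin (N * C a) (C 𝟘) ⟩
      N * C a + C 𝟘 ∎
      where
      fin : ∀ x y → x - (0ℤ - y) ≡ x + y
      fin = solve-∀

    -- Weighted incidences of points and lines

    module Lines {a : Fin q} (a≢0 : a ≢ 𝟘) where

      -- The point (u , z) has weight φ u φ z and the line { (u , z) : a z = u m + b } has weight φ m φ b;
      -- Φ u z is the total weight of the lines through (u , z).
      Φ : Fin q → Fin q → ℤ
      Φ u z = sum (λ m → φ m * φ (a ⊛ z ⊟ u ⊛ m))

      W : ℤ
      W = sum (λ u → sum (λ z → φ u * φ z * Φ u z))

      -- For fixed z the coordinate u and the slope m enter only through u ⊛ m, so `∑∑-φφ` merges
      -- them into one variable at the price of a factor N. The sum over z that remains is `∑-φC`.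
      W≡ : W ≡ N * (N * C a + C 𝟘)
      W≡ = begin
        sum (λ u → sum (λ z → φ u * φ z * Φ u z))
          ≡⟨ ∑-comm (λ u z → φ u * φ z * Φ u z) ⟩
        sum (λ z → sum (λ u → φ u * φ z * Φ u z))
          ≡⟨ sum-cong-≗ inner ⟩
        sum (λ z → N * (φ z * C (a ⊛ z)))
          ≡⟨ *-distribˡ-sum N (λ z → φ z * C (a ⊛ z)) ⟨
        N * sum (λ z → φ z * C (a ⊛ z))
          ≡⟨ cong (N *_) (∑-φC a≢0) ⟩
        N * (N * C a + C 𝟘) ∎
        where
        eq₁ : ∀ u z S → u * z * S ≡ z * (u * S)
        eq₁ = solve-∀
        eq₂ : ∀ n z c → z * (n * c) ≡ n * (z * c)
        eq₂ = solve-∀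
        inner : ∀ z → sum (λ u → φ u * φ z * Φ u z) ≡ N * (φ z * C (a ⊛ z))
        inner z = begin
          sum (λ u → φ u * φ z * Φ u z)
            ≡⟨ sum-cong-≗ (λ u → eq₁ (φ u) (φ z) (Φ u z)) ⟩
          sum (λ u → φ z * (φ u * Φ u z))
            ≡⟨ *-distribˡ-sum (φ z) (λ u → φ u * Φ u z) ⟨
          φ z * sum (λ u → φ u * Φ u z)
            ≡⟨ cong (φ z *_) (sum-cong-≗ (λ u → trans (*-distribˡ-sum (φ u) (λ m → φ m * φ (a ⊛ z ⊟ u ⊛ m)))
                 (sum-cong-≗ (λ m → sym (ℤ.*-assoc (φ u) (φ m) (φ (a ⊛ z ⊟ u ⊛ m))))))) ⟩
          φ z * sum (λ u → sum (λ m → φ u * φ m * φ (a ⊛ z ⊟ u ⊛ m)))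
            ≡⟨ cong (φ z *_) (∑∑-φφ (λ x → φ (a ⊛ z ⊟ x))) ⟩
          φ z * (N * C (a ⊛ z))
            ≡⟨ eq₂ N (φ z) (C (a ⊛ z)) ⟩
          N * (φ z * C (a ⊛ z)) ∎

      -- Distinct non-parallel lines meet in one point, and φ has sum zero, so only the diagonal pairs contribute.
      correlation : ∀ m m' → sum (λ u → sum (λ z → φ (a ⊛ z ⊟ u ⊛ m) * φ (a ⊛ z ⊟ u ⊛ m'))) ≡ δ m m' * (+ q * E)
      correlation m m' = begin
        sum (λ u → sum (λ z → φ (a ⊛ z ⊟ u ⊛ m) * φ (a ⊛ z ⊟ u ⊛ m')))
          ≡⟨ sum-cong-≗ shift ⟩
        sum (λ u → sum (λ s → φ s * φ (s ⊕ u ⊛ (m ⊟ m'))))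
          ≡⟨ ∑-comm (λ u s → φ s * φ (s ⊕ u ⊛ (m ⊟ m'))) ⟩
        sum (λ s → sum (λ u → φ s * φ (s ⊕ u ⊛ (m ⊟ m'))))
          ≡⟨ by-cases (m ≟ m') ⟩
        δ m m' * (+ q * E) ∎
        where
        shift : ∀ u → sum (λ z → φ (a ⊛ z ⊟ u ⊛ m) * φ (a ⊛ z ⊟ u ⊛ m')) ≡ sum (λ s → φ s * φ (s ⊕ u ⊛ (m ⊟ m')))
        shift u = begin
          sum (λ z → φ (a ⊛ z ⊟ u ⊛ m) * φ (a ⊛ z ⊟ u ⊛ m'))
            ≡⟨ ∑-scale (λ y → φ (y ⊟ u ⊛ m) * φ (y ⊟ u ⊛ m')) a≢0 ⟩
          sum (λ y → φ (y ⊟ u ⊛ m) * φ (y ⊟ u ⊛ m'))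
            ≡⟨ ∑-translate (λ y → φ (y ⊟ u ⊛ m) * φ (y ⊟ u ⊛ m')) (u ⊛ m) ⟨
          sum (λ s → φ (s ⊕ u ⊛ m ⊟ u ⊛ m) * φ (s ⊕ u ⊛ m ⊟ u ⊛ m'))
            ≡⟨ sum-cong-≗ (λ s → cong₂ (λ x y → φ x * φ y)
                 (solve 2 (λ s v → s :+ v :- v := s) refl s (u ⊛ m))
                 (solve 4 (λ s u m m' → s :+ u :* m :- u :* m' := s :+ u :* (m :- m')) refl s u m m')) ⟩
          sum (λ s → φ s * φ (s ⊕ u ⊛ (m ⊟ m'))) ∎
        by-cases : Dec (m ≡ m') → sum (λ s → sum (λ u → φ s * φ (s ⊕ u ⊛ (m ⊟ m')))) ≡ δ m m' * (+ q * E)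
        by-cases (yes refl) = begin
          sum (λ s → sum (λ u → φ s * φ (s ⊕ u ⊛ (m ⊟ m))))
            ≡⟨ sum-cong-≗ (λ s → trans (sum-cong-≗ (λ u → cong (λ x → φ s * φ x)
                  (solve 3 (λ s u m → s :+ u :* (m :- m) := s) refl s u m))) (sum-const q (φ s * φ s))) ⟩
          sum (λ s → + q * (φ s * φ s))
            ≡⟨ *-distribˡ-sum (+ q) (λ s → φ s * φ s) ⟨
          + q * E
            ≡⟨ trans (cong (_* (+ q * E)) (δ-refl {x = m} refl)) (ℤ.*-identityˡ (+ q * E)) ⟨
          δ m m * (+ q * E) ∎
        by-cases (no m≢m') = begin
          sum (λ s → sum (λ u → φ s * φ (s ⊕ u ⊛ (m ⊟ m'))))
            ≡⟨ sum-zero (λ s → trans (sym (*-distribˡ-sum (φ s) (λ u → φ (s ⊕ u ⊛ (m ⊟ m')))))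
                 (trans (cong (φ s *_) (vanish s)) (ℤ.*-zeroʳ (φ s)))) ⟩
          0ℤ
            ≡⟨ trans (cong (_* (+ q * E)) (δ-≢ m≢m')) (ℤ.*-zeroˡ (+ q * E)) ⟨
          δ m m' * (+ q * E) ∎
          where
          m-m'≢0 : m ⊟ m' ≢ 𝟘
          m-m'≢0 eq = m≢m' (trans (solve 2 (λ m m' → m := m :- m' :+ m') refl m m') (trans (cong (_⊕ m') eq) (R.+-identityˡ m')))
          vanish : ∀ s → sum (λ u → φ (s ⊕ u ⊛ (m ⊟ m'))) ≡ 0ℤ
          vanish s = begin
            sum (λ u → φ (s ⊕ u ⊛ (m ⊟ m')))
              ≡⟨ sum-cong-≗ (λ u → cong φ (solve 3 (λ s u w → s :+ u :* w := w :* u :+ s) refl s u (m ⊟ m'))) ⟩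
            sum (λ u → φ ((m ⊟ m') ⊛ u ⊕ s))
              ≡⟨ ∑-scale (λ x → φ (x ⊕ s)) m-m'≢0 ⟩
            sum (λ x → φ (x ⊕ s))
              ≡⟨ trans (∑-translate φ s) ∑-φ≡0 ⟩
            0ℤ ∎

      -- Expanding the square gives a sum over pairs of slopes, of which `correlation` keeps the
      -- equal ones.
      ∑-Φ² : sum (λ u → sum (λ z → Φ u z * Φ u z)) ≡ + q * (E * E)
      ∑-Φ² = begin
        sum (λ u → sum (λ z → Φ u z * Φ u z))
          ≡⟨ sum-cong-≗ (λ u → sum-cong-≗ (λ z → square u z)) ⟩
        sum (λ u → sum (λ z → sum (λ m → sum (λ m' → t u z m m'))))
          ≡⟨ sum-cong-≗ (λ u → trans (∑-comm (λ z m → sum (λ m' → t u z m m'))) (sum-cong-≗ (λ m → ∑-comm (λ z m' → t u z m m')))) ⟩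
        sum (λ u → sum (λ m → sum (λ m' → sum (λ z → t u z m m'))))
          ≡⟨ trans (∑-comm (λ u m → sum (λ m' → sum (λ z → t u z m m')))) (sum-cong-≗ (λ m → ∑-comm (λ u m' → sum (λ z → t u z m m')))) ⟩
        sum (λ m → sum (λ m' → sum (λ u → sum (λ z → t u z m m'))))
          ≡⟨ sum-cong-≗ (λ m → sum-cong-≗ (λ m' → pull m m')) ⟩
        sum (λ m → sum (λ m' → φ m * φ m' * (δ m m' * (+ q * E))))
          ≡⟨ sum-cong-≗ (λ m → trans (sum-cong-≗ (λ m' → eq₂ (φ m) (φ m') (δ m m') (+ q * E))) (δ-sum m (λ m' → φ m * φ m' * (+ q * E)))) ⟩
        sum (λ m → φ m * φ m * (+ q * E))
          ≡⟨ *-distribʳ-sum (+ q * E) (λ m → φ m * φ m) ⟨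
        E * (+ q * E)
          ≡⟨ eq₃ E (+ q) ⟩
        + q * (E * E) ∎
        where
        t : Fin q → Fin q → Fin q → Fin q → ℤ
        t u z m m' = φ m * φ m' * (φ (a ⊛ z ⊟ u ⊛ m) * φ (a ⊛ z ⊟ u ⊛ m'))
        eq₁ : ∀ a b c d → a * b * (c * d) ≡ a * c * (b * d)
        eq₁ = solve-∀
        eq₂ : ∀ a b d e → a * b * (d * e) ≡ d * (a * b * e)
        eq₂ = solve-∀
        eq₃ : ∀ a b → a * (b * a) ≡ b * (a * a)
        eq₃ = solve-∀
        square : ∀ u z → Φ u z * Φ u z ≡ sum (λ m → sum (λ m' → t u z m m'))
        square u z = trans (*-distribʳ-sum (Φ u z) (λ m → f m)) (sum-cong-≗ (λ m → trans (*-distribˡ-sum (f m) f)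
          (sum-cong-≗ (λ m' → eq₁ (φ m) (φ (a ⊛ z ⊟ u ⊛ m)) (φ m') (φ (a ⊛ z ⊟ u ⊛ m'))))))
          where
          f : Fin q → ℤ
          f m = φ m * φ (a ⊛ z ⊟ u ⊛ m)
        pull : ∀ m m' → sum (λ u → sum (λ z → t u z m m')) ≡ φ m * φ m' * (δ m m' * (+ q * E))
        pull m m' = trans (sum-cong-≗ (λ u → sym (*-distribˡ-sum (φ m * φ m') (λ z → φ (a ⊛ z ⊟ u ⊛ m) * φ (a ⊛ z ⊟ u ⊛ m')))))
          (trans (sym (*-distribˡ-sum (φ m * φ m') (λ u → sum (λ z → φ (a ⊛ z ⊟ u ⊛ m) * φ (a ⊛ z ⊟ u ⊛ m')))))
            (cong (φ m * φ m' *_) (correlation m m')))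

      ∑-φφ² : sum (λ u → sum (λ z → (φ u * φ z) * (φ u * φ z))) ≡ E * E
      ∑-φφ² = begin
        sum (λ u → sum (λ z → (φ u * φ z) * (φ u * φ z)))
          ≡⟨ sum-cong-≗ (λ u → trans (sum-cong-≗ (λ z → eq (φ u) (φ z))) (sym (*-distribˡ-sum (φ u * φ u) (λ z → φ z * φ z)))) ⟩
        sum (λ u → φ u * φ u * E)
          ≡⟨ *-distribʳ-sum E (λ u → φ u * φ u) ⟨
        E * E ∎
        where
        eq : ∀ a b → (a * b) * (a * b) ≡ a * a * (b * b)
        eq = solve-∀

      -- The sum of the squares of λ₀ φ u φ z + Φ u z. Leaving λ₀ free replaces the optimal
      -- multiplier, which would involve the square root of q.
      cauchy-schwarz : ∀ λ₀ → 0ℤ ≤ λ₀ * λ₀ * (E * E) + + 2 * λ₀ * W + + q * (E * E)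
      cauchy-schwarz λ₀ = subst (0ℤ ≤_) expand
        (sum-nonNegative (λ u → sum-nonNegative (λ z → 0≤square (λ₀ * (φ u * φ z) + Φ u z))))
        where
        eq : ∀ l g f → (l * g + f) * (l * g + f) ≡ l * l * (g * g) + + 2 * l * (g * f) + f * f
        eq = solve-∀
        double : ∀ c (f : Fin q → Fin q → ℤ) → sum (λ u → sum (λ z → c * f u z)) ≡ c * sum (λ u → sum (λ z → f u z))
        double c f = trans (sum-cong-≗ (λ u → sym (*-distribˡ-sum c (f u)))) (sym (*-distribˡ-sum c (λ u → sum (f u))))
        add : ∀ (f g : Fin q → Fin q → ℤ) → sum (λ u → sum (λ z → f u z + g u z)) ≡ sum (λ u → sum (f u)) + sum (λ u → sum (g u))
        add f g = trans (sum-cong-≗ (λ u → ∑-distrib-+ (f u) (g u))) (∑-distrib-+ (λ u → sum (f u)) (λ u → sum (g u)))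
        expand : sum (λ u → sum (λ z → (λ₀ * (φ u * φ z) + Φ u z) * (λ₀ * (φ u * φ z) + Φ u z))) ≡
                 λ₀ * λ₀ * (E * E) + + 2 * λ₀ * W + + q * (E * E)
        expand = begin
          sum (λ u → sum (λ z → (λ₀ * (φ u * φ z) + Φ u z) * (λ₀ * (φ u * φ z) + Φ u z)))
            ≡⟨ sum-cong-≗ (λ u → sum-cong-≗ (λ z → eq λ₀ (φ u * φ z) (Φ u z))) ⟩
          sum (λ u → sum (λ z → λ₀ * λ₀ * ((φ u * φ z) * (φ u * φ z)) + + 2 * λ₀ * (φ u * φ z * Φ u z) + Φ u z * Φ u z))
            ≡⟨ trans (add (λ u z → λ₀ * λ₀ * ((φ u * φ z) * (φ u * φ z)) + + 2 * λ₀ * (φ u * φ z * Φ u z)) (λ u z → Φ u z * Φ u z))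
                 (cong₂ _+_ (add (λ u z → λ₀ * λ₀ * ((φ u * φ z) * (φ u * φ z))) (λ u z → + 2 * λ₀ * (φ u * φ z * Φ u z))) ∑-Φ²) ⟩
          sum (λ u → sum (λ z → λ₀ * λ₀ * ((φ u * φ z) * (φ u * φ z)))) + sum (λ u → sum (λ z → + 2 * λ₀ * (φ u * φ z * Φ u z))) + + q * (E * E)
            ≡⟨ cong (_+ + q * (E * E)) (cong₂ _+_
                 (trans (double (λ₀ * λ₀) (λ u z → (φ u * φ z) * (φ u * φ z))) (cong (λ₀ * λ₀ *_) ∑-φφ²))
                 (double (+ 2 * λ₀) (λ u z → φ u * φ z * Φ u z))) ⟩
          λ₀ * λ₀ * (E * E) + + 2 * λ₀ * W + + q * (E * E) ∎

  0<* : ∀ {i j} → 0ℤ < i → 0ℤ < j → 0ℤ < i * j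
  0<* {+ suc m} {+ suc n} _ _ = subst (0ℤ <_) (ℤ.pos-* (suc m) (suc n)) (ℤ.+<+ ℕ.z<s)
  0<* {+ zero} (ℤ.+<+ ()) _
  0<* {+ suc m} {+ zero} _ (ℤ.+<+ ())

  -- Roots of unity and elementary counts

  module PowerCounts {q : ℕ} (K : FiniteField q) (k : ℕ) where
    open FiniteField K
    open PowerSums K k
    private
      module R = CommutativeRing commutativeRing
    open IntegerCoefficientSolver commutativeRing using (solve; _:=_; _:+_; _:-_)
    open import Algebra.Properties.Semiring.Exp R.semiring using (_^_; ^-homo-*; ^-assocʳ)
    open MonicPolynomials commutativeRing using (peval; quotient; quotient-root; peval-replicate)
    import Algebra.Properties.CommutativeMonoid.Sum R.*-commutativeMonoid as Product
    open ≡-Reasoning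

    prod : ∀ {n} → (Fin n → Fin q) → Fin q
    prod = Product.sum

    prod-≢𝟘 : ∀ {n} {f : Fin n → Fin q} → (∀ i → f i ≢ 𝟘) → prod f ≢ 𝟘
    prod-≢𝟘 {zero} f≢0 = 𝟙≢𝟘
    prod-≢𝟘 {suc n} f≢0 = ⊛-≢𝟘 (f≢0 zero) (prod-≢𝟘 (λ i → f≢0 (suc i)))

    prod-const-but-one : ∀ {n} (z : Fin n) {f : Fin n → Fin q} {x} → f z ≡ 𝟙 → (∀ y → y ≢ z → f y ≡ x) →
      prod f ≡ x ^ (n ℕ.∸ 1)
    prod-const-but-one {suc n} z {f} {x} fz fy = begin
      prod f                          ≡⟨ Product.sum-remove {i = z} f ⟩
      f z ⊛ prod (λ i → f (punchIn z i)) ≡⟨ cong₂ _⊛_ fz (Product.sum-cong-≗ (λ i → fy (punchIn z i) (punchInᵢ≢i z i))) ⟩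
      𝟙 ⊛ prod {n} (λ _ → x)          ≡⟨ R.*-identityˡ _ ⟩
      prod {n} (λ _ → x)              ≡⟨ Product.sum-replicate n ⟩
      x ^ n                           ∎

    -- Multiplication by x permutes the units. To keep all of `Fin q` as index set, the factor at 𝟘
    -- is replaced by 𝟙: in `h` for the elements themselves, in `c` for the factors x.
    fermat : ∀ {x} → x ≢ 𝟘 → x ^ (q ℕ.∸ 1) ≡ 𝟙
    fermat {x} x≢0 with x' , xx' ← inverse x x≢0 = begin
      x ^ (q ℕ.∸ 1)   ≡⟨ prod-const-but-one 𝟘 c-𝟘 c-≢ ⟨
      prod c          ≡⟨ ⊛-cancelˡ (prod-≢𝟘 h≢0) (begin
        prod h ⊛ prod c               ≡⟨ R.*-comm (prod h) (prod c) ⟩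
        prod c ⊛ prod h               ≡⟨ Product.∑-distrib-+ c h ⟨
        prod (λ y → c y ⊛ h y)        ≡⟨ Product.sum-cong-≗ h-scale ⟨
        prod (λ y → h (x ⊛ y))        ≡⟨ Product.sum-permute h (permutation (x ⊛_) (x' ⊛_)
          (λ y → trans (sym (R.*-assoc x x' y)) (trans (cong (_⊛ y) xx') (R.*-identityˡ y)))
          (λ y → trans (sym (R.*-assoc x' x y)) (trans (cong (_⊛ y) (trans (R.*-comm x' x) xx')) (R.*-identityˡ y)))) ⟨
        prod h                        ≡⟨ R.*-identityʳ (prod h) ⟨
        prod h ⊛ 𝟙                    ∎) ⟩
      𝟙               ∎
      where
      h c : Fin q → Fin q
      h y = if does (y ≟ 𝟘) then 𝟙 else y
      c y = if does (y ≟ 𝟘) then 𝟙 else x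
      h≢0 : ∀ y → h y ≢ 𝟘
      h≢0 y with y ≟ 𝟘
      ... | yes _ = 𝟙≢𝟘
      ... | no y≢0 = y≢0
      c-𝟘 : c 𝟘 ≡ 𝟙
      c-𝟘 with 𝟘 ≟ 𝟘
      ... | yes _ = refl
      ... | no 0≢0 = contradiction refl 0≢0
      c-≢ : ∀ y → y ≢ 𝟘 → c y ≡ x
      c-≢ y y≢0 with y ≟ 𝟘
      ... | yes y≡0 = contradiction y≡0 y≢0
      ... | no _ = refl
      h-scale : ∀ y → h (x ⊛ y) ≡ c y ⊛ h y
      h-scale y with y ≟ 𝟘 | (x ⊛ y) ≟ 𝟘
      ... | yes _ | yes _ = sym (R.*-identityˡ 𝟙)
      ... | yes y≡0 | no xy≢0 = contradiction (trans (cong (x ⊛_) y≡0) (R.zeroʳ x)) xy≢0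
      ... | no y≢0 | yes xy≡0 = contradiction xy≡0 (⊛-≢𝟘 x≢0 y≢0)
      ... | no _ | no _ = refl

    -- Splitting off a root a, every other root of p is a root of the quotient.
    root-bound : ∀ {m} (p : Vec (Fin q) m) → sum (λ x → δ (peval p x) 𝟘) ≤ + m
    root-bound {zero} [] = ℤ.≤-reflexive (sum-zero {q} (λ x → δ-≢ 𝟙≢𝟘))
    root-bound {suc m} p with any? (λ a → peval p a ≟ 𝟘)
    ... | no ¬root = ℤ.≤-trans (ℤ.≤-reflexive (sum-zero (λ x → δ-≢ (λ px≡0 → ¬root (x , px≡0))))) (ℤ.+≤+ ℕ.z≤n)
    ... | yes (a , pa≡0) = ℤ.≤-trans (sum-mono-≤ bound)
      (ℤ.≤-trans (ℤ.≤-reflexive (∑-distrib-+ (λ x → δ a x * 1ℤ) (λ x → δ (peval (quotient a p) x) 𝟘)))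
        (ℤ.+-mono-≤ (ℤ.≤-reflexive (δ-sum a (λ _ → 1ℤ))) (root-bound (quotient a p))))
      where
      bound : ∀ x → δ (peval p x) 𝟘 ≤ δ a x * 1ℤ + δ (peval (quotient a p) x) 𝟘
      bound x with a ≟ x | peval p x ≟ 𝟘
      ... | yes _ | yes _ = ℤ.≤-trans (ℤ.≤-reflexive (sym (ℤ.+-identityʳ 1ℤ))) (ℤ.+-monoʳ-≤ 1ℤ (0≤indicator (does (peval (quotient a p) x ≟ 𝟘))))
      ... | yes _ | no _ = 0≤+ {1ℤ} (ℤ.+≤+ ℕ.z≤n) (0≤indicator (does (peval (quotient a p) x ≟ 𝟘)))
      ... | no _ | no _ = 0≤+ {0ℤ} ℤ.≤-refl (0≤indicator (does (peval (quotient a p) x ≟ 𝟘)))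
      ... | no a≢x | yes px≡0 = ℤ.≤-reflexive (sym (trans (ℤ.+-identityˡ _) (δ-refl (⊛-cancelˡ x-a≢0
              (trans (sym (quotient-root a p pa≡0 x)) (trans px≡0 (sym (R.zeroʳ (x ⊟ a)))))))))
        where
        x-a≢0 : x ⊟ a ≢ 𝟘
        x-a≢0 eq = a≢x (sym (trans (solve 2 (λ x a → x := x :- a :+ a) refl x a) (trans (cong (_⊕ a) eq) (R.+-identityˡ a))))

    ^-𝟙 : ∀ m → 𝟙 ^ m ≡ 𝟙
    ^-𝟙 zero = refl
    ^-𝟙 (suc m) = trans (R.*-identityˡ _) (^-𝟙 m)

    ^-multiple : ∀ {x m} y → x ^ m ≡ 𝟙 → x ^ (y ℕ.* m) ≡ 𝟙
    ^-multiple {x} {m} y eq = begin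
      x ^ (y ℕ.* m)   ≡⟨ cong (x ^_) (ℕ.*-comm y m) ⟩
      x ^ (m ℕ.* y)   ≡⟨ ^-assocʳ x m y ⟨
      (x ^ m) ^ y     ≡⟨ cong (_^ y) eq ⟩
      𝟙 ^ y           ≡⟨ ^-𝟙 y ⟩
      𝟙               ∎

    ^-split : ∀ {x d a b} → x ^ a ≡ 𝟙 → x ^ b ≡ 𝟙 → d ℕ.+ a ≡ b → x ^ d ≡ 𝟙
    ^-split {x} {d} {a} {b} xa xb eq = begin
      x ^ d             ≡⟨ R.*-identityʳ (x ^ d) ⟨
      x ^ d ⊛ 𝟙         ≡⟨ cong (x ^ d ⊛_) xa ⟨
      x ^ d ⊛ x ^ a     ≡⟨ ^-homo-* x d a ⟨
      x ^ (d ℕ.+ a)     ≡⟨ cong (x ^_) eq ⟩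
      x ^ b             ≡⟨ xb ⟩
      𝟙                 ∎

    -- `fermat` supplies the exponent q - 1. Bézout's identity over ℕ comes in two forms, according
    -- to which multiple is the larger one.
    ^-gcd : ∀ {x} → x ≢ 𝟘 → x ^ k ≡ 𝟙 → x ^ gcd k (q ℕ.∸ 1) ≡ 𝟙
    ^-gcd {z} z≢0 zk with Bézout.identity (gcd-GCD k (q ℕ.∸ 1))
    ... | Bézout.+- x y eq = ^-split {z} {gcd k (q ℕ.∸ 1)} {y ℕ.* (q ℕ.∸ 1)} {x ℕ.* k} (^-multiple {z} {q ℕ.∸ 1} y (fermat z≢0)) (^-multiple {z} {k} x zk) eq
    ... | Bézout.-+ x y eq = ^-split {z} {gcd k (q ℕ.∸ 1)} {x ℕ.* k} {y ℕ.* (q ℕ.∸ 1)} (^-multiple {z} {k} x zk) (^-multiple {z} {q ℕ.∸ 1} y (fermat z≢0)) eq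

    -- By `^-gcd` the k-th roots of unity are roots of X ^ d - 1 with d the gcd.
    e≤gcd : 1 ℕ.≤ k → e ≤ + gcd k (q ℕ.∸ 1)
    e≤gcd 1≤k with gcd k (q ℕ.∸ 1) in eq
    ... | zero = contradiction (gcd[m,n]≡0⇒m≡0 {k} eq) (ℕ.>⇒≢ 1≤k)
    ... | suc d = ℤ.≤-trans (sum-mono-≤ bound) (root-bound p)
      where
      -- The polynomial X ^ (d + 1) - 1; here d + 1 is the gcd, positive because k is.
      p : Vec (Fin q) (suc d)
      p = ⊖ 𝟙 ∷ replicate d 𝟘
      bound : ∀ y → nz y * δ (y ^ k) 𝟙 ≤ δ (peval p y) 𝟘
      bound y with y ≟ 𝟘 | (y ^ k) ≟ 𝟙
      ... | yes _ | _ = 0≤indicator _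
      ... | no _ | no _ = 0≤indicator _
      ... | no y≢0 | yes yk = ℤ.≤-reflexive (sym (δ-refl (begin
        ⊖ 𝟙 ⊕ y ⊛ peval (replicate d 𝟘) y  ≡⟨ cong (λ z → ⊖ 𝟙 ⊕ y ⊛ z) (peval-replicate d y) ⟩
        ⊖ 𝟙 ⊕ y ^ suc d                    ≡⟨ cong (⊖ 𝟙 ⊕_) (subst (λ m → y ^ m ≡ 𝟙) eq (^-gcd y≢0 yk)) ⟩
        ⊖ 𝟙 ⊕ 𝟙                            ≡⟨ R.-‿inverseˡ 𝟙 ⟩
        𝟘                                  ∎)))

    0≤ν : ∀ x → 0ℤ ≤ ν x
    0≤ν x = sum-nonNegative (λ y → 0≤* (0≤nz y) (0≤indicator _))

    ν≤e : ∀ x → ν x ≤ e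
    ν≤e x with any? (λ y → ¬? (y ≟ 𝟘) ×-dec (y ^ k ≟ x))
    ... | yes (y , y≢0 , refl) = ℤ.≤-reflexive (ν-power y≢0)
    ... | no ¬y = ℤ.≤-trans (ℤ.≤-reflexive (sum-zero (λ y →
      trans (nz-cong-* y (λ y≢0 → δ-≢ (λ yk → ¬y (y , y≢0 , yk)))) (ℤ.*-zeroʳ (nz y))))) (0≤ν 𝟙)

    1≤e : 1ℤ ≤ e
    1≤e = ℤ.≤-trans (ℤ.≤-reflexive (sym (δ-sum 𝟙 (λ _ → 1ℤ)))) (sum-mono-≤ bound)
      where
      bound : ∀ y → δ 𝟙 y * 1ℤ ≤ nz y * δ (y ^ k) 𝟙
      bound y with 𝟙 ≟ y
      ... | yes refl = ℤ.≤-reflexive (sym (cong₂ _*_ (nz-≢ 𝟙≢𝟘) (δ-refl (^-𝟙 k))))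
      ... | no _ = 0≤* (0≤nz y) (0≤indicator _)

    ∑-ν≡N : sum ν ≡ N
    ∑-ν≡N = begin
      sum ν                       ≡⟨ sum-cong-≗ (λ x → sym (ℤ.*-identityʳ (ν x))) ⟩
      sum (λ x → ν x * 1ℤ)        ≡⟨ ∑-ν (λ _ → 1ℤ) ⟩
      sum (λ y → nz y * 1ℤ)       ≡⟨ ∑*-const 1ℤ ⟩
      N * 1ℤ                      ≡⟨ ℤ.*-identityʳ N ⟩
      N                           ∎

    -- The squares of φ x - φ (- x) add up to 2 (E - C 𝟘).
    C-𝟘≤E : C 𝟘 ≤ E
    C-𝟘≤E = ℤ.0≤i-j⇒j≤i (half (E - C 𝟘) (subst (0ℤ ≤_) expand
      (sum-nonNegative (λ x → 0≤square (φ x - φ (𝟘 ⊟ x))))))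
      where
      half : ∀ z → 0ℤ ≤ + 2 * z → 0ℤ ≤ z
      half (+ n) _ = ℤ.+≤+ ℕ.z≤n
      half -[1+ n ] ()
      eq : ∀ a b → (a - b) * (a - b) ≡ (a * a + b * b) - + 2 * (a * b)
      eq = solve-∀
      fin : ∀ a c → a + a - + 2 * c ≡ + 2 * (a - c)
      fin = solve-∀
      expand : sum (λ x → (φ x - φ (𝟘 ⊟ x)) * (φ x - φ (𝟘 ⊟ x))) ≡ + 2 * (E - C 𝟘)
      expand = begin
        sum (λ x → (φ x - φ (𝟘 ⊟ x)) * (φ x - φ (𝟘 ⊟ x)))
          ≡⟨ sum-cong-≗ (λ x → eq (φ x) (φ (𝟘 ⊟ x))) ⟩
        sum (λ x → (φ x * φ x + φ (𝟘 ⊟ x) * φ (𝟘 ⊟ x)) - + 2 * (φ x * φ (𝟘 ⊟ x)))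
          ≡⟨ sum-distrib-- (λ x → φ x * φ x + φ (𝟘 ⊟ x) * φ (𝟘 ⊟ x)) (λ x → + 2 * (φ x * φ (𝟘 ⊟ x))) ⟩
        sum (λ x → φ x * φ x + φ (𝟘 ⊟ x) * φ (𝟘 ⊟ x)) - sum (λ x → + 2 * (φ x * φ (𝟘 ⊟ x)))
          ≡⟨ cong₂ _-_ (trans (∑-distrib-+ (λ x → φ x * φ x) (λ x → φ (𝟘 ⊟ x) * φ (𝟘 ⊟ x)))
                         (cong (λ z → E + z) (∑-reflect (λ x → φ x * φ x) 𝟘)))
                       (sym (*-distribˡ-sum (+ 2) (λ x → φ x * φ (𝟘 ⊟ x)))) ⟩
        E + E - + 2 * C 𝟘
          ≡⟨ fin E (C 𝟘) ⟩
        + 2 * (E - C 𝟘) ∎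

    -- In the expansion of (ν - nz)(ν - nz) the product of the two `ν` counts representations of a
    -- by two nonzero powers and vanishes by hypothesis. The other three products are elementary: N
    -- - 1, and N - ν a twice.
    C-without-sums : ∀ {a} → a ≢ 𝟘 → (∀ y w → y ≢ 𝟘 → w ≢ 𝟘 → y ^ k ⊕ w ^ k ≢ a) → C a ≡ + 2 * ν a - + q
    C-without-sums {a} a≢0 none = begin
      sum (λ x → φ x * φ (a ⊟ x))
        ≡⟨ sum-cong-≗ (λ x → expand (ν x) (nz x) (ν (a ⊟ x)) (nz (a ⊟ x))) ⟩
      sum (λ x → (ν x * ν (a ⊟ x) + nz x * nz (a ⊟ x)) - (ν x * nz (a ⊟ x) + nz x * ν (a ⊟ x)))
        ≡⟨ trans (sum-distrib-- (λ x → ν x * ν (a ⊟ x) + nz x * nz (a ⊟ x)) (λ x → ν x * nz (a ⊟ x) + nz x * ν (a ⊟ x)))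
             (cong₂ _-_ (∑-distrib-+ (λ x → ν x * ν (a ⊟ x)) (λ x → nz x * nz (a ⊟ x)))
                        (∑-distrib-+ (λ x → ν x * nz (a ⊟ x)) (λ x → nz x * ν (a ⊟ x)))) ⟩
      (sum (λ x → ν x * ν (a ⊟ x)) + sum (λ x → nz x * nz (a ⊟ x))) -
        (sum (λ x → ν x * nz (a ⊟ x)) + sum (λ x → nz x * ν (a ⊟ x)))
        ≡⟨ cong₂ _-_ (cong₂ _+_ νν (trans (∑-nz-reflect nz) (cong (λ z → N - z) (nz-≢ a≢0))))
                     (cong₂ _+_ ν-nz (trans reflect ν-nz)) ⟩
      (0ℤ + (N - 1ℤ)) - ((N - ν a) + (N - ν a))
        ≡⟨ fin N (ν a) ⟩
      + 2 * ν a - (N + 1ℤ)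
        ≡⟨ cong (λ z → + 2 * ν a - z) (trans (cong (_+ 1ℤ) N≡q-1) (back (+ q))) ⟩
      + 2 * ν a - + q ∎
      where
      expand : ∀ a b c d → (a - b) * (c - d) ≡ (a * c + b * d) - (a * d + b * c)
      expand = solve-∀
      fin : ∀ n v → (0ℤ + (n - 1ℤ)) - ((n - v) + (n - v)) ≡ + 2 * v - (n + 1ℤ)
      fin = solve-∀
      back : ∀ x → x - 1ℤ + 1ℤ ≡ x
      back = solve-∀
      nz-reflect : ∀ x → nz (a ⊟ x) ≡ 1ℤ - δ a x
      nz-reflect x = trans (nz-δ (a ⊟ x)) (cong (λ z → 1ℤ - z) (δ-⇔
        (λ eq → trans (solve 2 (λ a x → a := a :- x :+ x) refl a x) (trans (cong (_⊕ x) (sym eq)) (R.+-identityˡ x)))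
        (λ eq → sym (trans (cong (_⊟ x) eq) (R.-‿inverseʳ x)))))
      ∑-nz-reflect : ∀ g → sum (λ x → g x * nz (a ⊟ x)) ≡ sum g - g a
      ∑-nz-reflect g = begin
        sum (λ x → g x * nz (a ⊟ x))        ≡⟨ sum-cong-≗ (λ x → trans (cong (g x *_) (nz-reflect x)) (eq (g x) (δ a x))) ⟩
        sum (λ x → g x - δ a x * g x)       ≡⟨ sum-distrib-- g (λ x → δ a x * g x) ⟩
        sum g - sum (λ x → δ a x * g x)     ≡⟨ cong (λ z → sum g - z) (δ-sum a g) ⟩
        sum g - g a                         ∎
        where
        eq : ∀ g d → g * (1ℤ - d) ≡ g - d * g
        eq = solve-∀
      ν-nz : sum (λ x → ν x * nz (a ⊟ x)) ≡ N - ν a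
      ν-nz = trans (∑-nz-reflect ν) (cong (_- ν a) ∑-ν≡N)
      reflect : sum (λ x → nz x * ν (a ⊟ x)) ≡ sum (λ x → ν x * nz (a ⊟ x))
      reflect = trans (sum-cong-≗ (λ x → trans (ℤ.*-comm (nz x) (ν (a ⊟ x)))
          (cong (λ z → ν (a ⊟ x) * nz z) (solve 2 (λ a x → x := a :- (a :- x)) refl a x))))
        (∑-reflect (λ x → ν x * nz (a ⊟ x)) a)
      νν : sum (λ x → ν x * ν (a ⊟ x)) ≡ 0ℤ
      νν = trans (∑-ν (λ x → ν (a ⊟ x))) (sum-zero (λ y → trans (nz-cong-* y (λ y≢0 →
        sum-zero (λ w → trans (nz-cong-* w (λ w≢0 → δ-≢ (λ eq → none y w y≢0 w≢0
          (trans (cong (y ^ k ⊕_) eq) (solve 2 (λ x a → x :+ (a :- x) := a) refl (y ^ k) a))))) (ℤ.*-zeroʳ (nz w)))))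
        (ℤ.*-zeroʳ (nz y))))

    -- Consequences of the lower bound on q

    module LargeField (1≤k : 1 ℕ.≤ k)
        (bound : (gcd k (q ℕ.∸ 1) ℕ.∸ 1) ℕ.^ 4 ℕ.+ 6 ℕ.* gcd k (q ℕ.∸ 1) ℕ.≤ q) where

      f : ℤ
      f = e - 1ℤ

      0≤f : 0ℤ ≤ f
      0≤f = ℤ.i≤j⇒0≤j-i 1≤e

      -- The hypothesis on d is monotone and e ≤ d. Since e ≥ 1, the truncated subtraction in ℕ
      -- becomes an honest one in ℤ.
      f-bound : (f * f) * (f * f) + + 6 * (f + 1ℤ) ≤ + q
      f-bound = from-ℕ f e 0≤f (e≤gcd 1≤k) (sym (back e))
        where
        back : ∀ x → x - 1ℤ + 1ℤ ≡ x
        back = solve-∀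
        d : ℕ
        d = gcd k (q ℕ.∸ 1)
        from-ℕ : ∀ f e → 0ℤ ≤ f → e ≤ + d → e ≡ f + 1ℤ → (f * f) * (f * f) + + 6 * (f + 1ℤ) ≤ + q
        from-ℕ (+ m) _ _ (ℤ.+≤+ m+1≤d) refl = subst (_≤ + q) cast (ℤ.+≤+ (ℕ.≤-trans (ℕ.+-mono-≤
            (ℕ.^-monoˡ-≤ 4 (ℕ.≤-trans (ℕ.≤-reflexive (sym (ℕ.m+n∸n≡m m 1))) (ℕ.∸-monoˡ-≤ 1 m+1≤d))) (ℕ.*-monoʳ-≤ 6 m+1≤d)) bound))
          where
          pow4 : ∀ m → m ℕ.^ 4 ≡ (m ℕ.* m) ℕ.* (m ℕ.* m)
          pow4 m = trans (cong (λ z → m ℕ.* (m ℕ.* (m ℕ.* z))) (ℕ.*-identityʳ m)) (sym (ℕ.*-assoc m m (m ℕ.* m)))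
          cast : + (m ℕ.^ 4 ℕ.+ 6 ℕ.* (m ℕ.+ 1)) ≡ (+ m * + m) * (+ m * + m) + + 6 * (+ m + 1ℤ)
          cast = trans (cong (λ z → + (z ℕ.+ 6 ℕ.* (m ℕ.+ 1))) (pow4 m)) (trans (ℤ.pos-+ ((m ℕ.* m) ℕ.* (m ℕ.* m)) (6 ℕ.* (m ℕ.+ 1)))
            (cong₂ _+_ (trans (ℤ.pos-* (m ℕ.* m) (m ℕ.* m)) (cong₂ _*_ (ℤ.pos-* m m) (ℤ.pos-* m m))) (ℤ.pos-* 6 (m ℕ.+ 1))))

      slack : ℤ
      slack = + q - ((f * f) * (f * f) + + 6 * (f + 1ℤ))

      0≤slack : 0ℤ ≤ slack
      0≤slack = ℤ.i≤j⇒0≤j-i f-bound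

      0<N : 0ℤ < N
      0<N = subst (0ℤ <_) (sym (trans N≡q-1 (eq f (+ q))))
        (ℤ.+-mono-<-≤ {0ℤ} {+ 5} (ℤ.+<+ ℕ.z<s) (0≤+ (0≤+ (0≤square (f * f)) (0≤* {+ 6} (ℤ.+≤+ ℕ.z≤n) 0≤f)) 0≤slack))
        where
        eq : ∀ f q → q - 1ℤ ≡ + 5 + ((f * f) * (f * f) + + 6 * f + (q - ((f * f) * (f * f) + + 6 * (f + 1ℤ))))
        eq = solve-∀

      sum-of-two-powers : ∀ {a} → a ≢ 𝟘 → ∃ λ y → ∃ λ w → y ≢ 𝟘 × w ≢ 𝟘 × y ^ k ⊕ w ^ k ≡ a
      sum-of-two-powers {a} a≢0
        with any? (λ y → any? (λ w → ¬? (y ≟ 𝟘) ×-dec (¬? (w ≟ 𝟘) ×-dec (y ^ k ⊕ w ^ k ≟ a))))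
      ... | yes found = found
      ... | no ¬found = contradiction (sym total≡0) (ℤ.<⇒≢ 0<total)
        where
        open Lines a≢0
        -- l = s + 1 contradicts cauchy-schwarz as soon as s² + 6 (f + 1) ≤ q, also in the case f = 0.
        s l w₁ w₀ : ℤ
        s = f * f
        l = s + 1ℤ
        w₁ = (+ 2 * (f + 1ℤ) - + q) - C a
        w₀ = E - C 𝟘
        -- What is left of q (s + 2) - s (s + 1)² - (s + 1)(6 f + 4) once q is written as s² + 6 (f
        -- + 1) + `slack`.
        X : ℤ
        X = + 8 + (+ 6 * f + + 2 * slack + s + s * slack)
        0≤s : 0ℤ ≤ s
        0≤s = 0≤square f
        0≤l : 0ℤ ≤ l
        0≤l = 0≤+ 0≤s (ℤ.+≤+ ℕ.z≤n)
        0≤w₁ : 0ℤ ≤ w₁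
        0≤w₁ = ℤ.i≤j⇒0≤j-i (ℤ.≤-trans
          (ℤ.≤-reflexive (C-without-sums a≢0 (λ y w y≢0 w≢0 eq → ¬found (y , w , y≢0 , w≢0 , eq))))
          (ℤ.+-monoˡ-≤ (- + q) (ℤ.*-monoˡ-≤-nonNeg (+ 2) (ℤ.≤-trans (ν≤e a) (ℤ.≤-reflexive (back e))))))
          where
          back : ∀ x → x ≡ x - 1ℤ + 1ℤ
          back = solve-∀
        0≤w₀ : 0ℤ ≤ w₀
        0≤w₀ = ℤ.i≤j⇒0≤j-i C-𝟘≤E
        0≤N : 0ℤ ≤ N
        0≤N = ℤ.<⇒≤ 0<N
        0<X : 0ℤ < X
        0<X = ℤ.+-mono-<-≤ {0ℤ} {+ 8} (ℤ.+<+ ℕ.z<s)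
          (0≤+ (0≤+ (0≤+ (0≤* {+ 6} (ℤ.+≤+ ℕ.z≤n) 0≤f) (0≤* {+ 2} (ℤ.+≤+ ℕ.z≤n) 0≤slack)) 0≤s) (0≤* 0≤s 0≤slack))
        -- Besides N² X, the summands are the Cauchy-Schwarz form and the upper estimates for C a
        -- and C 𝟘, with nonnegative multipliers chosen such that everything cancels after `E≡` and
        -- `W≡`.
        total : ℤ
        total = (N * N) * X + ((l * l * (E * E) + + 2 * l * W + + q * (E * E)) + + 2 * l * N * (N * w₁ + w₀))
        0<total : 0ℤ < total
        0<total = ℤ.+-mono-<-≤ {0ℤ} (0<* (0<* 0<N 0<N) 0<X) (0≤+ (cauchy-schwarz l)
          (0≤* (0≤* (0≤* {+ 2} (ℤ.+≤+ ℕ.z≤n) 0≤l) 0≤N) (0≤+ (0≤* 0≤N 0≤w₁) 0≤w₀)))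
        identity : ∀ n f q c c₀ →
          (n * n) * (+ 8 + (+ 6 * f + + 2 * (q - ((f * f) * (f * f) + + 6 * (f + 1ℤ))) + f * f + f * f * (q - ((f * f) * (f * f) + + 6 * (f + 1ℤ))))) +
          (((f * f + 1ℤ) * (f * f + 1ℤ) * ((n * f) * (n * f)) + + 2 * (f * f + 1ℤ) * (n * (n * c + c₀)) + q * ((n * f) * (n * f))) +
          + 2 * (f * f + 1ℤ) * n * (n * ((+ 2 * (f + 1ℤ) - q) - c) + (n * f - c₀))) ≡ 0ℤ
        identity = solve-∀
        total≡0 : total ≡ 0ℤ
        total≡0 = trans (cong₂ (λ E W → (N * N) * X + ((l * l * (E * E) + + 2 * l * W + + q * (E * E)) + + 2 * l * N * (N * w₁ + (E - C 𝟘)))) E≡ W≡)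
          (identity N f (+ q) (C a) (C 𝟘))

      -- Each value is the k-th power of at most e units, so four values account for at most 4 e of
      -- the q - 1 units, fewer than there are because q ≥ 6 e.
      avoid-four : ∀ x₁ x₂ x₃ x₄ → ∃ λ y → y ≢ 𝟘 × y ^ k ≢ x₁ × y ^ k ≢ x₂ × y ^ k ≢ x₃ × y ^ k ≢ x₄
      avoid-four x₁ x₂ x₃ x₄
        with any? (λ y → ¬? (y ≟ 𝟘) ×-dec ¬? (y ^ k ≟ x₁) ×-dec ¬? (y ^ k ≟ x₂) ×-dec ¬? (y ^ k ≟ x₃) ×-dec ¬? (y ^ k ≟ x₄))
      ... | yes found = found
      ... | no ¬found = contradiction N≤4e (ℤ.<⇒≱ 4e<N)
        where
        -- Counted with multiplicity, so that the four values may coincide.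
        D : Fin q → ℤ
        D x = (δ x₁ x + δ x₂ x) + (δ x₃ x + δ x₄ x)
        4e<N : + 4 * e < N
        4e<N = subst₂ _<_ (ℤ.+-identityʳ (+ 4 * e)) (sym (trans N≡q-1 (eq e (+ q))))
          (ℤ.+-mono-≤-< {+ 4 * e} ℤ.≤-refl (ℤ.+-mono-<-≤ {0ℤ} {1ℤ} (ℤ.+<+ ℕ.z<s)
            (0≤+ (0≤+ (0≤* {+ 2} (ℤ.+≤+ ℕ.z≤n) 0≤f) (0≤square (f * f))) 0≤slack)))
          where
          eq : ∀ e q → q - 1ℤ ≡ + 4 * e + (1ℤ + (+ 2 * (e - 1ℤ) + ((e - 1ℤ) * (e - 1ℤ)) * ((e - 1ℤ) * (e - 1ℤ)) +
            (q - (((e - 1ℤ) * (e - 1ℤ)) * ((e - 1ℤ) * (e - 1ℤ)) + + 6 * (e - 1ℤ + 1ℤ)))))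
          eq = solve-∀
        e≤ : ∀ {i} → 1ℤ ≤ i → e ≤ i * e
        e≤ {i} 1≤i = ℤ.≤-trans (ℤ.≤-reflexive (sym (ℤ.*-identityˡ e)))
          (ℤ.*-monoʳ-≤-nonNeg e {{ℤ.nonNegative (0≤ν 𝟙)}} 1≤i)
        ν≤ : ∀ x → ν x ≤ D x * e
        ν≤ x with x₁ ≟ x | x₂ ≟ x | x₃ ≟ x | x₄ ≟ x
        ... | yes _ | p | q | r = ℤ.≤-trans (ν≤e x) (e≤ (ℤ.+-mono-≤ (ℤ.+-mono-≤ (ℤ.≤-refl {1ℤ}) (0≤indicator (does p))) (0≤+ (0≤indicator (does q)) (0≤indicator (does r)))))
        ... | no _ | yes _ | q | r = ℤ.≤-trans (ν≤e x) (e≤ (ℤ.+-mono-≤ (ℤ.≤-refl {1ℤ}) (0≤+ (0≤indicator (does q)) (0≤indicator (does r)))))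
        ... | no _ | no _ | yes _ | r = ℤ.≤-trans (ν≤e x) (e≤ (ℤ.+-mono-≤ (ℤ.≤-refl {0ℤ}) (ℤ.+-mono-≤ (ℤ.≤-refl {1ℤ}) (0≤indicator (does r)))))
        ... | no _ | no _ | no _ | yes _ = ℤ.≤-trans (ν≤e x) (e≤ (ℤ.≤-refl {1ℤ}))
        ... | no n₁ | no n₂ | no n₃ | no n₄ = ℤ.≤-reflexive (sum-zero (λ y → trans (nz-cong-* y (λ y≢0 → δ-≢ (λ eq →
                ¬found (y , y≢0 , (λ p → n₁ (trans (sym p) eq)) , (λ p → n₂ (trans (sym p) eq)) ,
                  (λ p → n₃ (trans (sym p) eq)) , (λ p → n₄ (trans (sym p) eq)))))) (ℤ.*-zeroʳ (nz y))))
        ∑-δ : ∀ x → sum (δ x) ≡ 1ℤ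
        ∑-δ x = trans (sum-cong-≗ (λ y → sym (ℤ.*-identityʳ (δ x y)))) (δ-sum x (λ _ → 1ℤ))
        ∑-D : sum D ≡ + 4
        ∑-D = trans (∑-distrib-+ (λ x → δ x₁ x + δ x₂ x) (λ x → δ x₃ x + δ x₄ x))
          (cong₂ _+_ (trans (∑-distrib-+ (δ x₁) (δ x₂)) (cong₂ _+_ (∑-δ x₁) (∑-δ x₂)))
                     (trans (∑-distrib-+ (δ x₃) (δ x₄)) (cong₂ _+_ (∑-δ x₃) (∑-δ x₄))))
        N≤4e : N ≤ + 4 * e
        N≤4e = subst₂ _≤_ ∑-ν≡N (trans (sym (*-distribʳ-sum e D)) (cong (_* e) ∑-D)) (sum-mono-≤ ν≤)

open PowerCounting using (FiniteField; module PowerSums; module PowerCounts)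

-- Arbitrary finite fields and their k-th powers

module FiniteFields {c ℓ : Level} (F : CommutativeRing c ℓ) (isField : IsField F) {q : ℕ} (card : HasCardinality F q) where
  open CommutativeRing F hiding (zero)
  open IsField isField
  open HasCardinality card
  open IntegerCoefficientSolver F using (solve; _:=_; _:+_; _:*_; _:-_)
  open import Algebra.Properties.Semiring.Exp semiring using (_^_; ^-congˡ)
  open import Algebra.Properties.CommutativeSemiring.Exp commutativeSemiring using (^-distrib-*)
  open import Relation.Binary.Reasoning.Setoid setoid

  index : Carrier → Fin q
  index x = proj₁ (enum-surjective x)

  enum-index : ∀ x → enum (index x) ≈ x
  enum-index x = proj₂ (enum-surjective x)

  infix 4 _≟_
  _≟_ : ∀ x y → Dec (x ≈ y)
  x ≟ y = map′
    (λ eq → trans (sym (enum-index x)) (trans (reflexive (≡.cong enum eq)) (enum-index y)))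
    (λ eq → enum-injective (index x) (index y) (trans (enum-index x) (trans eq (sym (enum-index y)))))
    (index x Fin.≟ index y)

  search : ∀ {p} {P : Carrier → Set p} → (∀ {x y} → x ≈ y → P x → P y) → (∀ x → Dec (P x)) → Dec (∃ P)
  search resp P? = map′ (λ (i , p) → enum i , p) (λ (x , p) → index x , resp (sym (enum-index x)) p) (any? (λ i → P? (enum i)))

  *-cancelˡ-≉0 : ∀ {x y z} → ¬ x ≈ 0# → x * y ≈ x * z → y ≈ z
  *-cancelˡ-≉0 {x} {y} {z} x≉0 eq with x' , xx' ← inverse x x≉0 = begin
    y              ≈⟨ *-identityˡ y ⟨
    1# * y         ≈⟨ *-congʳ xx' ⟨
    (x * x') * y   ≈⟨ solve 3 (λ x x' y → x :* x' :* y := x' :* (x :* y)) refl x x' y ⟩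
    x' * (x * y)   ≈⟨ *-congˡ eq ⟩
    x' * (x * z)   ≈⟨ solve 3 (λ x x' y → x :* x' :* y := x' :* (x :* y)) refl x x' z ⟨
    (x * x') * z   ≈⟨ *-congʳ xx' ⟩
    1# * z         ≈⟨ *-identityˡ z ⟩
    z              ∎

  *-≉0 : ∀ {x y} → ¬ x ≈ 0# → ¬ y ≈ 0# → ¬ x * y ≈ 0#
  *-≉0 {x} x≉0 y≉0 eq = y≉0 (*-cancelˡ-≉0 x≉0 (trans eq (sym (zeroʳ x))))

  -≉0 : ∀ {x y} → ¬ x ≈ y → ¬ x - y ≈ 0#
  -≉0 {x} {y} x≉y eq = x≉y (begin
    x            ≈⟨ solve 2 (λ x y → x := x :- y :+ y) refl x y ⟩
    x - y + y    ≈⟨ +-congʳ eq ⟩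
    0# + y       ≈⟨ +-identityˡ y ⟩
    y            ∎)

  private
    rawRing′ : RawRing 0ℓ 0ℓ
    rawRing′ = record
      { Carrier = Fin q ; _≈_ = _≡_
      ; _+_ = λ i j → index (enum i + enum j) ; _*_ = λ i j → index (enum i * enum j)
      ; -_ = λ i → index (- enum i) ; 0# = index 0# ; 1# = index 1# }

    enum-isMonomorphism : IsRingMonomorphism rawRing′ rawRing enum
    enum-isMonomorphism = record
      { isRingHomomorphism = record
        { isSemiringHomomorphism = record
          { isNearSemiringHomomorphism = record
            { +-isMonoidHomomorphism = record
              { isMagmaHomomorphism = record
                { isRelHomomorphism = record { cong = λ eq → reflexive (≡.cong enum eq) }
                ; homo = λ i j → enum-index _ }
              ; ε-homo = enum-index _ }
            ; *-homo = λ i j → enum-index _ }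
          ; 1#-homo = enum-index _ }
        ; -‿homo = λ i → enum-index _ }
      ; injective = λ {i} {j} → enum-injective i j }

  -- The structure is transported along `enum`, so that the counting above works with indices and
  -- propositional equality.
  finiteField : FiniteField q
  finiteField = record
    { _⊕_ = λ i j → index (enum i + enum j) ; _⊛_ = λ i j → index (enum i * enum j)
    ; ⊖_ = λ i → index (- enum i) ; 𝟘 = index 0# ; 𝟙 = index 1#
    ; isCommutativeRing = RingMonomorphism.isCommutativeRing enum-isMonomorphism isCommutativeRing
    ; 𝟙≢𝟘 = λ eq → 1≉0 (trans (sym (enum-index 1#)) (trans (reflexive (≡.cong enum eq)) (enum-index 0#)))
    ; inverse = λ i i≢0 → let (y , eq) = inverse (enum i) (≉0 i≢0) in index y ,
        enum-injective _ _ (trans (enum-index _) (trans (*-congˡ (enum-index y)) (trans eq (sym (enum-index 1#)))))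
    }
    where
    ≉0 : ∀ {i} → i ≢ index 0# → ¬ enum i ≈ 0#
    ≉0 i≢0 eq = i≢0 (enum-injective _ _ (trans eq (sym (enum-index 0#))))

  module Powers (k : ℕ) (1≤k : 1 ℕ.≤ k) where

    Power : Carrier → Set (c ⊔ ℓ)
    Power x = ∃ λ y → y ^ k ≈ x

    Unit : Carrier → Set (c ⊔ ℓ)
    Unit x = Power x × ¬ x ≈ 0#

    power-resp : ∀ {x y} → x ≈ y → Power x → Power y
    power-resp x≈y (z , eq) = z , trans eq x≈y

    0^k≈0 : 0# ^ k ≈ 0#
    0^k≈0 = lemma k 1≤k
      where
      lemma : ∀ m → 1 ℕ.≤ m → 0# ^ m ≈ 0#
      lemma (suc m) _ = zeroˡ _

    power-0 : Power 0#
    power-0 = 0# , 0^k≈0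

    1^ : ∀ k → 1# ^ k ≈ 1#
    1^ zero = refl
    1^ (suc k) = trans (*-identityˡ _) (1^ k)

    power-1 : Power 1#
    power-1 = 1# , 1^ k

    power-* : ∀ {x y} → Power x → Power y → Power (x * y)
    power-* (a , p) (b , r) = a * b , trans (^-distrib-* a b k) (*-cong p r)

    unit-* : ∀ {x y} → Unit x → Unit y → Unit (x * y)
    unit-* (px , x≉0) (py , y≉0) = power-* px py , *-≉0 x≉0 y≉0

    power? : ∀ x → Dec (Power x)
    power? x = search (λ y≈z eq → trans (^-congˡ k (sym y≈z)) eq) (λ y → y ^ k ≟ x)

    unit-inverse : ∀ {x} → Unit x → ∃ λ x' → x * x' ≈ 1# × Unit x'
    unit-inverse {x} ((y , yk) , x≉0) with y ≟ 0#
    ... | yes y≈0 = contradiction (trans (sym yk) (trans (^-congˡ k y≈0) 0^k≈0)) x≉0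
    ... | no y≉0 with y' , yy' ← inverse y y≉0 = y' ^ k , eq , (y' , refl) , (λ y'k≈0 →
            1≉0 (trans (sym eq) (trans (*-congˡ y'k≈0) (zeroʳ x))))
      where
      eq : x * y' ^ k ≈ 1#
      eq = begin
        x * y' ^ k       ≈⟨ *-congʳ yk ⟨
        y ^ k * y' ^ k   ≈⟨ ^-distrib-* y y' k ⟨
        (y * y') ^ k     ≈⟨ ^-congˡ k yy' ⟩
        1# ^ k           ≈⟨ 1^ k ⟩
        1#               ∎

    -- This and `AvoidsFour` are the only arithmetic facts about the powers that the linear algebra
    -- receives from the bound on q.
    SumsOfTwo : Set (c ⊔ ℓ)
    SumsOfTwo = ∀ {a} → ¬ a ≈ 0# → ∃ λ x → ∃ λ y → Unit x × Unit y × a ≈ x + y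

    AvoidsFour : Set (c ⊔ ℓ)
    AvoidsFour = ∀ x₁ x₂ x₃ x₄ → ∃ λ x → Unit x × ¬ x ≈ x₁ × ¬ x ≈ x₂ × ¬ x ≈ x₃ × ¬ x ≈ x₄

    module LargeFieldPowers
        (bound : (gcd k (q ℕ.∸ 1) ℕ.∸ 1) ℕ.^ 4 ℕ.+ 6 ℕ.* gcd k (q ℕ.∸ 1) ℕ.≤ q) where

      module K = FiniteField finiteField
      module KR = CommutativeRing K.commutativeRing
      open import Algebra.Properties.Semiring.Exp KR.semiring using () renaming (_^_ to _^ₖ_)
      open PowerCounts finiteField k
      open LargeField 1≤k bound

      enum-^ : ∀ i m → enum (i ^ₖ m) ≈ enum i ^ m
      enum-^ i zero = enum-index 1#
      enum-^ i (suc m) = trans (enum-index _) (*-congˡ (enum-^ i m))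

      ≢⇒unit : ∀ {i} → i ≢ K.𝟘 → Unit (enum (i ^ₖ k))
      ≢⇒unit {i} i≢0 = (enum i , sym (enum-^ i k)) , λ eq →
        PowerSums.^-≢𝟘 finiteField k k i≢0 (enum-injective _ _ (trans eq (sym (enum-index 0#))))

      sum-of-two-units : SumsOfTwo
      sum-of-two-units {a} a≉0 with sum-of-two-powers {index a}
        (λ eq → a≉0 (trans (sym (enum-index a)) (trans (reflexive (≡.cong enum eq)) (enum-index 0#))))
      ... | y , w , y≢0 , w≢0 , eq = enum (y ^ₖ k) , enum (w ^ₖ k) , ≢⇒unit y≢0 , ≢⇒unit w≢0 ,
        trans (sym (enum-index a)) (trans (reflexive (≡.cong enum (≡.sym eq))) (enum-index _))

      avoid-four-units : AvoidsFour
      avoid-four-units x₁ x₂ x₃ x₄ with avoid-four (index x₁) (index x₂) (index x₃) (index x₄)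
      ... | y , y≢0 , n₁ , n₂ , n₃ , n₄ = enum (y ^ₖ k) , ≢⇒unit y≢0 , transfer n₁ , transfer n₂ , transfer n₃ , transfer n₄
        where
        transfer : ∀ {i x} → i ≢ index x → ¬ enum i ≈ x
        transfer {x = x} i≢ eq = i≢ (enum-injective _ _ (trans eq (sym (enum-index x))))

-- Vectors, spans and independence

module Spans {c ℓ : Level} (F : CommutativeRing c ℓ) where
  open CommutativeRing F hiding (zero)
  open IntegerCoefficientSolver F using (solve; _:=_; _:+_; _:*_; _:-_; :-_; con)

  -- The index set is arbitrary so that a pair of vectors is again a vector, indexed by a sum type;
  -- graphs of linear maps are handled this way.
  V : Set → Set c
  V I = I → Carrier


  module _ {I : Set} where
    infix 4 _≋_
    infixl 6 _⊹_ _⊖_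
    infixr 7 _·_

    _≋_ : V I → V I → Set ℓ
    x ≋ y = ∀ i → x i ≈ y i

    _⊹_ _⊖_ : V I → V I → V I
    (x ⊹ y) i = x i + y i
    (x ⊖ y) i = x i - y i

    _·_ : Carrier → V I → V I
    (a · x) i = a * x i

    0ᵥ : V I
    0ᵥ i = 0#

    -- Removing one multiple at a time exposes the coefficients in order. Over a finite field
    -- membership is then decided by searching for each of them, and the leading coefficient of a
    -- relation can be read off.
    data Span : List (V I) → V I → Set (c ⊔ ℓ) where
      nil : ∀ {x} → x ≋ 0ᵥ → Span [] x
      cons : ∀ {b bs x} a → Span bs (x ⊖ a · b) → Span (b ∷ bs) x

    record IsSubspace {p} (P : V I → Set p) : Set (c ⊔ ℓ ⊔ p) where
      field
        resp : ∀ {x y} → x ≋ y → P x → P y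
        zer : P 0ᵥ
        add : ∀ {x y} → P x → P y → P (x ⊹ y)
        scale : ∀ a {x} → P x → P (a · x)

      sub : ∀ {x y} → P x → P y → P (x ⊖ y)
      sub {x} {y} px py = resp (λ i → solve 2 (λ x y → x :+ (:- con (+ 1)) :* y := x :- y) refl (x i) (y i))
        (add px (scale (- 1#) py))

    span-resp : ∀ {bs x y} → x ≋ y → Span bs x → Span bs y
    span-resp x≋y (nil x≋0) = nil (λ i → trans (sym (x≋y i)) (x≋0 i))
    span-resp x≋y (cons a s) = cons a (span-resp (λ i → +-congʳ (x≋y i)) s)

    span-0 : ∀ bs → Span bs 0ᵥ
    span-0 [] = nil (λ i → refl)
    span-0 (b ∷ bs) = cons 0# (span-resp (λ i → solve 1 (λ b → con (+ 0) := con (+ 0) :- con (+ 0) :* b) refl (b i)) (span-0 bs))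

    span-add : ∀ {bs x y} → Span bs x → Span bs y → Span bs (x ⊹ y)
    span-add (nil x≋0) (nil y≋0) = nil (λ i → trans (+-cong (x≋0 i) (y≋0 i)) (+-identityʳ 0#))
    span-add {b ∷ bs} {x} {y} (cons a s) (cons a' s') = cons (a + a') (span-resp
      (λ i → solve 5 (λ x y a a' b → (x :- a :* b) :+ (y :- a' :* b) := x :+ y :- (a :+ a') :* b) refl (x i) (y i) a a' (b i))
      (span-add s s'))

    span-scale : ∀ {bs} d {x} → Span bs x → Span bs (d · x)
    span-scale d (nil x≋0) = nil (λ i → trans (*-congˡ (x≋0 i)) (zeroʳ d))
    span-scale {b ∷ bs} d {x} (cons a s) = cons (d * a) (span-resp
      (λ i → solve 4 (λ d x a b → d :* (x :- a :* b) := d :* x :- d :* a :* b) refl d (x i) a (b i)) (span-scale d s))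

    span-isSubspace : ∀ bs → IsSubspace (Span bs)
    span-isSubspace bs = record { resp = span-resp ; zer = span-0 bs ; add = span-add ; scale = span-scale }

    span-there : ∀ {b bs x} → Span bs x → Span (b ∷ bs) x
    span-there {b} {bs} {x} s = cons 0# (span-resp (λ i → solve 2 (λ x b → x := x :- con (+ 0) :* b) refl (x i) (b i)) s)

    span-here : ∀ {b bs} → Span (b ∷ bs) b
    span-here {b} {bs} = cons 1# (span-resp (λ i → solve 1 (λ b → con (+ 0) := b :- con (+ 1) :* b) refl (b i)) (span-0 bs))

    span-all : ∀ bs → All (Span bs) bs
    span-all [] = []
    span-all (b ∷ bs) = span-here ∷ All.map span-there (span-all bs)

    span-⊆ : ∀ {p} {P : V I → Set p} → IsSubspace P → ∀ {bs} → All P bs → ∀ {x} → Span bs x → P x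
    span-⊆ sP [] (nil x≋0) = IsSubspace.resp sP (λ i → sym (x≋0 i)) (IsSubspace.zer sP)
    span-⊆ sP {b ∷ bs} (pb ∷ pbs) {x} (cons a s) = IsSubspace.resp sP
      (λ i → solve 3 (λ x a b → x :- a :* b :+ a :* b := x) refl (x i) a (b i))
      (IsSubspace.add sP (span-⊆ sP pbs s) (IsSubspace.scale sP a pb))

    span-++ˡ : ∀ {as bs x} → Span as x → Span (as ++ bs) x
    span-++ˡ {[]} {bs} (nil x≋0) = span-resp (λ i → sym (x≋0 i)) (span-0 bs)
    span-++ˡ (cons a s) = cons a (span-++ˡ s)

    span-++ʳ : ∀ as {bs x} → Span bs x → Span (as ++ bs) x
    span-++ʳ [] s = s
    span-++ʳ (a ∷ as) s = span-there (span-++ʳ as s)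

    span-split : ∀ as {bs x} → Span (as ++ bs) x → ∃ λ y → Span as y × Span bs (x ⊖ y)
    span-split [] {x = x} s = 0ᵥ , nil (λ i → refl) , span-resp (λ i → solve 1 (λ x → x := x :- con (+ 0)) refl (x i)) s
    span-split (b ∷ as) {x = x} (cons a s) with span-split as s
    ... | y , sy , s' = y ⊹ a · b , cons a (span-resp (λ i → solve 3 (λ y a b → y := y :+ a :* b :- a :* b) refl (y i) a (b i)) sy) ,
      span-resp (λ i → solve 4 (λ x y a b → x :- a :* b :- y := x :- (y :+ a :* b)) refl (x i) (y i) a (b i)) s'

    -- Each vector is compared only with the later ones, which suits bases that grow at the head of
    -- the list.
    data Independent : List (V I) → Set (c ⊔ ℓ) where
      [] : Independent []
      _∷_ : ∀ {b bs} → ¬ Span bs b → Independent bs → Independent (b ∷ bs)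

-- Linear maps and the action of matrices

module LinearMaps {c ℓ : Level} (F : CommutativeRing c ℓ) where
  open CommutativeRing F hiding (zero)
  open IntegerCoefficientSolver F using (solve; _:=_; _:+_; _:*_; _:-_; :-_; con)
  open Spans F

  record IsLinear {I J : Set} (f : V I → V J) : Set (c ⊔ ℓ) where
    field
      resp : ∀ {x y} → x ≋ y → (f x) ≋ (f y)
      add : ∀ x y → (f (x ⊹ y)) ≋ ((f x) ⊹ (f y))
      scale : ∀ a x → (f (a · x)) ≋ (a · (f x))

    zer : (f 0ᵥ) ≋ 0ᵥ
    zer i = trans (resp (λ j → sym (zeroʳ 0#)) i) (trans (scale 0# 0ᵥ i) (zeroˡ (f 0ᵥ i)))

    sub : ∀ x y → (f (x ⊖ y)) ≋ ((f x) ⊖ (f y))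
    sub x y i = trans (resp (λ j → solve 2 (λ x y → x :- y := x :+ (:- con (+ 1)) :* y) refl (x j) (y j)) i)
      (trans (add x ((- 1#) · y) i) (trans (+-congˡ (scale (- 1#) y i))
        (solve 2 (λ x y → x :+ (:- con (+ 1)) :* y := x :- y) refl (f x i) (f y i))))

  preimage-isSubspace : ∀ {I J p} {P : V J → Set p} {f : V I → V J} → IsLinear f → IsSubspace {J} P → IsSubspace {I} (λ x → P (f x))
  preimage-isSubspace {f = f} lin sP = record
    { resp = λ x≋y → P.resp (L.resp x≋y)
    ; zer = P.resp (λ i → sym (L.zer i)) P.zer
    ; add = λ {x} {y} px py → P.resp (λ i → sym (L.add x y i)) (P.add px py)
    ; scale = λ a {x} px → P.resp (λ i → sym (L.scale a x i)) (P.scale a px) }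
    where
    module L = IsLinear lin
    module P = IsSubspace sP

  module Matrices (n : ℕ) where
    open MatrixDefs F
    open import Relation.Binary.Reasoning.Setoid setoid

    ∑-cong : ∀ {m} {f g : Fin m → Carrier} → (∀ i → f i ≈ g i) → ∑ f ≈ ∑ g
    ∑-cong {zero} eq = refl
    ∑-cong {suc m} eq = +-cong (eq zero) (∑-cong (eq ∘ suc))

    ∑-+ : ∀ {m} (f g : Fin m → Carrier) → ∑ (λ i → f i + g i) ≈ ∑ f + ∑ g
    ∑-+ {zero} f g = sym (+-identityʳ 0#)
    ∑-+ {suc m} f g = trans (+-congˡ (∑-+ (f ∘ suc) (g ∘ suc)))
      (solve 4 (λ a b c d → a :+ b :+ (c :+ d) := a :+ c :+ (b :+ d)) refl _ _ _ _)

    ∑-* : ∀ {m} a (f : Fin m → Carrier) → ∑ (λ i → a * f i) ≈ a * ∑ f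
    ∑-* {zero} a f = sym (zeroʳ a)
    ∑-* {suc m} a f = trans (+-congˡ (∑-* a (f ∘ suc))) (sym (distribˡ a _ _))

    ∑-0 : ∀ m → ∑ {m} (λ _ → 0#) ≈ 0#
    ∑-0 zero = refl
    ∑-0 (suc m) = trans (+-identityˡ _) (∑-0 m)

    ∑-swap : ∀ {m p} (f : Fin m → Fin p → Carrier) → ∑ (λ i → ∑ (λ j → f i j)) ≈ ∑ (λ j → ∑ (λ i → f i j))
    ∑-swap {zero} {p} f = sym (∑-0 p)
    ∑-swap {suc m} f = trans (+-congˡ (∑-swap (f ∘ suc))) (sym (∑-+ (f zero) (λ j → ∑ (λ i → f (suc i) j))))

    ∑-I : ∀ {m} (f : Fin m → Carrier) j → ∑ (λ i → f i * Iᴹ i j) ≈ f j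
    ∑-I {suc m} f zero = trans (+-cong (*-identityʳ _) (trans (∑-cong (λ i → zeroʳ (f (suc i)))) (∑-0 m))) (+-identityʳ _)
    ∑-I {suc m} f (suc j) = trans (+-cong (zeroʳ _) (∑-I (f ∘ suc) j)) (+-identityˡ _)

    I-sym : ∀ {m} (i j : Fin m) → Iᴹ i j ≈ Iᴹ j i
    I-sym zero zero = refl
    I-sym zero (suc j) = refl
    I-sym (suc i) zero = refl
    I-sym (suc i) (suc j) = I-sym i j

    infixr 8 _*ᵥ_
    _*ᵥ_ : Mat n → V (Fin n) → V (Fin n)
    (A *ᵥ x) i = ∑ (λ j → A i j * x j)

    basis : Fin n → V (Fin n)
    basis j i = Iᴹ i j

    infix 4 _≋ₙ_
    _≋ₙ_ : V (Fin n) → V (Fin n) → Set ℓ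
    _≋ₙ_ = _≋_

    *ᵥ-isLinear : ∀ A → IsLinear (A *ᵥ_)
    *ᵥ-isLinear A = record
      { resp = λ x≋y i → ∑-cong (λ j → *-congˡ (x≋y j))
      ; add = λ x y i → trans (∑-cong (λ j → distribˡ (A i j) (x j) (y j))) (∑-+ (λ j → A i j * x j) (λ j → A i j * y j))
      ; scale = λ a x i → trans (∑-cong (λ j → solve 3 (λ m a x → m :* (a :* x) := a :* (m :* x)) refl (A i j) a (x j))) (∑-* a (λ j → A i j * x j)) }

    *ᵥ-basis : ∀ A j → (A *ᵥ basis j) ≋ₙ (λ i → A i j)
    *ᵥ-basis A j i = ∑-I (A i) j

    I-*ᵥ : ∀ x → (Iᴹ *ᵥ x) ≋ₙ x
    I-*ᵥ x i = trans (∑-cong (λ j → trans (*-comm (Iᴹ i j) (x j)) (*-congˡ (I-sym i j)))) (∑-I x i)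

    *ᴹ-*ᵥ : ∀ A B x → ((A *ᴹ B) *ᵥ x) ≋ₙ (A *ᵥ (B *ᵥ x))
    *ᴹ-*ᵥ A B x i = begin
      ∑ (λ j → ∑ (λ k → A i k * B k j) * x j)       ≈⟨ ∑-cong (λ j → trans (*-comm _ (x j)) (sym (∑-* (x j) (λ k → A i k * B k j)))) ⟩
      ∑ (λ j → ∑ (λ k → x j * (A i k * B k j)))     ≈⟨ ∑-swap (λ j k → x j * (A i k * B k j)) ⟩
      ∑ (λ k → ∑ (λ j → x j * (A i k * B k j)))     ≈⟨ ∑-cong (λ k → trans (∑-cong (λ j →
                                                        solve 3 (λ x a b → x :* (a :* b) := a :* (b :* x)) refl (x j) (A i k) (B k j)))
                                                        (∑-* (A i k) (λ j → B k j * x j))) ⟩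
      ∑ (λ k → A i k * ∑ (λ j → B k j * x j))       ∎

    +ᴹ-*ᵥ : ∀ A B x → ((A +ᴹ B) *ᵥ x) ≋ₙ ((A *ᵥ x) ⊹ (B *ᵥ x))
    +ᴹ-*ᵥ A B x i = trans (∑-cong (λ j → distribʳ (x j) (A i j) (B i j))) (∑-+ (λ j → A i j * x j) (λ j → B i j * x j))

    •ᴹ-*ᵥ : ∀ a A x → ((a •ᴹ A) *ᵥ x) ≋ₙ (a · (A *ᵥ x))
    •ᴹ-*ᵥ a A x i = trans (∑-cong (λ j → *-assoc a (A i j) (x j))) (∑-* a (λ j → A i j * x j))

    0-*ᵥ : ∀ x → (0ᴹ *ᵥ x) ≋ₙ 0ᵥ
    0-*ᵥ x i = trans (∑-cong (λ j → zeroˡ (x j))) (∑-0 n)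

    ≈ᴹ⇒*ᵥ : ∀ {A B} → A ≈ᴹ B → ∀ x → (A *ᵥ x) ≋ₙ (B *ᵥ x)
    ≈ᴹ⇒*ᵥ A≈B x i = ∑-cong (λ j → *-congʳ (A≈B i j))

    *ᵥ⇒≈ᴹ : ∀ {A B} → (∀ x → (A *ᵥ x) ≋ₙ (B *ᵥ x)) → A ≈ᴹ B
    *ᵥ⇒≈ᴹ {A} {B} eq i j = trans (sym (*ᵥ-basis A j i)) (trans (eq (basis j) i) (*ᵥ-basis B j i))

    subspace-∑ : ∀ {J p} {P : V J → Set p} → IsSubspace {J} P → ∀ {m} (f : Fin m → V J) → (∀ j → P (f j)) → P (λ i → ∑ (λ j → f j i))
    subspace-∑ sP {zero} f pf = IsSubspace.zer sP
    subspace-∑ sP {suc m} f pf = IsSubspace.add sP (pf zero) (subspace-∑ sP (f ∘ suc) (pf ∘ suc))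


-- Decidable spans and linear extension from a basis

module FiniteSpans {c ℓ : Level} (F : CommutativeRing c ℓ) (isField : IsField F) {q : ℕ} (card : HasCardinality F q) where
  open CommutativeRing F hiding (zero)
  open IsField isField
  open FiniteFields F isField card
  open HasCardinality card
  open IntegerCoefficientSolver F using (solve; _:=_; _:+_; _:*_; _:-_; :-_; con)
  open Spans F
  open LinearMaps F

  abstract
    span? : ∀ {n} (bs : List (V (Fin n))) x → Dec (Span bs x)
    span? [] x = map′ nil (λ { (nil x≋0) → x≋0 }) (all? (λ i → x i ≟ 0#))
    span? (b ∷ bs) x = map′ (λ (a , s) → cons a s) (λ { (cons a s) → a , s })
      (search (λ a≈a' → span-resp (λ i → +-congˡ (-‿cong (*-congʳ a≈a')))) (λ a → span? bs (x ⊖ a · b)))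

  span-unscale : ∀ {I} {bs : List (V I)} {a x} → ¬ a ≈ 0# → Span bs (a · x) → Span bs x
  span-unscale {a = a} {x} a≉0 s = span-resp (λ i → trans
      (solve 3 (λ a a' x → a' :* (a :* x) := a :* a' :* x) refl a (proj₁ (inverse a a≉0)) (x i))
      (trans (*-congʳ (proj₂ (inverse a a≉0))) (*-identityˡ (x i))))
    (span-scale (proj₁ (inverse a a≉0)) s)

  -- The finite enumeration of all vectors serves the pigeonhole argument and the exhaustive greedy
  -- search.
  vector : ∀ {n} → Fin (q ℕ.^ n) → V (Fin n)
  vector k i = enum (finToFun k i)

  abstract
    vector-surjective : ∀ {n} (x : V (Fin n)) → ∃ λ k → vector k ≋ x
    vector-surjective x = funToFin (λ i → index (x i)) , λ i →
      trans (reflexive (≡.cong enum (finToFun-funToFin (λ i → index (x i)) i))) (enum-index (x i))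

  module Extension (n : ℕ) where
    open MatrixDefs F using (Mat; ∑; Iᴹ)
    open Matrices n

    -- The span of the pairs (b, t) is the graph of a linear map when the b form a basis.
    graph : List (V (Fin n) × V (Fin n)) → List (V (Fin n ⊎ Fin n))
    graph = map (λ (b , t) → [ b , t ])

    graph-total : ∀ ps {x} → Span (map proj₁ ps) x → ∃ λ y → Span (graph ps) [ x , y ]
    graph-total [] (nil x≋0) = 0ᵥ , nil λ { (inj₁ i) → x≋0 i ; (inj₂ i) → refl }
    graph-total ((b , t) ∷ ps) {x} (cons a s) with graph-total ps s
    ... | y , g = y ⊹ a · t , cons a (span-resp (λ { (inj₁ i) → refl
      ; (inj₂ i) → solve 3 (λ y a t → y := y :+ a :* t :- a :* t) refl (y i) a (t i) }) g)

    graph-domain : ∀ ps {z} → Span (graph ps) z → Span (map proj₁ ps) (λ i → z (inj₁ i))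
    graph-domain [] (nil z≋0) = nil (λ i → z≋0 (inj₁ i))
    graph-domain (p ∷ ps) (cons a s) = cons a (graph-domain ps s)

    -- Independence of the first components forces every coefficient of a combination with zero
    -- first half to vanish, so the graph is single-valued.
    graph-functional : ∀ ps → Independent (map proj₁ ps) → ∀ {z} → Span (graph ps) z →
      (∀ i → z (inj₁ i) ≈ 0#) → ∀ i → z (inj₂ i) ≈ 0#
    graph-functional [] _ (nil z≋0) _ i = z≋0 (inj₂ i)
    graph-functional ((b , t) ∷ ps) (b∉ ∷ ind) {z} (cons a s) z₁≈0 i = by-cases (a ≟ 0#)
      where
      by-cases : Dec (a ≈ 0#) → z (inj₂ i) ≈ 0#
      by-cases (yes a≈0) = begin
        z (inj₂ i)                      ≈⟨ solve 2 (λ z t → z := z :- con (+ 0) :* t) refl (z (inj₂ i)) (t i) ⟩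
        z (inj₂ i) - 0# * t i           ≈⟨ +-congˡ (-‿cong (*-congʳ a≈0)) ⟨
        z (inj₂ i) - a * t i            ≈⟨ graph-functional ps ind s (λ j → trans (+-cong (z₁≈0 j) (-‿cong (*-congʳ a≈0)))
                                             (solve 1 (λ b → con (+ 0) :- con (+ 0) :* b := con (+ 0)) refl (b j))) i ⟩
        0#                              ∎
        where open import Relation.Binary.Reasoning.Setoid setoid
      by-cases (no a≉0) = contradiction (span-unscale a≉0 (span-resp
        (λ j → trans (*-congˡ (+-congʳ (z₁≈0 j))) (solve 2 (λ a b → (:- con (+ 1)) :* (con (+ 0) :- a :* b) := a :* b) refl a (b j)))
        (span-scale (- 1#) (graph-domain ps s)))) b∉

    extend : ∀ ps → Independent (map proj₁ ps) → (∀ x → Span (map proj₁ ps) x) →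
      ∃ λ (B : Mat n) → All (λ (b , t) → (B *ᵥ b) ≋ t) ps
    extend ps ind spans = B , All.tabulate (λ {p} p∈ i → values p p∈ i)
      where
      image : Fin n → V (Fin n)
      image j = proj₁ (graph-total ps (spans (basis j)))
      B : Mat n
      B i j = image j i
      in-graph : ∀ x → Span (graph ps) [ x , B *ᵥ x ]
      in-graph x = span-resp (λ { (inj₁ i) → I-*ᵥ′ i ; (inj₂ i) → ∑-cong (λ j → *-comm (x j) (B i j)) })
        (subspace-∑ (span-isSubspace (graph ps)) (λ j → x j · [ basis j , image j ])
          (λ j → span-scale (x j) (proj₂ (graph-total ps (spans (basis j))))))
        where
        I-*ᵥ′ : ∀ i → ∑ (λ j → x j * Iᴹ i j) ≈ x i
        I-*ᵥ′ i = trans (∑-cong (λ j → *-comm (x j) (Iᴹ i j))) (I-*ᵥ x i)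
      values : ∀ p → p ∈ ps → (B *ᵥ proj₁ p) ≋ proj₂ p
      values (b , t) p∈ i = begin
        (B *ᵥ b) i                                    ≈⟨ solve 2 (λ u t → u := u :- t :+ t) refl ((B *ᵥ b) i) (t i) ⟩
        (B *ᵥ b) i - t i + t i                        ≈⟨ +-congʳ (graph-functional ps ind
          (IsSubspace.sub (span-isSubspace (graph ps)) (in-graph b) (All.lookup (span-all (graph ps)) (∈-map⁺ _ p∈)))
          (λ j → -‿inverseʳ (b j)) i) ⟩
        0# + t i                                      ≈⟨ +-identityˡ (t i) ⟩
        t i                                           ∎
        where open import Relation.Binary.Reasoning.Setoid setoid

-- Diagonals for A and B along a chain

module DiagonalPlans {c ℓ : Level} (F : CommutativeRing c ℓ) (isField : IsField F) {q : ℕ} (card : HasCardinality F q)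
    (k : ℕ) (1≤k : 1 ℕ.≤ k)
    (sum-of-two-units : FiniteFields.Powers.SumsOfTwo F isField card k 1≤k)
    (avoid-four-units : FiniteFields.Powers.AvoidsFour F isField card k 1≤k) where
  open CommutativeRing F hiding (zero)
  open IsField isField
  open FiniteFields F isField card
  open Powers k 1≤k
  open IntegerCoefficientSolver F using (solve; _:=_; _:+_; _:*_; _:-_; :-_; con)
  open import Relation.Binary.Reasoning.Setoid setoid

  move : ∀ {x y a b} → a ≈ b → x - y ≈ a - b → x ≈ y
  move {x} {y} {a} {b} a≈b eq = begin
    x              ≈⟨ solve 2 (λ x y → x := x :- y :+ y) refl x y ⟩
    x - y + y      ≈⟨ +-congʳ eq ⟩
    a - b + y      ≈⟨ +-congʳ (+-congʳ a≈b) ⟩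
    b - b + y      ≈⟨ solve 2 (λ b y → b :- b :+ y := y) refl b y ⟩
    y              ∎

  3# : Carrier
  3# = 1# + 1# + 1#

  -- After scaling by c₁ these four terms fill a chain of two vectors with trace 0: c₁ and c₁ t in
  -- A, c₁ x and c₁ y in B.
  record FourTerms (t x y : Carrier) : Set (c ⊔ ℓ) where
    field
      unit-t : Unit t
      unit-x : Unit x
      unit-y : Unit y
      t≉1 : ¬ t ≈ 1#
      x≉y : ¬ x ≈ y
      sums-to-0 : 1# + (t + (x + y)) ≈ 0#

  module Characteristic3 (3≈0 : 3# ≈ 0#) (¬-1 : ¬ Power (- 1#)) where

    Solution : Set (c ⊔ ℓ)
    Solution = ∃ λ t → ∃ λ x → ∃ λ y → FourTerms t x y

    abstract
      -- As - 1 is not a power, - (1 + g) is nonzero and so a sum of two units x and y. Different x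
      -- and y solve the problem; equal ones give 1 + g = - 2 x = x in characteristic 3.
      successor : ∀ {g} → Unit g → ¬ g ≈ 1# → Solution ⊎ Unit (1# + g)
      successor {g} ug g≉1 with sum-of-two-units { - (1# + g)} (λ eq → ¬-1 (power-resp (move (sym eq)
        (solve 1 (λ g → g :- (:- con (+ 1)) := con (+ 0) :- (:- (con (+ 1) :+ g))) refl g)) (proj₁ ug)))
      ... | x , y , ux , uy , eq with x ≟ y
      ... | no x≉y = inj₁ (g , x , y , record { unit-t = ug ; unit-x = ux ; unit-y = uy ; t≉1 = g≉1 ; x≉y = x≉y
              ; sums-to-0 = move (sym eq) (solve 3 (λ g x y →
                  con (+ 1) :+ (g :+ (x :+ y)) :- con (+ 0) := x :+ y :- (:- (con (+ 1) :+ g))) refl g x y) })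
      ... | yes x≈y = inj₂ (power-resp x≈1+g (proj₁ ux) , λ 1+g≈0 → proj₂ ux (trans x≈1+g 1+g≈0))
        where
        x≈1+g : x ≈ 1# + g
        x≈1+g = begin
          x                          ≈⟨ solve 1 (λ x → x := (con (+ 1) :+ con (+ 1) :+ con (+ 1)) :* x :- (x :+ x)) refl x ⟩
          3# * x - (x + x)           ≈⟨ +-cong (*-congʳ 3≈0) (-‿cong (+-congˡ x≈y)) ⟩
          0# * x - (x + y)           ≈⟨ +-congˡ (-‿cong eq) ⟨
          0# * x - (- (1# + g))      ≈⟨ solve 2 (λ x g → con (+ 0) :* x :- (:- (con (+ 1) :+ g)) := con (+ 1) :+ g) refl x g ⟩
          1# + g                     ∎

      -- In characteristic 3 adding 1 twice subtracts 1.
      predecessor : ∀ {g} → Unit g → ¬ g ≈ 1# → Solution ⊎ Unit (g - 1#)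
      predecessor {g} ug g≉1 = first (successor ug g≉1)
        where
        eq : 1# + (1# + g) ≈ g - 1#
        eq = move 3≈0 (solve 1 (λ g → con (+ 1) :+ (con (+ 1) :+ g) :- (g :- con (+ 1)) :=
          con (+ 1) :+ con (+ 1) :+ con (+ 1) :- con (+ 0)) refl g)
        1+g≉1 : ¬ 1# + g ≈ 1#
        1+g≉1 1+g≈1 = proj₂ ug (move 1+g≈1 (solve 1 (λ g → g :- con (+ 0) := con (+ 1) :+ g :- con (+ 1)) refl g))
        second : Solution ⊎ Unit (1# + (1# + g)) → Solution ⊎ Unit (g - 1#)
        second (inj₁ s) = inj₁ s
        second (inj₂ (p , ≉0)) = inj₂ (power-resp eq p , λ z → ≉0 (trans eq z))
        first : Solution ⊎ Unit (1# + g) → Solution ⊎ Unit (g - 1#)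
        first (inj₁ s) = inj₁ s
        first (inj₂ u) = second (successor u 1+g≉1)

    -- If both g - 1 and g⁻¹ - 1 were powers, so would be (g⁻¹ - 1) g / (g - 1) = - 1.
    solution : Solution
    solution with avoid-four-units 1# 1# 1# 1#
    ... | g , ug , g≉1 , _ with unit-inverse ug
    ... | g' , gg' , ug' with predecessor ug g≉1 | predecessor ug' (λ g'≈1 → g≉1 (trans (sym (*-identityʳ g)) (trans (*-congˡ (sym g'≈1)) gg')))
    ... | inj₁ s | _ = s
    ... | inj₂ _ | inj₁ s = s
    ... | inj₂ u | inj₂ u' with unit-inverse u
    ... | z , eq , uz = contradiction (power-resp (begin
      (g' - 1#) * g * z          ≈⟨ solve 3 (λ g g' z → (g' :- con (+ 1)) :* g :* z := (g :* g' :- g) :* z) refl g g' z ⟩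
      (g * g' - g) * z           ≈⟨ *-congʳ (+-congʳ gg') ⟩
      (1# - g) * z               ≈⟨ solve 2 (λ g z → (con (+ 1) :- g) :* z := :- ((g :- con (+ 1)) :* z)) refl g z ⟩
      - ((g - 1#) * z)           ≈⟨ -‿cong eq ⟩
      - 1#                       ∎) (power-* (power-* (proj₁ u') (proj₁ ug)) (proj₁ uz))) ¬-1

  -- Here v is the trace of a chain of two vectors minus the first entry of A: t is the last entry
  -- of A, and β and u are the entries of B, distinct because B joins them.
  record Triple (In : Carrier → Set ℓ) (v : Carrier) : Set (c ⊔ ℓ) where
    field
      {t β u} : Carrier
      power-t : Power t
      power-β : Power β
      power-u : Power u
      t∉ : ¬ In t
      β≉u : ¬ β ≈ u
      sum≈ : v ≈ t + (β + u)

  module Pair (c₁ c₂ : Carrier) (unit₁ : Unit c₁) (unit₂ : Unit c₂) (c₁≉c₂ : ¬ c₁ ≈ c₂) where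

    In : Carrier → Set ℓ
    In x = x ≈ c₁ ⊎ x ≈ c₂

    in? : ∀ x → Dec (In x)
    in? x = (x ≟ c₁) ⊎-dec (x ≟ c₂)

    -- The values where a decomposition into two units is not guaranteed or may consist of two equal
    -- elements of the pair.
    Exceptional : Carrier → Set ℓ
    Exceptional v = v ≈ 0# ⊎ v ≈ c₁ + c₁ ⊎ v ≈ c₂ + c₂

    exceptional? : ∀ v → Dec (Exceptional v)
    exceptional? v = (v ≟ 0#) ⊎-dec ((v ≟ c₁ + c₁) ⊎-dec (v ≟ c₂ + c₂))

    ¬In-0 : ¬ In 0#
    ¬In-0 (inj₁ eq) = proj₂ unit₁ (sym eq)
    ¬In-0 (inj₂ eq) = proj₂ unit₂ (sym eq)

    -- A summand outside the pair becomes the final entry of A, and B has the other summand and 0.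
    -- If both summands lie in the pair, they are distinct and go to B, and A ends with 0.
    triple : ∀ {v} → ¬ Exceptional v → Triple In v
    triple {v} ¬exc with sum-of-two-units {v} (λ eq → ¬exc (inj₁ eq))
    ... | x , y , (px , x≉0) , (py , y≉0) , eq with in? x | in? y
    ... | no x∉ | _ = record { power-t = px ; power-β = py ; power-u = power-0 ; t∉ = x∉ ; β≉u = y≉0
            ; sum≈ = trans eq (+-congˡ (sym (+-identityʳ y))) }
    ... | yes _ | no y∉ = record { power-t = py ; power-β = px ; power-u = power-0 ; t∉ = y∉ ; β≉u = x≉0
            ; sum≈ = trans eq (trans (+-comm x y) (+-congˡ (sym (+-identityʳ x)))) }
    ... | yes x∈ | yes y∈ = record { power-t = power-0 ; power-β = px ; power-u = py ; t∉ = ¬In-0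
            ; β≉u = λ x≈y → ¬exc (inj₂ (doubled x∈ x≈y)) ; sum≈ = trans eq (sym (+-identityˡ _)) }
      where
      doubled : In x → x ≈ y → v ≈ c₁ + c₁ ⊎ v ≈ c₂ + c₂
      doubled (inj₁ x≈) x≈y = inj₁ (trans eq (+-cong x≈ (trans (sym x≈y) x≈)))
      doubled (inj₂ x≈) x≈y = inj₂ (trans eq (+-cong x≈ (trans (sym x≈y) x≈)))

    One : Carrier → Set (c ⊔ ℓ)
    One T = ∃ λ α → In α × Triple In (T - α)

    module _ (c₂≉-c₁ : ¬ c₂ ≈ - c₁) (c₁≉3c₂ : ¬ c₁ ≈ 3# * c₂) (c₂≉3c₁ : ¬ c₂ ≈ 3# * c₁)
             (one-0 : 3# ≈ 0# → ∀ {T} → T ≈ 0# → One T) where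

      -- If both choices of α failed, the two resulting expressions for T would give a linear
      -- relation between c₁ and c₂. All are excluded except 3 c₁ = 3 c₂, which means characteristic
      -- 3 and T = 0.
      one : ∀ T → One T
      one T with exceptional? (T - c₁) | exceptional? (T - c₂)
      ... | no ¬exc | _ = c₁ , inj₁ refl , triple ¬exc
      ... | yes _ | no ¬exc = c₂ , inj₂ refl , triple ¬exc
      ... | yes exc₁ | yes exc₂ = cases exc₁ exc₂
        where
        combine : ∀ {x y} → T - c₁ ≈ x → T - c₂ ≈ y → c₁ + x ≈ c₂ + y
        combine {x} {y} p r = trans (+-congˡ (sym p)) (trans
          (solve 3 (λ T c₁ c₂ → c₁ :+ (T :- c₁) := c₂ :+ (T :- c₂)) refl T c₁ c₂) (+-congˡ r))
        cases : Exceptional (T - c₁) → Exceptional (T - c₂) → One T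
        cases (inj₁ p) (inj₁ r) = contradiction (move (combine p r)
          (solve 2 (λ x y → x :- y := x :+ con (+ 0) :- (y :+ con (+ 0))) refl c₁ c₂)) c₁≉c₂
        cases (inj₁ p) (inj₂ (inj₁ r)) = contradiction (move (sym (combine p r))
          (solve 2 (λ x y → y :- (:- x) := y :+ (x :+ x) :- (x :+ con (+ 0))) refl c₁ c₂)) c₂≉-c₁
        cases (inj₁ p) (inj₂ (inj₂ r)) = contradiction (move (combine p r)
          (solve 2 (λ x y → x :- (con (+ 1) :+ con (+ 1) :+ con (+ 1)) :* y := x :+ con (+ 0) :- (y :+ (y :+ y))) refl c₁ c₂)) c₁≉3c₂
        cases (inj₂ (inj₁ p)) (inj₁ r) = contradiction (move (sym (combine p r))
          (solve 2 (λ x y → y :- (con (+ 1) :+ con (+ 1) :+ con (+ 1)) :* x := y :+ con (+ 0) :- (x :+ (x :+ x))) refl c₁ c₂)) c₂≉3c₁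
        cases (inj₂ (inj₁ p)) (inj₂ (inj₁ r)) = contradiction (move (combine p r)
          (solve 2 (λ x y → x :- y := x :+ (x :+ x) :- (y :+ (x :+ x))) refl c₁ c₂)) c₁≉c₂
        cases (inj₂ (inj₁ p)) (inj₂ (inj₂ r)) with 3# ≟ 0#
        ... | yes 3≈0 = one-0 3≈0 (begin
          T                     ≈⟨ solve 2 (λ T x → T := x :+ (T :- x)) refl T c₁ ⟩
          c₁ + (T - c₁)         ≈⟨ +-congˡ p ⟩
          c₁ + (c₁ + c₁)        ≈⟨ solve 1 (λ x → x :+ (x :+ x) := (con (+ 1) :+ con (+ 1) :+ con (+ 1)) :* x) refl c₁ ⟩
          3# * c₁               ≈⟨ *-congʳ 3≈0 ⟩
          0# * c₁               ≈⟨ zeroˡ c₁ ⟩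
          0#                    ∎)
        ... | no 3≉0 = contradiction (*-cancelˡ-≉0 3≉0 (move (combine p r)
          (solve 2 (λ x y → (con (+ 1) :+ con (+ 1) :+ con (+ 1)) :* x :- (con (+ 1) :+ con (+ 1) :+ con (+ 1)) :* y :=
            x :+ (x :+ x) :- (y :+ (y :+ y))) refl c₁ c₂))) c₁≉c₂
        cases (inj₂ (inj₂ p)) (inj₁ r) = contradiction (move (combine p r)
          (solve 2 (λ x y → y :- (:- x) := x :+ (y :+ y) :- (y :+ con (+ 0))) refl c₁ c₂)) c₂≉-c₁
        cases (inj₂ (inj₂ p)) (inj₂ (inj₁ r)) = contradiction (move (sym (combine p r))
          (solve 2 (λ x y → x :- y := y :+ (x :+ x) :- (x :+ (y :+ y))) refl c₁ c₂)) c₁≉c₂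
        cases (inj₂ (inj₂ p)) (inj₂ (inj₂ r)) = contradiction (move (combine p r)
          (solve 2 (λ x y → x :- y := x :+ (y :+ y) :- (y :+ (y :+ y))) refl c₁ c₂)) c₁≉c₂

    -- PlanA r β T and PlanB r α T list the diagonals of A and B along a chain of r + 1 basis vectors whose
    -- entries sum to T. Subdiagonal entries go alternately to A and to B, the last one to B; neighbours joined
    -- in A (in B) need distinct diagonal entries in A (in B). The index β, α is the first entry in B, in A.
    mutual
      data PlanA : ℕ → Carrier → Carrier → Set (c ⊔ ℓ) where
        end : ∀ {t u T} → Power t → Power u → ¬ In t → T ≈ t + u → PlanA 0 u T
        stepA : ∀ {r α β α' T T'} → In α → Power β → ¬ α ≈ α' → T ≈ (α + β) + T' → PlanB r α' T' → PlanA (suc r) β T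

      data PlanB : ℕ → Carrier → Carrier → Set (c ⊔ ℓ) where
        stepB : ∀ {r α β β' T T'} → In α → Power β → ¬ β ≈ β' → T ≈ (α + β) + T' → PlanA r β' T' → PlanB (suc r) α T

    data Plan (r : ℕ) (T : Carrier) : Set (c ⊔ ℓ) where
      planA : ∀ {β} → PlanA r β T → Plan r T
      planB : ∀ {α} → PlanB r α T → Plan r T

    oneB : ∀ {α T} → In α → Triple In (T - α) → PlanB 1 α T
    oneB {α} {T} α∈ tr = stepB {T' = Triple.t tr + Triple.u tr} α∈ (Triple.power-β tr) (Triple.β≉u tr)
      (move (Triple.sum≈ tr) (solve 5 (λ T α t β u → T :- (α :+ β :+ (t :+ u)) := T :- α :- (t :+ (β :+ u))) refl
        T α (Triple.t tr) (Triple.β tr) (Triple.u tr)))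
      (end (Triple.power-t tr) (Triple.power-u tr) (Triple.t∉ tr) refl)

    -- As the last step belongs to B, the parity of the length decides which matrix starts. The case
    -- starting in A can avoid a given β, which is what a B-step in front of it needs; the case
    -- starting in B offers the fixed first entry c₁, which an A-step with entry c₂ can precede.
    long : ∀ j → (∀ T b → ∃ λ β → ¬ β ≈ b × PlanA (2 ℕ.+ j) β T) ⊎ (∀ T → PlanB (2 ℕ.+ j) c₁ T)
    long zero = inj₁ base
      where
      base : ∀ T b → ∃ λ β → ¬ β ≈ b × PlanA 2 β T
      -- Besides b, β avoids the three values for which the trace remaining for the last two
      -- vectors, minus c₁, is exceptional.
      base T b with avoid-four-units b (T - c₁ - c₂) (T - c₁ - c₂ - (c₁ + c₁)) (T - c₁ - c₂ - (c₂ + c₂))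
      ... | β , (pβ , _) , β≉b , n₀ , n₁ , n₂ = β , β≉b ,
          stepA {T' = T - (c₂ + β)} (inj₂ refl) pβ (λ eq → c₁≉c₂ (sym eq))
            (solve 2 (λ T x → T := x :+ (T :- x)) refl T (c₂ + β))
            (oneB (inj₁ refl) (triple ¬exc))
        where
        lem : ∀ {x} → T - (c₂ + β) - c₁ ≈ x → β ≈ T - c₁ - c₂ - x
        lem {x} eq = move (sym eq) (solve 5 (λ T c₁ c₂ β x → β :- (T :- c₁ :- c₂ :- x) := x :- (T :- (c₂ :+ β) :- c₁)) refl T c₁ c₂ β x)
        ¬exc : ¬ Exceptional (T - (c₂ + β) - c₁)
        ¬exc (inj₁ eq) = n₀ (trans (lem eq) (solve 1 (λ x → x :- con (+ 0) := x) refl (T - c₁ - c₂)))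
        ¬exc (inj₂ (inj₁ eq)) = n₁ (lem eq)
        ¬exc (inj₂ (inj₂ eq)) = n₂ (lem eq)
    long (suc j) with long j
    ... | inj₁ even = inj₂ odd
      where
      odd : ∀ T → PlanB (3 ℕ.+ j) c₁ T
      odd T with even (T - (c₁ + 0#)) 0#
      ... | β , β≉0 , p = stepB (inj₁ refl) power-0 (λ eq → β≉0 (sym eq)) (solve 2 (λ T x → T := x :+ (T :- x)) refl T (c₁ + 0#)) p
    ... | inj₂ odd = inj₁ even
      where
      even : ∀ T b → ∃ λ β → ¬ β ≈ b × PlanA (3 ℕ.+ j) β T
      even T b with avoid-four-units b b b b
      ... | β , (pβ , _) , β≉b , _ = β , β≉b , stepA (inj₂ refl) pβ (λ eq → c₁≉c₂ (sym eq))
        (solve 2 (λ T x → T := x :+ (T :- x)) refl T (c₂ + β)) (odd (T - (c₂ + β)))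

    plan-suc : (∀ T → One T) → ∀ r T → Plan (suc r) T
    plan-suc one zero T with one T
    ... | _ , α∈ , tr = planB (oneB α∈ tr)
    plan-suc one (suc j) T with long j
    ... | inj₁ even = planA (proj₂ (proj₂ (even T 0#)))
    ... | inj₂ odd = planB (odd T)

  -- A chain with r = 0 has a single diagonal entry, which no change of basis can alter; hence its
  -- trace has to be the common scalar a.
  record Plans (a : Carrier) : Set (c ⊔ ℓ) where
    field
      c₁ c₂ : Carrier
      unit₁ : Unit c₁
      unit₂ : Unit c₂
      c₁≉c₂ : ¬ c₁ ≈ c₂
    open Pair c₁ c₂ unit₁ unit₂ c₁≉c₂ public
    field
      plan : ∀ r T → (r ≡ 0 → T ≈ a) → Plan r T




  -- The value that the ratio c₂ / c₁ has to avoid besides ± 1 and 3.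
  record Third (w : Carrier) : Set (c ⊔ ℓ) where
    field
      inverse-3 : ¬ 3# ≈ 0# → 3# * w ≈ 1#
      four-terms : 3# ≈ 0# → ¬ Power (- 1#) → ∃ λ x → ∃ λ y → FourTerms w x y

  third : ∃ Third
  third with 3# ≟ 0# | power? (- 1#)
  ... | no 3≉0 | _ = proj₁ (inverse 3# 3≉0) , record
    { inverse-3 = λ _ → proj₂ (inverse 3# 3≉0) ; four-terms = λ 3≈0 → contradiction 3≈0 3≉0 }
  -- Neither condition applies here, and 1 is a harmless default because the ratio avoids it anyway.
  ... | yes 3≈0 | yes p = 1# , record
    { inverse-3 = λ 3≉0 → contradiction 3≈0 3≉0 ; four-terms = λ _ ¬p → contradiction p ¬p }
  ... | yes 3≈0 | no ¬p = proj₁ (Characteristic3.solution 3≈0 ¬p) , record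
    { inverse-3 = λ 3≉0 → contradiction 3≈0 3≉0 ; four-terms = λ _ _ → proj₂ (Characteristic3.solution 3≈0 ¬p) }

  power-sum : ∀ a → ∃ λ x → ∃ λ y → Power x × Power y × a ≈ x + y
  power-sum a with a ≟ 0#
  ... | yes a≈0 = 0# , 0# , power-0 , power-0 , trans a≈0 (sym (+-identityʳ 0#))
  ... | no a≉0 with sum-of-two-units a≉0
  ... | x , y , (px , _) , (py , _) , eq = x , y , px , py , eq

  module Choice {w h c₁ : Carrier} (third-w : Third w) (unit-h : Unit h)
      (h≉1 : ¬ h ≈ 1#) (h≉-1 : ¬ h ≈ - 1#) (h≉3 : ¬ h ≈ 3#) (h≉w : ¬ h ≈ w) (unit₁ : Unit c₁) where
    open Third third-w

    c₂ : Carrier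
    c₂ = c₁ * h

    unit₂ : Unit c₂
    unit₂ = unit-* unit₁ unit-h

    cancel : ∀ {x} → c₂ ≈ c₁ * x → h ≈ x
    cancel = *-cancelˡ-≉0 (proj₂ unit₁)

    c₁≉c₂ : ¬ c₁ ≈ c₂
    c₁≉c₂ eq = h≉1 (cancel (trans (sym eq) (sym (*-identityʳ c₁))))

    open Pair c₁ c₂ unit₁ unit₂ c₁≉c₂

    c₂≉-c₁ : ¬ c₂ ≈ - c₁
    c₂≉-c₁ eq = h≉-1 (cancel (trans eq (solve 1 (λ x → :- x := x :* (:- con (+ 1))) refl c₁)))

    c₂≉3c₁ : ¬ c₂ ≈ 3# * c₁
    c₂≉3c₁ eq = h≉3 (cancel (trans eq (*-comm 3# c₁)))

    c₁≉3c₂ : ¬ c₁ ≈ 3# * c₂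
    c₁≉3c₂ eq = by-cases (3# ≟ 0#)
      where
      by-cases : Dec (3# ≈ 0#) → ⊥
      by-cases (yes 3≈0) = proj₂ unit₁ (trans eq (trans (*-congʳ 3≈0) (zeroˡ c₂)))
      by-cases (no 3≉0) = h≉w (*-cancelˡ-≉0 3≉0 (trans (*-cancelˡ-≉0 (proj₂ unit₁) (begin
        c₁ * (3# * h)   ≈⟨ solve 3 (λ x y z → x :* (y :* z) := y :* (x :* z)) refl c₁ 3# h ⟩
        3# * (c₁ * h)   ≈⟨ eq ⟨
        c₁              ≈⟨ *-identityʳ c₁ ⟨
        c₁ * 1#         ∎)) (sym (inverse-3 3≉0))))

    -x≈x⇒x≈0 : 3# ≈ 0# → ∀ {x} → - x ≈ x → x ≈ 0#
    -x≈x⇒x≈0 3≈0 {x} eq = begin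
      x                   ≈⟨ solve 1 (λ x → x := (con (+ 1) :+ con (+ 1) :+ con (+ 1)) :* x :- (x :+ x)) refl x ⟩
      3# * x - (x + x)    ≈⟨ +-cong (*-congʳ 3≈0) (-‿cong (+-congˡ (sym eq))) ⟩
      0# * x - (x - x)    ≈⟨ solve 1 (λ x → con (+ 0) :* x :- (x :- x) := con (+ 0)) refl x ⟩
      0#                  ∎

    -- If - 1 is a power, - c₁, 1 and - 1 serve as t, β and u; otherwise the four-term solution
    -- scaled by c₁ does, and the ratio avoids w to keep c₁ w different from c₂.
    one-0 : 3# ≈ 0# → ∀ {T} → T ≈ 0# → One T
    one-0 3≈0 {T} T≈0 = c₁ , inj₁ refl , by-cases (power? (- 1#))
      where
      by-cases : Dec (Power (- 1#)) → Triple In (T - c₁)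
      by-cases (yes p) = record
        { power-t = power-resp (solve 1 (λ x → :- con (+ 1) :* x := :- x) refl c₁) (power-* p (proj₁ unit₁))
        ; power-β = power-1 ; power-u = p
        ; t∉ = λ { (inj₁ eq) → proj₂ unit₁ (-x≈x⇒x≈0 3≈0 eq) ; (inj₂ eq) → c₂≉-c₁ (sym eq) }
        ; β≉u = λ eq → 1≉0 (-x≈x⇒x≈0 3≈0 (sym eq))
        ; sum≈ = trans (+-congʳ T≈0) (solve 1 (λ x → con (+ 0) :- x := :- x :+ (con (+ 1) :- con (+ 1))) refl c₁) }
      by-cases (no ¬p) with x , y , ft ← four-terms 3≈0 ¬p = record
        { power-t = proj₁ (unit-* unit₁ unit-t)
        ; power-β = proj₁ (unit-* unit₁ unit-x)
        ; power-u = proj₁ (unit-* unit₁ unit-y)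
        ; t∉ = λ { (inj₁ eq) → t≉1 (*-cancelˡ-≉0 (proj₂ unit₁) (trans eq (sym (*-identityʳ c₁)))) ; (inj₂ eq) → h≉w (cancel (sym eq)) }
        ; β≉u = λ eq → x≉y (*-cancelˡ-≉0 (proj₂ unit₁) eq)
        ; sum≈ = begin
            T - c₁                            ≈⟨ +-congʳ T≈0 ⟩
            0# - c₁                           ≈⟨ +-congʳ (zeroʳ c₁) ⟨
            c₁ * 0# - c₁                      ≈⟨ +-congʳ (*-congˡ sums-to-0) ⟨
            c₁ * (1# + (w + (x + y))) - c₁    ≈⟨ solve 4 (λ c w x y → c :* (con (+ 1) :+ (w :+ (x :+ y))) :- c := c :* w :+ (c :* x :+ c :* y)) refl c₁ w x y ⟩
            c₁ * w + (c₁ * x + c₁ * y)        ∎ }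
        where open FourTerms ft

    plans : ∀ {a x y} → Power x → Power y → a ≈ x + y → ¬ In x → Plans a
    plans {a} {x} {y} px py a≈ x∉ = record { c₁ = c₁ ; c₂ = c₂ ; unit₁ = unit₁ ; unit₂ = unit₂ ; c₁≉c₂ = c₁≉c₂ ; plan = plan }
      where
      plan : ∀ r T → (r ≡ 0 → T ≈ a) → Plan r T
      plan zero T T≈a = planA (end px py x∉ (trans (T≈a ≡.refl) a≈))
      plan (suc r) T _ = plan-suc (one c₂≉-c₁ c₁≉3c₂ c₂≉3c₁ one-0) r T

  abstract
    plans-exist : ∀ a → Plans a
    plans-exist a with third
    ... | w , third-w with avoid-four-units 1# (- 1#) 3# w
    ... | h , unit-h , h≉1 , h≉-1 , h≉3 , h≉w with unit-inverse unit-h | power-sum a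
    -- Avoiding x and x / h keeps x, the entry of A for chains of one vector, away from both c₁ and
    -- c₂ = c₁ h.
    ... | h' , hh' , _ | x , y , px , py , a≈ with avoid-four-units x (h' * x) x x
    ... | c₁ , unit₁ , c₁≉x , c₁≉h'x , _ = Choice.plans third-w unit-h h≉1 h≉-1 h≉3 h≉w unit₁ px py a≈
      λ { (inj₁ eq) → c₁≉x (sym eq)
        ; (inj₂ eq) → c₁≉h'x (sym (trans (*-congˡ eq) (trans (solve 3 (λ h' c h → h' :* (c :* h) := (h :* h') :* c) refl h' c₁ h)
                        (trans (*-congʳ hh') (*-identityˡ c₁))))) }

-- Decomposition of a linear map into chains

module KrylovChains {c ℓ : Level} (F : CommutativeRing c ℓ) (isField : IsField F) {q : ℕ} (card : HasCardinality F q)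
    {n : ℕ} (M : (Fin n → CommutativeRing.Carrier F) → Fin n → CommutativeRing.Carrier F) (M-isLinear : LinearMaps.IsLinear F M) where
  open CommutativeRing F hiding (zero)
  open IsField isField
  open FiniteFields F isField card
  open IntegerCoefficientSolver F using (solve; _:=_; _:+_; _:*_; _:-_; :-_; con)
  open Spans F
  open LinearMaps F
  open FiniteSpans F isField card
  private
    module M = IsLinear M-isLinear
    U : Set c
    U = V (Fin n)

  pow : ℕ → U → U
  pow zero v = v
  pow (suc r) v = M (pow r v)

  pow-pow : ∀ i j v → pow i (pow j v) ≡ pow (i ℕ.+ j) v
  pow-pow zero j v = ≡.refl
  pow-pow (suc i) j v = ≡.cong M (pow-pow i j v)

  pow-isLinear : ∀ r → IsLinear (pow r)
  pow-isLinear zero = record { resp = λ eq → eq ; add = λ x y i → refl ; scale = λ a x i → refl }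
  pow-isLinear (suc r) = record
    { resp = λ eq → M.resp (P.resp eq)
    ; add = λ x y i → trans (M.resp (P.add x y) i) (M.add (pow r x) (pow r y) i)
    ; scale = λ a x i → trans (M.resp (P.scale a x) i) (M.scale a (pow r x) i) }
    where module P = IsLinear (pow-isLinear r)

  chain : ℕ → U → List U
  chain zero v = []
  chain (suc r) v = pow r v ∷ chain r v

  chain-∈ : ∀ {i r} v → i ℕ.< r → Span (chain r v) (pow i v)
  chain-∈ {i} {suc r} v i<1+r with ℕ.m<1+n⇒m<n∨m≡n i<1+r
  ... | inj₁ i<r = span-there (chain-∈ v i<r)
  ... | inj₂ ≡.refl = span-here

  chain-shift : ∀ r v → All (λ b → Span (chain (suc r) v) (M b)) (chain r v)
  chain-shift zero v = []
  chain-shift (suc r) v = span-here ∷ All.map span-there (chain-shift r v)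

  chain-pow : ∀ m s v → All (Span (chain (m ℕ.+ s) v)) (chain m (pow s v))
  chain-pow zero s v = []
  chain-pow (suc m) s v = ≡.subst (Span (chain (suc m ℕ.+ s) v)) (≡.sym (pow-pow m s v)) span-here ∷ All.map span-there (chain-pow m s v)

  span-mono : ∀ {bs cs : List U} → All (Span cs) bs → ∀ {x} → Span bs x → Span cs x
  span-mono {cs = cs} = span-⊆ (span-isSubspace cs)

  weaken : ∀ {b : U} {bs cs} → All (Span cs) bs → All (Span (b ∷ cs)) bs
  weaken = All.map span-there

  ++-mono : ∀ as {bs cs : List U} → All (Span cs) bs → All (Span (as ++ cs)) (as ++ bs)
  ++-mono as {bs} {cs} bs⊆cs = ++⁺ (All.map span-++ˡ (span-all as)) (All.map (span-++ʳ as) bs⊆cs)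

  -- Some monic polynomial of degree r in M sends x into the span of W.
  Relation : ℕ → U → List U → Set (c ⊔ ℓ)
  Relation r x W = Span (chain r x ++ W) (pow r x)

  relation-mono : ∀ {r x W W'} → All (Span W') W → Relation r x W → Relation r x W'
  relation-mono {r} {x} W⊆W' = span-mono (++-mono (chain r x) W⊆W')

  relation-resp : ∀ r {x y W} → x ≋ y → Relation r x W → Relation r y W
  relation-resp r {x} {y} {W} x≋y rel = span-resp (IsLinear.resp (pow-isLinear r) x≋y)
    (span-mono (++⁺ (All.map span-++ˡ (chain⊆ r)) (All.map (span-++ʳ (chain r y)) (span-all W))) rel)
    where
    chain⊆ : ∀ r → All (Span (chain r y)) (chain r x)
    chain⊆ zero = []
    chain⊆ (suc r) = span-resp (IsLinear.resp (pow-isLinear r) (λ i → sym (x≋y i))) span-here ∷ weaken (chain⊆ r)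

  Invariant : List U → Set (c ⊔ ℓ)
  Invariant W = ∀ {x} → Span W x → Span W (M x)

  invariant-pow : ∀ {W} → Invariant W → ∀ r {x} → Span W x → Span W (pow r x)
  invariant-pow inv zero s = s
  invariant-pow inv (suc r) s = inv (invariant-pow inv r s)

  relation-suc : ∀ {r x W} → Invariant W → Relation r x W → Relation (suc r) x W
  relation-suc {r} {x} {W} inv = span-⊆ (preimage-isSubspace M-isLinear (span-isSubspace (chain (suc r) x ++ W)))
    (++⁺ (All.map span-++ˡ (chain-shift r x)) (All.map (λ s → span-++ʳ (chain (suc r) x) (inv s)) (span-all W)))

  relation-translate : ∀ {W} → Invariant W → ∀ r {v w} → Span W w → Relation r (v ⊹ w) W → Relation r v W
  relation-translate {W} inv r {v} {w} w∈ rel = span-resp (λ i → trans (+-congʳ (IsLinear.add (pow-isLinear r) v w i))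
      (solve 2 (λ x y → x :+ y :- y := x) refl (pow r v i) (pow r w i)))
    (IsSubspace.sub (span-isSubspace (chain r v ++ W))
      (span-mono (++⁺ (chain⊆ r) (All.map (span-++ʳ (chain r v)) (span-all W))) rel)
      (span-++ʳ (chain r v) (invariant-pow inv r w∈)))
    where
    chain⊆ : ∀ r → All (Span (chain r v ++ W)) (chain r (v ⊹ w))
    chain⊆ zero = []
    chain⊆ (suc r) = span-resp (λ i → sym (IsLinear.add (pow-isLinear r) v w i))
      (span-add span-here (span-there (span-++ʳ (chain r v) (invariant-pow inv r w∈)))) ∷ weaken (chain⊆ r)

  Cell : Set c
  Cell = ℕ × U × Carrier

  ws ns : List Cell → List U
  ws [] = []
  ws ((r , v , t) ∷ L) = chain (suc r) v ++ ws L
  ns [] = []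
  ns ((r , v , t) ∷ L) = chain r v ++ ns L

  -- A cell (r , v , t) stands for the basis vectors v, Mv, …, Mʳv; modulo the non-final vectors of this
  -- and of the older cells, M maps the final vector Mʳv to t Mʳv.
  data Good : List Cell → Set (c ⊔ ℓ) where
    [] : Good []
    cell : ∀ {r v t L} → ¬ Relation r v (ws L) → Span (chain r v ++ ns L) (pow (suc r) v ⊖ t · pow r v) → Good L → Good ((r , v , t) ∷ L)

  ns⊆ws : ∀ L → All (Span (ws L)) (ns L)
  ns⊆ws [] = []
  ns⊆ws ((r , v , t) ∷ L) = ++⁺ (All.map (span-there ∘ span-++ˡ) (span-all (chain r v))) (All.map (span-there ∘ span-++ʳ (chain r v)) (ns⊆ws L))

  good-invariant : ∀ {L} → Good L → Invariant (ws L)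
  good-invariant {L} good = span-⊆ (preimage-isSubspace M-isLinear (span-isSubspace (ws L))) (generators good)
    where
    generators : ∀ {L} → Good L → All (λ b → Span (ws L) (M b)) (ws L)
    generators [] = []
    generators {(r , v , t) ∷ L} (cell _ rel good) =
      span-resp (λ i → solve 3 (λ x t y → x :- t :* y :+ t :* y := x) refl (pow (suc r) v i) t (pow r v i))
        (span-add (span-mono (ns⊆ws ((r , v , t) ∷ L)) rel) (span-scale t span-here)) ∷
      ++⁺ (All.map span-++ˡ (chain-shift r v)) (All.map (span-++ʳ (chain (suc r) v)) (generators good))

  -- P is a monic polynomial of degree r + 1 in M; of its coefficients only the second, - t, is
  -- recorded, because it becomes the trace of the chain.
  record MonicOperator (r : ℕ) (t : Carrier) (P : U → U) : Set (c ⊔ ℓ) where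
    field
      isLinear : IsLinear P
      lower : ∀ x → Span (chain r x) ((pow (suc r) x ⊖ t · pow r x) ⊖ P x)

  -- The coefficients that witness the membership for v define a polynomial in M, which can then be
  -- applied to every x.
  evaluation : ∀ m {v W y} → Span (chain m v ++ W) y →
    ∃ λ (Q : U → U) → IsLinear Q × (∀ x → Span (chain m x) (Q x)) × Span W (y ⊖ Q v)
  evaluation zero {y = y} s = (λ _ → 0ᵥ) ,
    record { resp = λ _ i → refl ; add = λ _ _ i → sym (+-identityʳ 0#) ; scale = λ a _ i → sym (zeroʳ a) } ,
    (λ x → nil (λ i → refl)) , span-resp (λ i → solve 1 (λ y → y := y :- con (+ 0)) refl (y i)) s
  evaluation (suc m) {v} {W} {y} (cons a s) with evaluation m s
  ... | Q , lin , low , rest = (λ x → Q x ⊹ a · pow m x) ,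
    record
      { resp = λ eq i → +-cong (L.resp eq i) (*-congˡ (P.resp eq i))
      ; add = λ x y i → trans (+-cong (L.add x y i) (*-congˡ (P.add x y i)))
          (solve 5 (λ a b c d e → a :+ b :+ c :* (d :+ e) := a :+ c :* d :+ (b :+ c :* e)) refl (Q x i) (Q y i) a (pow m x i) (pow m y i))
      ; scale = λ d x i → trans (+-cong (L.scale d x i) (*-congˡ (P.scale d x i)))
          (solve 4 (λ d q a p → d :* q :+ a :* (d :* p) := d :* (q :+ a :* p)) refl d (Q x i) a (pow m x i)) } ,
    (λ x → cons a (span-resp (λ i → solve 2 (λ q p → q := q :+ p :- p) refl (Q x i) (a * pow m x i)) (low x))) ,
    span-resp (λ i → solve 3 (λ y p q → y :- p :- q := y :- (q :+ p)) refl (y i) (a * pow m v i) (Q v i)) rest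
    where
    module L = IsLinear lin
    module P = IsLinear (pow-isLinear m)

  abstract
    relation⇒operator : ∀ {r v W} → Relation (suc r) v W → ∃ λ t → ∃ λ P → MonicOperator r t P × Span W (P v)
    relation⇒operator {r} {v} {W} (cons t s) with evaluation r s
    ... | Q , lin , low , rest = t , (λ x → (pow (suc r) x ⊖ t · pow r x) ⊖ Q x) , record
      { isLinear = record
        { resp = λ eq i → +-cong (+-cong (S.resp eq i) (-‿cong (*-congˡ (P.resp eq i)))) (-‿cong (L.resp eq i))
        ; add = λ x y i → trans (+-cong (+-cong (S.add x y i) (-‿cong (*-congˡ (P.add x y i)))) (-‿cong (L.add x y i)))
            (solve 7 (λ a b c d e f g → a :+ b :- c :* (d :+ e) :- (f :+ g) := (a :- c :* d :- f) :+ (b :- c :* e :- g)) refl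
              (pow (suc r) x i) (pow (suc r) y i) t (pow r x i) (pow r y i) (Q x i) (Q y i))
        ; scale = λ d x i → trans (+-cong (+-cong (S.scale d x i) (-‿cong (*-congˡ (P.scale d x i)))) (-‿cong (L.scale d x i)))
            (solve 5 (λ d a t p q → d :* a :- t :* (d :* p) :- d :* q := d :* (a :- t :* p :- q)) refl d (pow (suc r) x i) t (pow r x i) (Q x i)) }
      ; lower = λ x → span-resp (λ i → solve 2 (λ p q → q := p :- (p :- q)) refl ((pow (suc r) x ⊖ t · pow r x) i) (Q x i)) (low x) } , rest
      where
      module L = IsLinear lin
      module P = IsLinear (pow-isLinear r)
      module S = IsLinear (pow-isLinear (suc r))

  -- In a chain longer than r + 1, P (Mˢ v₁) has the final vector of the chain as leading term,
  -- so the final coordinates of z can be removed by adding a value of P.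
  abstract
    clear-ends : ∀ {r t P} → MonicOperator r t P → ∀ {K} → All (λ C → r ℕ.< proj₁ C) K → ∀ {z} → Span (ws K) z →
      ∃ λ w → Span (ws K) w × Span (ns K) (z ⊹ P w)
    clear-ends op [] (nil z≋0) = 0ᵥ , nil (λ i → refl) , nil (λ i → trans (+-cong (z≋0 i) (IsLinear.zer (MonicOperator.isLinear op) i)) (+-identityʳ 0#))
    clear-ends {r} {t} {P} op {(r₁ , v₁ , t₁) ∷ K} (r<r₁ ∷ r<K) {z} (cons a s)
      with s' , ≡.refl ← ℕ.m≤n⇒∃[o]m+o≡n r<r₁ | y , sy , sz ← span-split (chain r₁ v₁) s
      with w' , w'∈ , zw ← clear-ends op r<K sz =
        w' ⊖ a · u ,
        IsSubspace.sub (span-isSubspace (ws ((r₁ , v₁ , t₁) ∷ K))) (span-++ʳ (chain (suc r₁) v₁) w'∈)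
          (span-scale a (span-++ˡ (chain-∈ v₁ (ℕ.m≤n⇒m≤1+n (ℕ.s≤s (ℕ.m≤n+m s' r)))))) ,
        span-resp eq (span-add (span-++ˡ (span-add sy (span-scale a top))) (span-++ʳ (chain r₁ v₁) zw))
      where
      module O = MonicOperator op
      module P = IsLinear O.isLinear
      u : U
      u = pow s' v₁
      top : Span (chain r₁ v₁) (pow r₁ v₁ ⊖ P u)
      top = span-resp (λ i → trans (solve 3 (λ x y p → x :- y :- p :+ y := x :- p) refl (pow (suc r) u i) (t * pow r u i) (P u i))
              (+-congʳ (reflexive (≡.cong (λ f → f i) (pow-pow (suc r) s' v₁)))))
        (span-mono (chain-pow (suc r) s' v₁) (span-add (span-there (O.lower u)) (span-scale t span-here)))
      eq : ((y ⊹ a · (pow r₁ v₁ ⊖ P u)) ⊹ (((z ⊖ a · pow r₁ v₁) ⊖ y) ⊹ P w')) ≋ (z ⊹ P (w' ⊖ a · u))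
      eq i = trans (solve 6 (λ y a p Pu z Pw → (y :+ a :* (p :- Pu)) :+ (z :- a :* p :- y :+ Pw) := z :+ (Pw :- a :* Pu)) refl
                     (y i) a (pow r₁ v₁ i) (P u i) (z i) (P w' i))
        (+-congˡ (sym (trans (P.sub w' (a · u) i) (+-congˡ (-‿cong (P.scale a u i))))))

  abstract
    -- The w from `clear-ends` removes the final coordinates of P v, and P differs from Mʳ⁺¹ - t Mʳ
    -- only by non-final vectors of the new chain.
    attach : ∀ {r t P K v} → MonicOperator r t P → All (λ C → r ℕ.< proj₁ C) K → Span (ws K) (P v) →
      ∃ λ w → Span (ws K) w × Span (chain r (v ⊹ w) ++ ns K) (pow (suc r) (v ⊹ w) ⊖ t · pow r (v ⊹ w))
    attach {r} {t} {P} {K} {v} op r<K Pv∈ with w , w∈ , s ← clear-ends op r<K Pv∈ =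
      w , w∈ , span-resp (λ i → trans (+-congˡ (sym (P.add v w i))) (solve 2 (λ x p → x :- p :+ p := x) refl ((pow (suc r) (v ⊹ w) ⊖ t · pow r (v ⊹ w)) i) (P (v ⊹ w) i)))
        (span-add (span-++ˡ (O.lower (v ⊹ w))) (span-++ʳ (chain r (v ⊹ w)) s))
      where
      module O = MonicOperator op
      module P = IsLinear O.isLinear

  -- K holds the cells from before a pass and L the present ones. Corrections are always made modulo
  -- K, whose chains are longer than the current one; ends of chains of the same length added during
  -- the pass could not be cleared.
  record Stage {p} (Q : Cell → Set p) (K L : List Cell) : Set (c ⊔ ℓ ⊔ p) where
    field
      good : Good L
      all : All Q L
      ws⊆ : All (Span (ws L)) (ws K)
      ns⊆ : All (Span (ns L)) (ns K)

  module Pass (r : ℕ) {p} (Q : Cell → Set p) {K : List Cell} (good-K : Good K) (all-K : All Q K)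
      (r<K : All (λ C → r ℕ.< proj₁ C) K)
      (operator : ∀ v → ∃ λ t → ∃ λ P → MonicOperator r t P × Span (ws K) (P v) × (∀ v' → Q (r , v' , t))) where

    abstract
      insert : ∀ {L} v → Stage Q K L → ¬ Relation r v (ws L) →
        ∃ λ L' → Stage Q K L' × All (Span (ws L')) (ws L) × Relation r v (ws L')
      insert {L} v st ¬rel with operator v
      ... | t , P , op , Pv∈ , Qt with attach op r<K Pv∈
      ... | w , w∈ , s = (r , v ⊹ w , t) ∷ L , record
        { good = cell (λ rel → ¬rel (relation-translate (good-invariant S.good) r (span-mono S.ws⊆ w∈) rel))
                      (span-mono (++-mono (chain r (v ⊹ w)) S.ns⊆) s) S.good
        ; all = Qt (v ⊹ w) ∷ S.all
        ; ws⊆ = All.map (span-++ʳ (chain (suc r) (v ⊹ w))) S.ws⊆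
        ; ns⊆ = All.map (span-++ʳ (chain r (v ⊹ w))) S.ns⊆ } ,
        All.map (span-++ʳ (chain (suc r) (v ⊹ w))) (span-all (ws L)) ,
        -- Mʳ v is the new final vector Mʳ (v + w) minus Mʳ w, which lies in the invariant span of
        -- the older cells.
        span-++ʳ (chain r v) (span-resp (λ i → trans (+-congʳ (IsLinear.add (pow-isLinear r) v w i))
            (solve 2 (λ x y → x :+ y :- y := x) refl (pow r v i) (pow r w i)))
          (IsSubspace.sub (span-isSubspace (ws ((r , v ⊹ w , t) ∷ L))) span-here
            (span-++ʳ (chain (suc r) (v ⊹ w)) (invariant-pow (good-invariant S.good) r (span-mono S.ws⊆ w∈)))))
        where module S = Stage st

    pass : ∀ ks → ∃ λ L → Stage Q K L × All (λ k → Relation r (vector k) (ws L)) ks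
    pass [] = K , record { good = good-K ; all = all-K ; ws⊆ = span-all (ws K) ; ns⊆ = span-all (ns K) } , []
    pass (k ∷ ks) with pass ks
    ... | L , st , rels with span? (chain r (vector k) ++ ws L) (pow r (vector k))
    ... | yes rel = L , st , rel ∷ rels
    ... | no ¬rel with insert (vector k) st ¬rel
    ... | L' , st' , L⊆L' , rel = L' , st' , rel ∷ All.map (relation-mono {r} L⊆L') rels

    result : ∃ λ L → Stage Q K L × (∀ x → Relation r x (ws L))
    result with pass (allFin (q ℕ.^ n))
    ... | L , st , rels = L , st , λ x → relation-resp r (proj₂ (vector-surjective x)) (All.lookup rels (∈-allFin (proj₁ (vector-surjective x))))

  -- Exhausting the chains with final exponent r gives every vector a relation of degree r, which is
  -- the input of the next pass. It stops at degree 1, because chains of one vector need a common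
  -- scalar first.
  descend : ∀ r L → Good L → All (λ C → suc r ℕ.≤ proj₁ C) L → (∀ x → Relation (suc r) x (ws L)) →
    ∃ λ L' → Good L' × All (λ C → 1 ℕ.≤ proj₁ C) L' × (∀ x → Relation 1 x (ws L'))
  descend zero L good r≤ rel = L , good , r≤ , rel
  descend (suc r) L good r≤ rel with Pass.result (suc r) (λ C → suc r ℕ.≤ proj₁ C) good (All.map (ℕ.≤-trans (ℕ.n≤1+n _)) r≤) r≤
    (λ v → let (t , P , op , Pv) = relation⇒operator {suc r} {v} (rel v) in t , P , op , Pv , λ _ → ℕ.≤-refl)
  ... | L' , st , rel' = descend r L' (Stage.good st) (Stage.all st) rel'

  abstract
    -- Among the first qⁿ + 1 iterates of x two coincide; further applications of M move the later
    -- one to the exponent qⁿ + 1.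
    periodic : ∀ x → Relation (suc (q ℕ.^ n)) x []
    periodic x with pigeonhole (ℕ.n<1+n (q ℕ.^ n)) (λ i → proj₁ (vector-surjective (pow (toℕ i) x)))
    ... | i , j , i<j , eq with o , j+o≡N ← ℕ.m≤n⇒∃[o]m+o≡n (ℕ.<⇒≤ (toℕ<n j)) =
      span-++ˡ (span-resp same (chain-∈ x (≡.subst (o ℕ.+ toℕ i ℕ.<_) N≡ (ℕ.+-monoʳ-< o i<j))))
      where
      N≡ : o ℕ.+ toℕ j ≡ suc (q ℕ.^ n)
      N≡ = ≡.trans (ℕ.+-comm o (toℕ j)) j+o≡N
      same : pow (o ℕ.+ toℕ i) x ≋ pow (suc (q ℕ.^ n)) x
      same k = trans (reflexive (≡.cong (λ f → f k) (≡.sym (pow-pow o (toℕ i) x))))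
        (trans (IsLinear.resp (pow-isLinear o) (λ k' → trans (sym (proj₂ (vector-surjective (pow (toℕ i) x)) k'))
            (trans (reflexive (≡.cong (λ z → vector z k') eq)) (proj₂ (vector-surjective (pow (toℕ j) x)) k'))) k)
          (reflexive (≡.cong (λ f → f k) (≡.trans (pow-pow o (toℕ j) x) (≡.cong (λ m → pow m x) N≡)))))

  abstract
    -- Modulo W every vector is an eigenvector. Comparing the eigenvalues of x, v and x + v for a
    -- fixed v outside W shows that they agree or that x is a multiple of v modulo W.
    scalar-modulo : ∀ {W} → Invariant W → (∀ x → Relation 1 x W) → ∃ λ a → ∀ x → Span W (M x ⊖ a · x)
    scalar-modulo {W} inv rel = by-cases (any? (λ k → ¬? (span? W (vector k))))
      where
      module W = IsSubspace (span-isSubspace W)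
      eigenvalue : ∀ x → ∃ λ a → Span W (M x ⊖ a · x)
      eigenvalue x with rel x
      ... | cons a s = a , s
      by-cases : Dec (∃ λ k → ¬ Span W (vector k)) → ∃ λ a → ∀ x → Span W (M x ⊖ a · x)
      -- If W spans everything, any scalar will do.
      by-cases (no all∈) = 0# , λ x → W.sub (inv (everything x)) (span-scale 0# (everything x))
        where
        everything : ∀ x → Span W x
        everything x with k , vk≋x ← vector-surjective x =
          span-resp vk≋x (decidable-stable (span? W (vector k)) (λ ¬s → all∈ (k , ¬s)))
      by-cases (yes (k , v∉)) = a , scalar
        where
        v : U
        v = vector k
        a : Carrier
        a = proj₁ (eigenvalue v)
        v-eig : Span W (M v ⊖ a · v)
        v-eig = proj₂ (eigenvalue v)
        scalar : ∀ x → Span W (M x ⊖ a · x)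
        scalar x = compare (b ≟ d)
          where
          b d : Carrier
          b = proj₁ (eigenvalue (x ⊹ v))
          d = proj₁ (eigenvalue x)
          x-eig : Span W (M x ⊖ d · x)
          x-eig = proj₂ (eigenvalue x)
          combination : Span W ((b - d) · x ⊹ (b - a) · v)
          combination = span-resp (λ i → trans (+-congˡ (-‿cong (+-congʳ (M.add x v i))))
              (solve 7 (λ Mx Mv x v a b d → (Mx :- d :* x) :+ (Mv :- a :* v) :- (Mx :+ Mv :- b :* (x :+ v)) := (b :- d) :* x :+ (b :- a) :* v)
                refl (M x i) (M v i) (x i) (v i) a b d))
            (W.sub (W.add x-eig v-eig) (proj₂ (eigenvalue (x ⊹ v))))
          compare : Dec (b ≈ d) → Span W (M x ⊖ a · x)
          compare (no b≉d) = span-resp (λ i → trans (+-congʳ (+-congʳ (M.add x (μ · v) i))) (final i))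
            (W.add (W.sub (inv x+μv∈) (span-scale a x+μv∈)) (span-scale (- μ) v-eig))
            where
            e : Carrier
            e = proj₁ (inverse (b - d) (-≉0 b≉d))
            μ : Carrier
            μ = e * (b - a)
            x+μv∈ : Span W (x ⊹ μ · v)
            x+μv∈ = span-resp (λ i → trans (solve 5 (λ e f g x v → e :* (f :* x :+ g :* v) := f :* e :* x :+ e :* g :* v) refl e (b - d) (b - a) (x i) (v i))
                (+-congʳ (trans (*-congʳ (proj₂ (inverse (b - d) (-≉0 b≉d)))) (*-identityˡ (x i)))))
              (span-scale e combination)
            final : ∀ i → M x i + M (μ · v) i - a * (x i + μ * v i) + (- μ) * (M v i - a * v i) ≈ M x i - a * x i
            final i = trans (+-congʳ (+-congʳ (+-congˡ (M.scale μ v i))))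
              (solve 6 (λ Mx Mv x v a μ → Mx :+ μ :* Mv :- a :* (x :+ μ :* v) :+ (:- μ) :* (Mv :- a :* v) := Mx :- a :* x) refl (M x i) (M v i) (x i) (v i) a μ)
          compare (yes b≈d) = same (b ≟ a)
            where
            same : Dec (b ≈ a) → Span W (M x ⊖ a · x)
            same (yes b≈a) = span-resp (λ i → +-congˡ (-‿cong (*-congʳ (trans (sym b≈d) b≈a)))) x-eig
            same (no b≉a) = contradiction (span-unscale (-≉0 b≉a) (span-resp (λ i → trans (+-congʳ (*-congʳ (+-congʳ b≈d)))
              (solve 3 (λ d x y → (d :- d) :* x :+ y := y) refl d (x i) ((b - a) * v i))) combination)) v∉

  record Decomposition : Set (c ⊔ ℓ) where
    field
      a : Carrier
      cells : List Cell
      good : Good cells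
      end-scalar : All (λ (r , v , t) → r ≡ 0 → t ≈ a) cells
      spanning : ∀ x → Span (ws cells) x

  shifted-operator : ∀ a → MonicOperator 0 a (λ x → M x ⊖ a · x)
  shifted-operator a = record
    { isLinear = record
      { resp = λ eq i → +-cong (M.resp eq i) (-‿cong (*-congˡ (eq i)))
      ; add = λ x y i → trans (+-congʳ (M.add x y i)) (solve 5 (λ p q a x y → p :+ q :- a :* (x :+ y) := p :- a :* x :+ (q :- a :* y)) refl (M x i) (M y i) a (x i) (y i))
      ; scale = λ d x i → trans (+-congʳ (M.scale d x i)) (solve 4 (λ d p a x → d :* p :- a :* (d :* x) := d :* (p :- a :* x)) refl d (M x i) a (x i)) }
    ; lower = λ x → nil (λ i → -‿inverseʳ _) }

  abstract
    decomposition : Decomposition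
    decomposition with descend (q ℕ.^ n) [] [] [] periodic
    ... | K , good , 1≤K , rel with scalar-modulo (good-invariant good) rel
    -- The final pass uses M - a for every v, so all its cells get the same t; the condition `Q` is
    -- vacuous for longer chains.
    ... | a , scalar = finish (Pass.result 0 Q good (All.map (λ { {zero , _ , _} () ; {suc _ , _ , _} _ () }) 1≤K) 1≤K
        (λ v → a , (λ x → M x ⊖ a · x) , shifted-operator a , scalar v , λ _ _ → refl))
      where
      Q : Cell → Set ℓ
      Q (r , v , t) = r ≡ 0 → t ≈ a
      finish : (∃ λ L → Stage Q K L × (∀ x → Relation 0 x (ws L))) → Decomposition
      finish (L , st , rel₀) = record { a = a ; cells = L ; good = Stage.good st ; end-scalar = Stage.all st ; spanning = rel₀ }

-- Eigenvectors, minimal polynomials and k-th roots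

module Eigenvectors {c ℓ : Level} (F : CommutativeRing c ℓ) (isField : IsField F) {q : ℕ} (card : HasCardinality F q) (n : ℕ) where
  open CommutativeRing F hiding (zero)
  open IsField isField
  open FiniteFields F isField card
  open IntegerCoefficientSolver F using (solve; _:=_; _:+_; _:*_; _:-_; :-_; con)
  open import Algebra.Properties.Semiring.Exp semiring using (_^_)
  open Spans F
  open LinearMaps F
  open FiniteSpans F isField card
  open Matrices n
  open Extension n
  open MatrixDefs F
  open MonicPolynomials F
  private
    U : Set c
    U = V (Fin n)

  -- Sums of eigenvectors, with no independence demanded and zero vectors allowed; a basis is
  -- extracted only in `root`.
  data EigenSpan {p} (A : Mat n) (P : Carrier → Set p) : U → Set (c ⊔ ℓ ⊔ p) where
    eig : ∀ {x} μ → A *ᵥ x ≋ μ · x → P μ → EigenSpan A P x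
    zer : ∀ {x} → x ≋ 0ᵥ → EigenSpan A P x
    add : ∀ {x y z} → x ≋ y ⊹ z → EigenSpan A P y → EigenSpan A P z → EigenSpan A P x

  module _ {p} {A : Mat n} {P : Carrier → Set p} where
    private
      module A = IsLinear (*ᵥ-isLinear A)

    eigenSpan-resp : ∀ {x y} → x ≋ y → EigenSpan A P x → EigenSpan A P y
    eigenSpan-resp x≋y (eig μ Ax pμ) = eig μ (λ i → trans (A.resp (λ j → sym (x≋y j)) i) (trans (Ax i) (*-congˡ (x≋y i)))) pμ
    eigenSpan-resp x≋y (zer x≋0) = zer (λ i → trans (sym (x≋y i)) (x≋0 i))
    eigenSpan-resp x≋y (add x≋ ey ez) = add (λ i → trans (sym (x≋y i)) (x≋ i)) ey ez

    eigenSpan-scale : ∀ a {x} → EigenSpan A P x → EigenSpan A P (a · x)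
    eigenSpan-scale a {x} (eig μ Ax pμ) = eig μ (λ i → trans (A.scale a x i) (trans (*-congˡ (Ax i))
      (solve 3 (λ a μ x → a :* (μ :* x) := μ :* (a :* x)) refl a μ (x i)))) pμ
    eigenSpan-scale a (zer x≋0) = zer (λ i → trans (*-congˡ (x≋0 i)) (zeroʳ a))
    eigenSpan-scale a (add {y = y} {z} x≋ ey ez) = add (λ i → trans (*-congˡ (x≋ i)) (distribˡ a (y i) (z i)))
      (eigenSpan-scale a ey) (eigenSpan-scale a ez)

    eigenSpan-isSubspace : IsSubspace (EigenSpan A P)
    eigenSpan-isSubspace = record { resp = eigenSpan-resp ; zer = zer (λ i → refl) ; add = add (λ i → refl) ; scale = eigenSpan-scale }

    -- On an eigenvector for μ the map A - t multiplies by the invertible μ - t.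
    eigenSpan-solve : ∀ {t} → (∀ {μ} → P μ → ¬ μ ≈ t) → ∀ {x} → EigenSpan A P x →
      ∃ λ y → EigenSpan A P y × (A *ᵥ y) ⊖ t · y ≋ x
    eigenSpan-solve {t} P≉t {x} (eig μ Ax pμ) = d · x , eigenSpan-scale d (eig μ Ax pμ) ,
      λ i → trans (+-congʳ (trans (A.scale d x i) (*-congˡ (Ax i)))) (trans
        (solve 4 (λ d μ t x → d :* (μ :* x) :- t :* (d :* x) := (μ :- t) :* d :* x) refl d μ t (x i))
        (trans (*-congʳ (proj₂ (inverse (μ - t) (-≉0 (P≉t pμ))))) (*-identityˡ (x i))))
      where
      d : Carrier
      d = proj₁ (inverse (μ - t) (-≉0 (P≉t pμ)))
    eigenSpan-solve {t} P≉t {x} (zer x≋0) = 0ᵥ , zer (λ i → refl) ,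
      λ i → trans (+-cong (A.zer i) (-‿cong (zeroʳ t))) (trans (-‿inverseʳ 0#) (sym (x≋0 i)))
    eigenSpan-solve {t} P≉t {x} (add x≋ ey ez) =
      let (y' , ey' , eqy) = eigenSpan-solve P≉t ey
          (z' , ez' , eqz) = eigenSpan-solve P≉t ez
      in y' ⊹ z' , add (λ i → refl) ey' ez' ,
        λ i → trans (+-congʳ (A.add y' z' i)) (trans
          (solve 5 (λ p q t y z → p :+ q :- t :* (y :+ z) := (p :- t :* y) :+ (q :- t :* z)) refl ((A *ᵥ y') i) ((A *ᵥ z') i) t (y' i) (z' i))
          (trans (+-cong (eqy i) (eqz i)) (sym (x≋ i))))

  eigenSpan-map : ∀ {p p'} {A : Mat n} {P : Carrier → Set p} {Q : Carrier → Set p'} → (∀ {μ} → P μ → Q μ) →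
    ∀ {x} → EigenSpan A P x → EigenSpan A Q x
  eigenSpan-map f (eig μ Ax pμ) = eig μ Ax (f pμ)
  eigenSpan-map f (zer x≋0) = zer x≋0
  eigenSpan-map f (add x≋ ey ez) = add x≋ (eigenSpan-map f ey) (eigenSpan-map f ez)

  -- If (A - t) y = x, then e - y is an eigenvector for t.
  eigenSpan-step : ∀ {p p'} {A : Mat n} {P : Carrier → Set p} {Q : Carrier → Set p'} → (∀ {μ} → P μ → Q μ) →
    ∀ {t e x} → Q t → (∀ {μ} → P μ → ¬ μ ≈ t) → A *ᵥ e ≋ t · e ⊹ x → EigenSpan A P x → EigenSpan A Q e
  eigenSpan-step {A = A} f {t} {e} {x} qt P≉t Ae ex =
    let (y , ey , eq) = eigenSpan-solve P≉t ex
    in add (λ i → solve 2 (λ e y → e := e :- y :+ y) refl (e i) (y i))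
      (eig {x = e ⊖ y} t (λ i → trans (IsLinear.sub (*ᵥ-isLinear A) e y i) (trans (+-congʳ (trans (Ae i) (+-congˡ (sym (eq i)))))
        (solve 4 (λ t e y Ay → t :* e :+ (Ay :- t :* y) :- Ay := t :* (e :- y)) refl t (e i) (y i) ((A *ᵥ y) i)))) qt)
      (eigenSpan-map f ey)

  peval-mulLinear : ∀ {m} l (p : Vec Carrier m) x → peval (mulLinear l p) x ≈ (x - l) * peval p x
  peval-mulLinear l p x = trans (general 0# p) (+-identityˡ _)
    where
    -- The shift by one place leaves a head coefficient, which varies in the recursion; 0 is its
    -- initial value.
    general : ∀ {m} b (p : Vec Carrier m) → peval (zipWith _+_ (b ∷ p) (Vec.map (λ a → - l * a) (p ∷ʳ 1#))) x ≈ b + (x - l) * peval p x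
    general b [] = solve 3 (λ b l x → b :+ (:- l) :* con (+ 1) :+ x :* con (+ 1) := b :+ (x :- l) :* con (+ 1)) refl b l x
    general b (a ∷ p) = trans (+-congˡ (*-congˡ (general a p)))
      (solve 5 (λ b l x a p → b :+ (:- l) :* a :+ x :* (a :+ (x :- l) :* p) := b :+ (x :- l) :* (a :+ x :* p)) refl b l x a (peval p x))

  peval-prodLinear : ∀ {r} (ls : Vec Carrier r) i {x} → lookup ls i ≈ x → peval (prodLinear ls) x ≈ 0#
  peval-prodLinear (l ∷ ls) zero {x} l≈x = trans (peval-mulLinear l (prodLinear ls) x)
    (trans (*-congʳ (trans (+-congʳ (sym l≈x)) (-‿inverseʳ l))) (zeroˡ _))
  peval-prodLinear (l ∷ ls) (suc i) {x} eq = trans (peval-mulLinear l (prodLinear ls) x)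
    (trans (*-congˡ (peval-prodLinear ls i eq)) (zeroʳ _))

  distinct-roots : ∀ {r m} (ls : Vec Carrier r) → (∀ i j → lookup ls i ≈ lookup ls j → i ≡ j) →
    (p : Vec Carrier m) → (∀ i → peval p (lookup ls i) ≈ 0#) → r ℕ.≤ m
  distinct-roots [] _ p roots = ℕ.z≤n
  distinct-roots {m = zero} (l ∷ ls) _ [] roots = contradiction (roots zero) 1≉0
  distinct-roots {m = suc m} (l ∷ ls) distinct p roots = ℕ.s≤s (distinct-roots ls
    (λ i j eq → suc-injective (distinct (suc i) (suc j) eq)) (quotient l p)
    (λ i → *-cancelˡ-≉0 (-≉0 (λ eq → contradiction (distinct (suc i) zero eq) λ ()))
      (trans (sym (quotient-root l p (roots zero) (lookup ls i))) (trans (roots (suc i)) (sym (zeroʳ _))))))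

  evalᴹ-eigenvector : ∀ {m} (p : MonicPoly m) {A w ρ} → A *ᵥ w ≋ ρ · w → evalᴹ p A *ᵥ w ≋ peval p ρ · w
  evalᴹ-eigenvector [] {w = w} Aw i = trans (I-*ᵥ w i) (sym (*-identityˡ (w i)))
  evalᴹ-eigenvector (a ∷ p) {A} {w} {ρ} Aw i = begin
    (evalᴹ (a ∷ p) A *ᵥ w) i                               ≈⟨ +ᴹ-*ᵥ (a •ᴹ Iᴹ) (A *ᴹ evalᴹ p A) w i ⟩
    ((a •ᴹ Iᴹ) *ᵥ w) i + ((A *ᴹ evalᴹ p A) *ᵥ w) i         ≈⟨ +-cong (trans (•ᴹ-*ᵥ a Iᴹ w i) (*-congˡ (I-*ᵥ w i))) (*ᴹ-*ᵥ A (evalᴹ p A) w i) ⟩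
    a * w i + (A *ᵥ (evalᴹ p A *ᵥ w)) i                    ≈⟨ +-congˡ (A.resp (evalᴹ-eigenvector p Aw) i) ⟩
    a * w i + (A *ᵥ (peval p ρ · w)) i                     ≈⟨ +-congˡ (trans (A.scale (peval p ρ) w i) (*-congˡ (Aw i))) ⟩
    a * w i + peval p ρ * (ρ * w i)                        ≈⟨ solve 4 (λ a w p ρ → a :* w :+ p :* (ρ :* w) := (a :+ ρ :* p) :* w) refl a (w i) (peval p ρ) ρ ⟩
    (a + ρ * peval p ρ) * w i                              ∎
    where
    open import Relation.Binary.Reasoning.Setoid setoid
    module A = IsLinear (*ᵥ-isLinear A)

  ^ᴹ-eigenvector : ∀ k {A w ρ} → A *ᵥ w ≋ ρ · w → (A ^ᴹ k) *ᵥ w ≋ (ρ ^ k) · w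
  ^ᴹ-eigenvector zero {w = w} Aw i = trans (I-*ᵥ w i) (sym (*-identityˡ (w i)))
  ^ᴹ-eigenvector (suc k) {A} {w} {ρ} Aw i = trans (*ᴹ-*ᵥ A (A ^ᴹ k) w i) (trans (A.resp (^ᴹ-eigenvector k Aw) i)
    (trans (A.scale (ρ ^ k) w i) (trans (*-congˡ (Aw i)) (solve 3 (λ p ρ w → p :* (ρ :* w) := ρ :* p :* w) refl (ρ ^ k) ρ (w i)))))
    where module A = IsLinear (*ᵥ-isLinear A)

  agree-isSubspace : ∀ {f g : U → U} → IsLinear f → IsLinear g → IsSubspace (λ x → f x ≋ g x)
  agree-isSubspace {f} {g} lf lg = record
    { resp = λ x≋y eq i → trans (f.resp (λ j → sym (x≋y j)) i) (trans (eq i) (g.resp x≋y i))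
    ; zer = λ i → trans (f.zer i) (sym (g.zer i))
    ; add = λ {x} {y} p r i → trans (f.add x y i) (trans (+-cong (p i) (r i)) (sym (g.add x y i)))
    ; scale = λ a {x} p i → trans (f.scale a x i) (trans (*-congˡ (p i)) (sym (g.scale a x i))) }
    where
    module f = IsLinear lf
    module g = IsLinear lg

  basis-spans : ∀ {p} {P : U → Set p} → IsSubspace P → (∀ j → P (basis j)) → ∀ x → P x
  basis-spans sP Pb x = IsSubspace.resp sP (λ i → trans (∑-cong (λ j → *-comm (x j) (Iᴹ i j))) (I-*ᵥ x i))
    (subspace-∑ sP (λ j → x j · basis j) (λ j → IsSubspace.scale sP (x j) (Pb j)))

  independent-sublist : ∀ {p} {Q : U × Carrier → Set p} es → All Q es →
    ∃ λ es' → All Q es' × Independent (map proj₁ es') × All (Span (map proj₁ es')) (map proj₁ es)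
  independent-sublist [] [] = [] , [] , [] , []
  independent-sublist (e ∷ es) (qe ∷ qes) with independent-sublist es qes
  ... | es' , qs , ind , sp with span? (map proj₁ es') (proj₁ e)
  ... | yes s = es' , qs , ind , s ∷ sp
  ... | no ¬s = e ∷ es' , qe ∷ qs , ¬s ∷ ind , span-here ∷ All.map span-there sp

  module _ (A : Mat n) where
    Eigenpair : U × Carrier → Set ℓ
    Eigenpair (w , ρ) = ¬ w ≋ 0ᵥ × A *ᵥ w ≋ ρ · w

    -- A nonzero eigenvector is kept for each listed value, because minimality needs every listed
    -- value to be a root of each annihilating polynomial.
    spectrum : ∀ es → All Eigenpair es → Σ ℕ λ r → Σ (Vec Carrier r) λ ls →
      (∀ i j → lookup ls i ≈ lookup ls j → i ≡ j) × All (λ e → ∃ λ i → lookup ls i ≈ proj₂ e) es ×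
      (∀ i → ∃ λ w → Eigenpair (w , lookup ls i))
    spectrum [] [] = 0 , [] , (λ ()) , [] , λ ()
    spectrum ((w , ρ) ∷ es) (wρ ∷ wρs) with spectrum es wρs
    ... | r , ls , distinct , covers , occurs with any? (λ i → lookup ls i ≟ ρ)
    ... | yes found = r , ls , distinct , found ∷ covers , occurs
    ... | no ¬found = suc r , ρ ∷ ls , distinct' , (zero , refl) ∷ All.map (λ (i , eq) → suc i , eq) covers ,
        λ { zero → w , wρ ; (suc i) → occurs i }
      where
      distinct' : ∀ i j → lookup (ρ ∷ ls) i ≈ lookup (ρ ∷ ls) j → i ≡ j
      distinct' zero zero _ = ≡.refl
      distinct' zero (suc j) eq = contradiction (j , sym eq) ¬found
      distinct' (suc i) zero eq = contradiction (i , eq) ¬found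
      distinct' (suc i) (suc j) eq = ≡.cong suc (distinct i j eq)

    -- The product over the distinct eigenvalues kills a spanning set, and an annihilating
    -- polynomial has all of them as roots, which bounds its degree from below.
    splitSemisimple : ∀ es → All Eigenpair es → (∀ x → Span (map proj₁ es) x) → SplitSemisimple A
    splitSemisimple es wρs spans with spectrum es wρs
    ... | r , ls , distinct , covers , occurs = r , ls , distinct , annihilates , minimal
      where
      annihilates : evalᴹ (prodLinear ls) A ≈ᴹ 0ᴹ
      annihilates = *ᵥ⇒≈ᴹ (λ x → span-⊆ (agree-isSubspace (*ᵥ-isLinear (evalᴹ (prodLinear ls) A)) (*ᵥ-isLinear 0ᴹ))
        (map⁺ (All.zipWith (λ { {w , ρ} ((i , eq) , (_ , Aw)) j → trans (evalᴹ-eigenvector (prodLinear ls) Aw j)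
          (trans (*-congʳ (peval-prodLinear ls i eq)) (trans (zeroˡ (w j)) (sym (0-*ᵥ w j)))) }) (covers , wρs))) (spans x))
      minimal : ∀ m' (p' : MonicPoly m') → evalᴹ p' A ≈ᴹ 0ᴹ → r ℕ.≤ m'
      minimal m' p' p'A≈0 = distinct-roots ls distinct p' root
        where
        root : ∀ i → peval p' (lookup ls i) ≈ 0#
        root i with occurs i | peval p' (lookup ls i) ≟ 0#
        ... | _ | yes eq = eq
        ... | w , w≉0 , Aw | no ≉0 = contradiction (λ j → *-cancelˡ-≉0 ≉0 (trans (sym (evalᴹ-eigenvector p' Aw j))
                (trans (≈ᴹ⇒*ᵥ p'A≈0 w j) (trans (0-*ᵥ w j) (sym (zeroʳ _)))))) w≉0

  module _ (k : ℕ) {A : Mat n} (eigen : ∀ x → EigenSpan A (λ μ → ∃ λ ρ → ρ ^ k ≈ μ) x) where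
    private
      Root : U × Carrier → Set ℓ
      Root (w , ρ) = A *ᵥ w ≋ (ρ ^ k) · w

      collect : ∀ {x} → EigenSpan A (λ μ → ∃ λ ρ → ρ ^ k ≈ μ) x → ∃ λ es → All Root es × Span (map proj₁ es) x
      collect {x} (eig μ Ax (ρ , ρk)) = (x , ρ) ∷ [] , (λ i → trans (Ax i) (*-congʳ (sym ρk))) ∷ [] , span-here
      collect (zer x≋0) = [] , [] , nil x≋0
      collect (add x≋ ey ez) with collect ey | collect ez
      ... | es , rs , s | es' , rs' , s' = es ++ es' , ++⁺ rs rs' , span-resp (λ i → sym (x≋ i))
        (span-add (≡.subst (λ bs → Span bs _) (≡.sym (map-++ proj₁ es es')) (span-++ˡ s))
                  (≡.subst (λ bs → Span bs _) (≡.sym (map-++ proj₁ es es')) (span-++ʳ (map proj₁ es) s')))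

      collect-all : ∀ {m} (f : Fin m → U) → ∃ λ es → All Root es × (∀ j → Span (map proj₁ es) (f j))
      collect-all {zero} f = [] , [] , λ ()
      collect-all {suc m} f with collect (eigen (f zero)) | collect-all (f ∘ suc)
      ... | es , rs , s | es' , rs' , s' = es ++ es' , ++⁺ rs rs' ,
        λ { zero → ≡.subst (λ bs → Span bs _) (≡.sym (map-++ proj₁ es es')) (span-++ˡ s)
          ; (suc j) → ≡.subst (λ bs → Span bs _) (≡.sym (map-++ proj₁ es es')) (span-++ʳ (map proj₁ es) (s' j)) }

      nonzero : ∀ {bs : List U} → Independent bs → All (λ w → ¬ w ≋ 0ᵥ) bs
      nonzero [] = []
      nonzero {b ∷ bs} (b∉ ∷ ind) = (λ b≋0 → b∉ (span-resp (λ i → sym (b≋0 i)) (span-0 bs))) ∷ nonzero ind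

      from-basis : ∀ es → All Root es → Independent (map proj₁ es) → (∀ x → Span (map proj₁ es) x) →
        Σ (Mat n) λ B → SplitSemisimple B × (B ^ᴹ k) ≈ᴹ A
      from-basis es rs ind spans with extend (map (λ (w , ρ) → w , ρ · w) es)
        (≡.subst Independent (map-∘ es) ind) (λ x → ≡.subst (λ bs → Span bs x) (map-∘ es) (spans x))
      ... | B , values = B ,
        splitSemisimple B es (All.zipWith (λ x → x) (map⁻ (nonzero ind) , map⁻ values)) spans ,
        *ᵥ⇒≈ᴹ (λ x → span-⊆ (agree-isSubspace (*ᵥ-isLinear (B ^ᴹ k)) (*ᵥ-isLinear A))
          (map⁺ (All.zipWith (λ (Bw , Aw) j → trans (^ᴹ-eigenvector k Bw j) (sym (Aw j))) (map⁻ values , rs))) (spans x))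

    abstract
      -- On a basis of eigenvectors of A, B multiplies each by a k-th root of its eigenvalue.
      root : Σ (Mat n) λ B → SplitSemisimple B × (B ^ᴹ k) ≈ᴹ A
      root with collect-all basis
      ... | es , rs , s with independent-sublist es rs
      ... | es' , rs' , ind , sp = from-basis es' rs' ind
        (basis-spans (span-isSubspace (map proj₁ es')) (λ j → span-⊆ (span-isSubspace (map proj₁ es')) sp (s j)))

-- Splitting M into A and B along the chains

module Splitting {c ℓ : Level} (F : CommutativeRing c ℓ) (isField : IsField F) {q : ℕ} (card : HasCardinality F q)
    (k : ℕ) (1≤k : 1 ℕ.≤ k)
    (sum-of-two-units : FiniteFields.Powers.SumsOfTwo F isField card k 1≤k)
    (avoid-four-units : FiniteFields.Powers.AvoidsFour F isField card k 1≤k)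
    {n : ℕ} (M : MatrixDefs.Mat F n) where
  open CommutativeRing F hiding (zero)
  open FiniteFields F isField card
  open Powers k 1≤k
  open IntegerCoefficientSolver F using (solve; _:=_; _:+_; _:*_; _:-_; :-_; con)
  open DiagonalPlans F isField card k 1≤k sum-of-two-units avoid-four-units
  open MatrixDefs F
  open Spans F
  open LinearMaps F
  open FiniteSpans F isField card
  open Matrices n
  open Extension n
  open Eigenvectors F isField card n
  open KrylovChains F isField card (M *ᵥ_) (*ᵥ-isLinear M)
  private
    module M = IsLinear (*ᵥ-isLinear M)
    U : Set c
    U = V (Fin n)

  open Decomposition decomposition
  open Plans (plans-exist a)

  -- With it M has diagonal entry α + β and subdiagonal entry 1 at e.
  next : Carrier → Carrier → U → U
  next α β e = (M *ᵥ e) ⊖ (α + β) · e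

  mutual
    -- The pairs are (e, B e), and A will be M - B. At an A-step and at the end B only scales e,
    -- which leaves to A the subdiagonal entry or the rest of the final column.
    pairsA : ∀ {r β T} → PlanA r β T → U → List (U × U) → List (U × U)
    pairsA (end {u = u} _ _ _ _) e acc = (e , u · e) ∷ acc
    pairsA (stepA {α = α} {β} _ _ _ _ p) e acc = pairsB p (next α β e) ((e , β · e) ∷ acc)

    pairsB : ∀ {r α T} → PlanB r α T → U → List (U × U) → List (U × U)
    pairsB (stepB {α = α} {β} _ _ _ _ p) e acc = pairsA p (next α β e) ((e , β · e ⊹ next α β e) ∷ acc)

  pairs : ∀ {r T} → Plan r T → U → List (U × U) → List (U × U)
  pairs (planA p) = pairsA p
  pairs (planB p) = pairsB p

  CellPlan : Cell → Set (c ⊔ ℓ)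
  CellPlan (r , v , T) = Plan r T

  allPairs : ∀ L → All CellPlan L → List (U × U)
  allPairs [] [] = []
  allPairs ((r , v , T) ∷ L) (p ∷ ps) = pairs p v (allPairs L ps)

  firsts : List (U × U) → List U
  firsts = map proj₁

  chain-M : ∀ {i v x} → Span (chain i v) x → Span (chain (suc i) v) (M *ᵥ x)
  chain-M {i} {v} = span-⊆ (preimage-isSubspace (*ᵥ-isLinear M) (span-isSubspace (chain (suc i) v))) (chain-shift i v)

  -- Such an e is a monic polynomial of degree i in M applied to v, so passing from the powers to
  -- these vectors is unitriangular.
  record Lead (v : U) (i : ℕ) (e : U) : Set (c ⊔ ℓ) where
    field
      lower : Span (chain i v) (e ⊖ pow i v)

    e∈ : Span (chain (suc i) v) e
    e∈ = span-resp (λ j → solve 2 (λ e p → e :- p :+ p := e) refl (e j) (pow i v j)) (span-add (span-there lower) span-here)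

  lead-start : ∀ v → Lead v 0 v
  lead-start v = record { lower = nil (λ j → -‿inverseʳ (v j)) }

  lead-next : ∀ {v i e} α β → Lead v i e → Lead v (suc i) (next α β e)
  lead-next {v} {i} {e} α β lead = record { lower = span-resp
    (λ j → trans (+-congʳ (M.sub e (pow i v) j))
      (solve 4 (λ Me p a e → Me :- p :- a :* e := Me :- a :* e :- p) refl ((M *ᵥ e) j) (pow (suc i) v j) (α + β) (e j)))
    (IsSubspace.sub (span-isSubspace (chain (suc i) v)) (chain-M (Lead.lower lead)) (span-scale (α + β) (Lead.e∈ lead))) }

  record Basis (W : List U) (acc : List (U × U)) : Set (c ⊔ ℓ) where
    field
      independent : Independent (firsts acc)
      acc⊆ : All (Span W) (firsts acc)
      ⊆acc : All (Span (firsts acc)) W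

  module _ {v : U} {W : List U} {R : ℕ} (inv : Invariant W) (¬rel : ¬ Relation R v W) where

    -- Relations persist in higher degrees because W is invariant. Hence failure in the top degree R
    -- gives failure in every lower one, and so independence along the whole chain.
    ¬relation : ∀ {i r} → i ℕ.+ r ≡ R → ¬ Relation i v W
    ¬relation {i} {zero} eq = ≡.subst (λ m → ¬ Relation m v W) (≡.trans (≡.sym eq) (ℕ.+-identityʳ i)) ¬rel
    ¬relation {i} {suc r} eq rel = ¬relation {suc i} {r} (≡.trans (≡.sym (ℕ.+-suc i r)) eq) (relation-suc {i} {v} {W} inv rel)

    advance : ∀ {i r e b acc} → i ℕ.+ r ≡ R → Lead v i e → Basis (chain i v ++ W) acc → Basis (chain (suc i) v ++ W) ((e , b) ∷ acc)
    advance {i} {r} {e} eq lead basis-acc = record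
      { independent = (λ s → ¬relation {i} {r} eq (span-resp (λ j → solve 2 (λ e p → e :- (e :- p) := p) refl (e j) (pow i v j))
          (IsSubspace.sub (span-isSubspace (chain i v ++ W)) (span-mono B.acc⊆ s) (span-++ˡ (Lead.lower lead))))) ∷ B.independent
      ; acc⊆ = span-++ˡ (Lead.e∈ lead) ∷ All.map span-there B.acc⊆
      ; ⊆acc = span-resp (λ j → solve 2 (λ e p → e :- (e :- p) := p) refl (e j) (pow i v j))
            (IsSubspace.sub (span-isSubspace _) span-here (span-there (span-mono B.⊆acc (span-++ˡ (Lead.lower lead)))))
          ∷ All.map span-there B.⊆acc }
      where module B = Basis basis-acc

    mutual
      basisA : ∀ {r i β T e acc} (p : PlanA r β T) → i ℕ.+ r ≡ R → Lead v i e → Basis (chain i v ++ W) acc → Basis (chain (suc R) v ++ W) (pairsA p e acc)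
      basisA {i = i} {e = e} {acc} (end {u = u} _ _ _ _) eq lead b =
        ≡.subst (λ m → Basis (chain (suc m) v ++ W) ((e , u · e) ∷ acc)) (≡.trans (≡.sym (ℕ.+-identityʳ i)) eq) (advance eq lead b)
      basisA {suc r} {i} (stepA {α = α} {β} _ _ _ _ p) eq lead b = basisB p (≡.trans (≡.sym (ℕ.+-suc i r)) eq) (lead-next α β lead) (advance eq lead b)

      basisB : ∀ {r i α T e acc} (p : PlanB r α T) → i ℕ.+ r ≡ R → Lead v i e → Basis (chain i v ++ W) acc → Basis (chain (suc R) v ++ W) (pairsB p e acc)
      basisB {suc r} {i} (stepB {α = α} {β} _ _ _ _ p) eq lead b = basisA p (≡.trans (≡.sym (ℕ.+-suc i r)) eq) (lead-next α β lead) (advance eq lead b)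

  basis-pairs : ∀ {L} → Good L → (ps : All CellPlan L) → Basis (ws L) (allPairs L ps)
  basis-pairs [] [] = record { independent = [] ; acc⊆ = [] ; ⊆acc = [] }
  basis-pairs {(r , v , T) ∷ L} (cell ¬rel _ good) (planA p ∷ ps) =
    basisA {W = ws L} (good-invariant good) ¬rel p ≡.refl (lead-start v) (basis-pairs good ps)
  basis-pairs {(r , v , T) ∷ L} (cell ¬rel _ good) (planB p ∷ ps) =
    basisB {W = ws L} (good-invariant good) ¬rel p ≡.refl (lead-start v) (basis-pairs good ps)

  In-power : ∀ {μ} → In μ → Power μ
  In-power (inj₁ eq) = power-resp (sym eq) (proj₁ unit₁)
  In-power (inj₂ eq) = power-resp (sym eq) (proj₁ unit₂)

  In-resp : ∀ {μ μ'} → μ ≈ μ' → In μ → In μ'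
  In-resp eq (inj₁ p) = inj₁ (trans (sym eq) p)
  In-resp eq (inj₂ p) = inj₂ (trans (sym eq) p)

  powerA : ∀ {r β T} → PlanA r β T → Power β
  powerA (end _ pu _ _) = pu
  powerA (stepA _ pβ _ _ _) = pβ

  module Parts (B : Mat n) where
    A : Mat n
    A i j = M i j - B i j

    A-*ᵥ : ∀ x → A *ᵥ x ≋ (M *ᵥ x) ⊖ (B *ᵥ x)
    A-*ᵥ x i = trans (∑-cong (λ j → solve 3 (λ m b x → (m :- b) :* x := m :* x :+ (:- con (+ 1)) :* (b :* x)) refl (M i j) (B i j) (x j)))
      (trans (∑-+ (λ j → M i j * x j) (λ j → (- 1#) * (B i j * x j))) (trans (+-congˡ (∑-* (- 1#) (λ j → B i j * x j)))
        (solve 2 (λ m b → m :+ (:- con (+ 1)) :* b := m :- b) refl ((M *ᵥ x) i) ((B *ᵥ x) i))))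

    Value : U × U → Set ℓ
    Value (b , t) = B *ᵥ b ≋ t

    mutual
      valuesA : ∀ {r β T e acc} (p : PlanA r β T) → All Value (pairsA p e acc) → All Value acc × B *ᵥ e ≋ β · e
      valuesA (end _ _ _ _) (val ∷ vals) = vals , val
      valuesA (stepA _ _ _ _ p) vals with valuesB p vals
      ... | val ∷ vals' , _ = vals' , val

      valuesB : ∀ {r α T e acc} (p : PlanB r α T) → All Value (pairsB p e acc) → All Value acc × A *ᵥ e ≋ α · e
      valuesB {e = e} (stepB {α = α} {β} _ _ _ _ p) vals with valuesA p vals
      ... | val ∷ vals' , _ = vals' , λ i → trans (A-*ᵥ e i) (trans (+-congˡ (-‿cong (val i)))
        (solve 4 (λ m α β e → m :- (β :* e :+ (m :- (α :+ β) :* e)) := α :* e) refl ((M *ᵥ e) i) α β (e i)))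

    mutual
      -- No two consecutive steps belong to B, so B acts in blocks of one or two vectors, the latter
      -- triangular with distinct diagonal entries.
      eigenB-A : ∀ {r β T e acc} (p : PlanA r β T) → All Value (pairsA p e acc) →
        All (EigenSpan B Power) (firsts acc) → All (EigenSpan B Power) (firsts (pairsA p e acc))
      eigenB-A (end {u = u} _ pu _ _) (val ∷ vals) es = eig u val pu ∷ es
      eigenB-A (stepA {β = β} _ pβ _ _ p) vals es with valuesB p vals
      ... | val ∷ _ , _ = eigenB-B p vals (eig β val pβ ∷ es)

      eigenB-B : ∀ {r α T e acc} (p : PlanB r α T) → All Value (pairsB p e acc) →
        All (EigenSpan B Power) (firsts acc) → All (EigenSpan B Power) (firsts (pairsB p e acc))
      eigenB-B (stepB {β = β} {β'} _ pβ β≉β' _ p) vals es with valuesA p vals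
      ... | val ∷ _ , val' = eigenB-A p vals (eigenSpan-step {P = _≈ β'} (λ eq → power-resp (sym eq) (powerA p)) pβ
              (λ eq eq' → β≉β' (trans (sym eq') eq)) val (eig β' val' refl) ∷ es)

    -- T' is the part of the trace T of the chain that the first i diagonal entries leave over.
    record Trace (v : U) (T : Carrier) (i : ℕ) (e : U) (T' : Carrier) : Set (c ⊔ ℓ) where
      field
        lower : Span (chain i v) (((M *ᵥ e) ⊖ pow (suc i) v) ⊹ (T - T') · pow i v)

    trace-start : ∀ v T → Trace v T 0 v T
    trace-start v T = record { lower = nil (λ j → solve 3 (λ m T v → m :- m :+ (T :- T) :* v := con (+ 0)) refl ((M *ᵥ v) j) T (v j)) }

    trace-next : ∀ {v T i e α β T' T''} → T' ≈ (α + β) + T'' → Trace v T i e T' → Trace v T (suc i) (next α β e) T''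
    trace-next {v} {T} {i} {e} {α} {β} {T'} {T''} T'≈ tr = record { lower = span-resp eq
      (IsSubspace.sub (span-isSubspace (chain (suc i) v)) (chain-M y∈)
        (span-scale (α + β) (IsSubspace.sub (span-isSubspace (chain (suc i) v)) (span-there y∈) (span-scale (T - T') span-here)))) }
      where
      y : U
      y = ((M *ᵥ e) ⊖ pow (suc i) v) ⊹ (T - T') · pow i v
      y∈ : Span (chain i v) y
      y∈ = Trace.lower tr
      My : ∀ j → (M *ᵥ y) j ≈ (M *ᵥ (M *ᵥ e)) j - pow (suc (suc i)) v j + (T - T') * pow (suc i) v j
      My j = trans (M.add ((M *ᵥ e) ⊖ pow (suc i) v) ((T - T') · pow i v) j)
        (+-cong (M.sub (M *ᵥ e) (pow (suc i) v) j) (M.scale (T - T') (pow i v) j))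
      eq : (M *ᵥ y) ⊖ (α + β) · (y ⊖ (T - T') · pow i v) ≋
           ((M *ᵥ next α β e) ⊖ pow (suc (suc i)) v) ⊹ (T - T'') · pow (suc i) v
      eq j = begin
        (M *ᵥ y) j - s * (Me - p₁ + (T - T') * p₀ - (T - T') * p₀)
          ≈⟨ +-congʳ (My j) ⟩
        MMe - p₂ + (T - T') * p₁ - s * (Me - p₁ + (T - T') * p₀ - (T - T') * p₀)
          ≈⟨ solve 8 (λ MMe Me p₀ p₁ p₂ T T' s → MMe :- p₂ :+ (T :- T') :* p₁ :- s :* (Me :- p₁ :+ (T :- T') :* p₀ :- (T :- T') :* p₀)
               := (MMe :- s :* Me :- p₂) :+ (T :- T' :+ s) :* p₁) refl MMe Me p₀ p₁ p₂ T T' s ⟩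
        (MMe - s * Me - p₂) + (T - T' + s) * p₁
          ≈⟨ +-cong (+-congʳ (sym (trans (M.sub (M *ᵥ e) (s · e) j) (+-congˡ (-‿cong (M.scale s e j))))))
                    (*-congʳ (trans (+-congʳ (+-congˡ (-‿cong T'≈))) (solve 3 (λ T s T'' → T :- (s :+ T'') :+ s := T :- T'') refl T s T''))) ⟩
        ((M *ᵥ next α β e) j - p₂) + (T - T'') * p₁ ∎
        where
        open import Relation.Binary.Reasoning.Setoid setoid
        MMe Me p₀ p₁ p₂ s : Carrier
        MMe = (M *ᵥ (M *ᵥ e)) j
        Me = (M *ᵥ e) j
        p₀ = pow i v j
        p₁ = pow (suc i) v j
        p₂ = pow (suc (suc i)) v j
        s = α + β

    module _ {v : U} {T : Carrier} {R : ℕ} {N : List U} (rel : Span (chain R v ++ N) (pow (suc R) v ⊖ T · pow R v))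
        (N⊆ : All (EigenSpan A In) N) where

      -- Non-final vectors need the sharper `In`, since the final vectors of this and of newer cells
      -- are sent by A to multiples of themselves plus non-final vectors; for the final vectors
      -- `Power` suffices.
      Result : List (U × U) → List (U × U) → Set (c ⊔ ℓ)
      Result acc acc' = All (EigenSpan A In) (chain R v) × (All (EigenSpan A Power) (firsts acc) → All (EigenSpan A Power) (firsts acc'))

      chain-eigen : ∀ {i e} → Lead v i e → All (EigenSpan A In) (chain i v) → EigenSpan A In e → All (EigenSpan A In) (chain (suc i) v)
      chain-eigen {i} {e} lead es ee = eigenSpan-resp (λ j → solve 2 (λ e p → e :- (e :- p) := p) refl (e j) (pow i v j))
        (IsSubspace.sub eigenSpan-isSubspace ee (span-⊆ eigenSpan-isSubspace es (Lead.lower lead))) ∷ es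

      -- Modulo non-final vectors M e is T' e, by the relation of the cell and the trace already
      -- spent. B takes u e, so A has the entry t, which differs from all its eigenvalues on the
      -- non-final part.
      eigen-end : ∀ {e t u T'} → Power t → ¬ In t → T' ≈ t + u → B *ᵥ e ≋ u · e → Lead v R e → Trace v T R e T' →
        All (EigenSpan A In) (chain R v) → EigenSpan A Power e
      eigen-end {e} {t} {u} {T'} pt t∉ T'≈ Be lead tr es = eigenSpan-step {P = In} In-power pt (λ μ∈ μ≈t → t∉ (In-resp μ≈t μ∈)) eq
        (span-⊆ eigenSpan-isSubspace (++⁺ es N⊆)
          (span-add rel (span-++ˡ {bs = N} (IsSubspace.sub (span-isSubspace (chain R v)) (Trace.lower tr) (span-scale T' (Lead.lower lead))))))
        where
        eq : A *ᵥ e ≋ t · e ⊹ ((pow (suc R) v ⊖ T · pow R v) ⊹ ((((M *ᵥ e) ⊖ pow (suc R) v) ⊹ (T - T') · pow R v) ⊖ T' · (e ⊖ pow R v)))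
        eq j = trans (A-*ᵥ e j) (trans (+-congˡ (-‿cong (Be j))) (trans
          (solve 7 (λ m t u e p₁ p₀ T → m :- u :* e :=
              t :* e :+ ((p₁ :- T :* p₀) :+ (((m :- p₁) :+ (T :- (t :+ u)) :* p₀) :- (t :+ u) :* (e :- p₀)))) refl
              ((M *ᵥ e) j) t u (e j) (pow (suc R) v j) (pow R v j) T)
            (+-congˡ (+-congˡ (+-cong (+-congˡ (*-congʳ (+-congˡ (-‿cong (sym T'≈))))) (-‿cong (*-congʳ (sym T'≈))))))))

      mutual
        eigenA-A : ∀ {r i β T' e acc} (p : PlanA r β T') → i ℕ.+ r ≡ R → Lead v i e → Trace v T i e T' →
          All (EigenSpan A In) (chain i v) → All Value (pairsA p e acc) → Result acc (pairsA p e acc)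
        eigenA-A {i = i} (end pt _ t∉ T'≈) eq lead tr es (val ∷ vals) with ≡.trans (≡.sym (ℕ.+-identityʳ i)) eq
        ... | ≡.refl = es , λ as → eigen-end pt t∉ T'≈ val lead tr es ∷ as
        eigenA-A {suc r} {i} {e = e} (stepA {α = α} {β} {α'} α∈ _ α≉α' T'≈ p) eq lead tr es vals =
          let (es' , f) = eigenA-B p (≡.trans (≡.sym (ℕ.+-suc i r)) eq) (lead-next α β lead) (trace-next T'≈ tr) (chain-eigen lead es ee) vals
          in es' , λ as → f (eigenSpan-map In-power ee ∷ as)
          where
          Be : B *ᵥ e ≋ β · e
          Be = All.head (proj₁ (valuesB p vals))
          ee : EigenSpan A In e
          ee = eigenSpan-step {P = _≈ α'} (λ μ≈α' → In-resp (sym μ≈α') (firstB p)) α∈ (λ μ≈α' μ≈α → α≉α' (trans (sym μ≈α) μ≈α'))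
            (λ j → trans (A-*ᵥ e j) (trans (+-congˡ (-‿cong (Be j)))
              (solve 4 (λ m α β e → m :- β :* e := α :* e :+ (m :- (α :+ β) :* e)) refl ((M *ᵥ e) j) α β (e j))))
            (eig α' (proj₂ (valuesB p vals)) refl)
            where
            firstB : ∀ {r α T} → PlanB r α T → In α
            firstB (stepB α∈ _ _ _ _) = α∈

        eigenA-B : ∀ {r i α T' e acc} (p : PlanB r α T') → i ℕ.+ r ≡ R → Lead v i e → Trace v T i e T' →
          All (EigenSpan A In) (chain i v) → All Value (pairsB p e acc) → Result acc (pairsB p e acc)
        eigenA-B {suc r} {i} {e = e} p'@(stepB {α = α} {β} α∈ _ _ T'≈ p) eq lead tr es vals =
          let (es' , f) = eigenA-A p (≡.trans (≡.sym (ℕ.+-suc i r)) eq) (lead-next α β lead) (trace-next T'≈ tr) (chain-eigen lead es ee) vals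
          in es' , λ as → f (eigenSpan-map In-power ee ∷ as)
          where
          ee : EigenSpan A In e
          ee = eig α (proj₂ (valuesB p' vals)) α∈

    eigenvectors : ∀ {L} → Good L → (ps : All CellPlan L) → All Value (allPairs L ps) →
      All (EigenSpan A In) (ns L) × All (EigenSpan A Power) (firsts (allPairs L ps)) × All (EigenSpan B Power) (firsts (allPairs L ps))
    eigenvectors [] [] [] = [] , [] , []
    eigenvectors {(r , v , T) ∷ L} (cell _ rel good) (planA p ∷ ps) vals =
      let (nsA , as , bs) = eigenvectors good ps (proj₁ (valuesA p vals))
          (es , f) = eigenA-A rel nsA p ≡.refl (lead-start v) (trace-start v T) [] vals
      in ++⁺ es nsA , f as , eigenB-A p vals bs
    eigenvectors {(r , v , T) ∷ L} (cell _ rel good) (planB p ∷ ps) vals =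
      let (nsA , as , bs) = eigenvectors good ps (proj₁ (valuesB p vals))
          (es , f) = eigenA-B rel nsA p ≡.refl (lead-start v) (trace-start v T) [] vals
      in ++⁺ es nsA , f as , eigenB-B p vals bs

  cellPlans : All CellPlan cells
  cellPlans = All.map (λ {C} z → plan (proj₁ C) (proj₂ (proj₂ C)) z) end-scalar

  split : Σ (Mat n) λ A → Σ (Mat n) λ B → SplitSemisimple A × SplitSemisimple B × M ≈ᴹ ((A ^ᴹ k) +ᴹ (B ^ᴹ k))
  split = assemble (extend (allPairs cells cellPlans) (Basis.independent basis-all) spans)
    where
    basis-all : Basis (ws cells) (allPairs cells cellPlans)
    basis-all = basis-pairs good cellPlans
    spans : ∀ x → Span (firsts (allPairs cells cellPlans)) x
    spans x = span-mono (Basis.⊆acc basis-all) (spanning x)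
    assemble : (∃ λ (B : Mat n) → All (λ (b , t) → (B *ᵥ b) ≋ t) (allPairs cells cellPlans)) →
      Σ (Mat n) λ A → Σ (Mat n) λ B → SplitSemisimple A × SplitSemisimple B × M ≈ᴹ ((A ^ᴹ k) +ᴹ (B ^ᴹ k))
    assemble (B , values) =
      let open Parts B
          (_ , as , bs) = eigenvectors good cellPlans values
          (A' , ssA , A'k) = root k (λ x → span-⊆ (eigenSpan-isSubspace {A = A} {P = Power}) as (spans x))
          (B' , ssB , B'k) = root k (λ x → span-⊆ (eigenSpan-isSubspace {A = B} {P = Power}) bs (spans x))
      in A' , B' , ssA , ssB , λ i j → trans (solve 2 (λ m b → m := m :- b :+ b) refl (M i j) (B i j)) (+-cong (sym (A'k i j)) (sym (B'k i j)))

open import Data.Nat using (_+_; _*_; _∸_; _^_; _≤_)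

theorem1p7 : ∀ {c ℓ : Level} (F : CommutativeRing c ℓ) → IsField F →
    (p l q : ℕ) → Prime p → q ≡ p ^ l → HasCardinality F q →
    (n k : ℕ) → 2 ≤ n → 1 ≤ k →
    (d : ℕ) → d ≡ gcd k (q ∸ 1) →
    (d ∸ 1) ^ 4 + 6 * d ≤ q →
    (M : MatrixDefs.Mat F n) →
    Σ (MatrixDefs.Mat F n) λ A → Σ (MatrixDefs.Mat F n) λ B →
    MatrixDefs.SplitSemisimple F A × MatrixDefs.SplitSemisimple F B ×
    MatrixDefs._≈ᴹ_ F M (MatrixDefs._+ᴹ_ F (MatrixDefs._^ᴹ_ F A k) (MatrixDefs._^ᴹ_ F B k))
theorem1p7 F isField p l q _ _ card n k _ 1≤k d ≡.refl bound M =
  Splitting.split F isField card k 1≤k sum-of-two-units avoid-four-units M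
  where open FiniteFields.Powers.LargeFieldPowers F isField card k 1≤k bound
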